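{- Let $0<s<t<1$ be real numbers. For almost all $\alpha\in(s,t)$ and for every $\epsilon>0$, there exists $x_0=x_0(\alpha,s,t,\epsilon)>1$ such that for every $x\geq x_0$, we have $$\#T_{\leq x}(\alpha)\geq (1-t)\min(1-t,\,2s)\,\frac{\log(16x)}{16\log(1+\sqrt{2})+\epsilon}.$$ In particular, $T(\alpha)$ is infinite for almost all $\alpha\in(0,1)$.
   Context: "Almost all" is with respect to the $1$-dimensional Lebesgue measure. $\mathbb{N}$ is the set of positive integers; $\lfloor x\rfloor$ is the integer part (floor) of $x$. For $X\subseteq\mathbb{N}$, $T(X)$ is the set of all tuples $(k,\ell,m)\in\mathbb{N}^3$ with $k\leq \ell\leq m$ such that all of $k,\ \ell,\ m,\ k+\ell,\ \ell+m,\ m+k,\ k+\ell+m$ belong to $X$. For $\alpha>0$, let $S(\alpha)=\{\lfloor \alpha n^2\rfloor : n\in\mathbb{N},\ n\geq \alpha^{ -1/2}\}$ and $T(\alpha)=T(S(\alpha))$. For $\alpha>0$ and $x>1$, let $T_{\leq x}(\alpha)=\{(\lfloor \alpha n_1^2\rfloor,\lfloor\alpha n_2^2\rfloor,\lfloor\alpha n_3^2\rfloor)\in T(\alpha) : n_1,n_2,n_3\in[\alpha^{ -1/2},x]\cap\mathbb{N}\}$. -}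

module Defs where

open import Algebra.Bundles using (CommutativeRing; Semiring)
import Algebra.Construct.NaturalChoice.Min as Min
import Algebra.Definitions.RawSemiring as RawSemiringDefinitions
open import Axiom.ExcludedMiddle using (ExcludedMiddle)
open import Data.Fin.Base using (toℕ)
open import Data.List.Base using (List; length)
open import Data.List.Membership.Propositional using (_∈_)
open import Data.List.Relation.Unary.Unique.Propositional using (Unique)
open import Data.Nat.Base as ℕ using (ℕ; _!)
open import Data.Product.Base using (∃; Σ-syntax; ∃-syntax; _×_; _,_)
open import Function.Bundles using (_⇔_)
open import Level using (0ℓ; suc)
open import Relation.Binary.Bundles using (StrictTotalOrder; DecTotalOrder)
open import Relation.Binary.Core using (Rel)
open import Relation.Binary.PropositionalEquality.Core using (_≡_)
open import Relation.Binary.Structures using (IsStrictTotalOrder)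
import Relation.Binary.Properties.StrictTotalOrder as StrictTotalOrderProperties
open import Relation.Nullary.Decidable.Core using (yes; no)
open import Relation.Nullary.Negation.Core using (¬_)
open import Relation.Unary using (Pred)

-- The library has no real numbers; they enter, as in classical analysis, as
-- a Dedekind-complete ordered field, which is unique up to isomorphism.
-- The value of 0# ⁻¹ is left unspecified.
record CompleteOrderedField : Set (suc 0ℓ) where
  infix  4 _<_ _≤_
  infix  8 _⁻¹
  infixl 7 _/_

  field
    commutativeRing : CommutativeRing 0ℓ 0ℓ

  open CommutativeRing commutativeRing public

  field
    _<_                : Rel Carrier 0ℓ
    isStrictTotalOrder : IsStrictTotalOrder _≈_ _<_
    0#<1#              : 0# < 1#
    +-monoʳ-<          : ∀ x {y z} → y < z → x + y < x + z
    *-pos              : ∀ {x y} → 0# < x → 0# < y → 0# < x * y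
    _⁻¹                : Carrier → Carrier
    ⁻¹-inverseʳ        : ∀ {x} → ¬ (x ≈ 0#) → x * x ⁻¹ ≈ 1#

  strictTotalOrder : StrictTotalOrder 0ℓ 0ℓ 0ℓ
  strictTotalOrder = record { isStrictTotalOrder = isStrictTotalOrder }

  decTotalOrder : DecTotalOrder 0ℓ 0ℓ 0ℓ
  decTotalOrder = StrictTotalOrderProperties.decTotalOrder strictTotalOrder

  _≤_ : Rel Carrier 0ℓ
  _≤_ = DecTotalOrder._≤_ decTotalOrder

  open Min (DecTotalOrder.totalOrder decTotalOrder) public using (_⊓_)

  _/_ : Carrier → Carrier → Carrier
  x / y = x * y ⁻¹

  UpperBound : Pred Carrier 0ℓ → Pred Carrier 0ℓ
  UpperBound P u = ∀ x → P x → x ≤ u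

  field
    supremum : ∀ (P : Pred Carrier 0ℓ) → ∃ P → ∃ (UpperBound P) →
               ∃[ s ] UpperBound P s × (∀ u → UpperBound P u → s ≤ u)

Triple : Set
Triple = ℕ × ℕ × ℕ

-- The set ℕ of positive integers is rendered by an explicit bound 1 ≤ _.
T : Pred ℕ 0ℓ → Pred Triple 0ℓ
T X (k , l , m) =
  1 ℕ.≤ k × k ℕ.≤ l × l ℕ.≤ m ×
  X k × X l × X m × X (k ℕ.+ l) × X (l ℕ.+ m) × X (m ℕ.+ k) × X (k ℕ.+ l ℕ.+ m)

HasCardinality : {A : Set} → Pred A 0ℓ → ℕ → Set
HasCardinality P c = ∃[ xs ] Unique xs × (∀ x → P x ⇔ x ∈ xs) × length xs ≡ c

Infinite : {A : Set} → Pred A 0ℓ → Set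
Infinite {A} P = ¬ (∃[ xs ] (∀ x → P x → x ∈ xs))

-- Excluded middle is the ambient logic of classical analysis; here it also
-- makes limits, square roots and logarithms total functions.
module Analysis (em : ExcludedMiddle 0ℓ) (R : CompleteOrderedField) where

  open CompleteOrderedField R public
    using (_≈_; _<_; _≤_; _+_; _*_; -_; _-_; 0#; 1#; _⁻¹; _/_; _⊓_)
    renaming (Carrier to ℝ)
  open RawSemiringDefinitions
    (Semiring.rawSemiring (CompleteOrderedField.semiring R))
    using (_^_; sum)
    renaming (_×_ to _×ℝ_)

  fromℕ : ℕ → ℝ
  fromℕ n = n ×ℝ 1#

  -- Definite description: "the x such that P x", with the junk value 0# if
  -- there is none. It is only applied to properties that determine x up to _≈_.
  the : Pred ℝ 0ℓ → ℝ
  the P with em {∃ P}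
  ... | yes (x , _) = x
  ... | no _        = 0#

  -- f 0 + f 1 + … + f (n - 1)
  ∑< : ℕ → (ℕ → ℝ) → ℝ
  ∑< n f = sum {n} (λ i → f (toℕ i))

  Converges : (ℕ → ℝ) → ℝ → Set
  Converges u l = ∀ ε → 0# < ε → ∃[ N ] (∀ n → N ℕ.≤ n → l - ε < u n × u n < l + ε)

  lim : (ℕ → ℝ) → ℝ
  lim u = the (Converges u)

  infix 8 √_
  √_ : ℝ → ℝ
  √ x = the (λ y → 0# ≤ y × y * y ≈ x)

  exp : ℝ → ℝ
  exp x = lim (λ n → ∑< n (λ i → x ^ i / fromℕ (i !)))

  log : ℝ → ℝ
  log y = the (λ x → exp x ≈ y)

  -- k = ⌊ x ⌋; natural k suffices because only x ≥ 0 occurs.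
  IsFloor : ℝ → ℕ → Set
  IsFloor x k = fromℕ k ≤ x × x < fromℕ k + 1#

  -- Lebesgue null sets of the line: for every ε > 0 there is a cover by
  -- countably many open intervals of total length at most ε.
  Null : Pred ℝ 0ℓ → Set
  Null A = ∀ ε → 0# < ε →
    Σ[ a ∈ (ℕ → ℝ) ] Σ[ b ∈ (ℕ → ℝ) ]
      (∀ i → a i ≤ b i) ×
      (∀ x → A x → ∃[ i ] (a i < x × x < b i)) ×
      (∀ n → ∑< n (λ i → b i - a i) ≤ ε)

  ForAlmostAll∈⟨_,_⟩ : ℝ → ℝ → Pred ℝ 0ℓ → Set
  ForAlmostAll∈⟨ s , t ⟩ P = Null (λ α → s < α × α < t × ¬ P α)

  -- k = ⌊ α n² ⌋ with n a positive integer and n ≥ α^(-1/2)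
  SFrom : ℝ → ℕ → Pred ℕ 0ℓ
  SFrom α n k = 1 ℕ.≤ n × (√ α) ⁻¹ ≤ fromℕ n × IsFloor (α * fromℕ n ^ 2) k

  S : ℝ → Pred ℕ 0ℓ
  S α k = ∃[ n ] SFrom α n k

  T≤ : ℝ → ℝ → Pred Triple 0ℓ
  T≤ x α (k , l , m) =
    T (S α) (k , l , m) ×
    ∃[ n₁ ] ∃[ n₂ ] ∃[ n₃ ]
      (SFrom α n₁ k × fromℕ n₁ ≤ x) ×
      (SFrom α n₂ l × fromℕ n₂ ≤ x) ×
      (SFrom α n₃ m × fromℕ n₃ ≤ x)

{-# OPTIONS --safe #-}
-- Let (b , d) run through the solutions (1 , 3), (6 , 17), (35 , 99), … of
-- d² = 8b² + 1 and put a = 2b, e = 2b², c = e - 1, g = e + 1. Then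
-- 2a² + 1 = d², a² + c² = e² + 1 and 2a² + c² = g². Hence, writing u and w for
-- the fractional parts of αa² and αe², the triple (⌊αa²⌋ , ⌊αa²⌋ , ⌊αc²⌋) lies
-- in T(α) as soon as 2u + α < 1, u + w + α < 1 and u ≤ w + α. For s < α < t and
-- β = (1 - t)/2 this holds on the rectangle 0 ≤ u < β, max(0 , β - s) ≤ w < β,
-- whose area is (1 - t) min(1 - t , 2s) / 4. Since 16e ≤ (1 + √2)^(4(n+1)) for the
-- n-th solution, about log(16x) / (4 log(1 + √2)) solutions are available up
-- to x, and it remains to show that for almost all α the point (u , w) visits the
-- rectangle with at least the expected frequency.
--
-- On a grid of mesh 1/Q, with Q a common multiple of all frequencies involved,
-- this is a counting problem. The count splits as
-- M²IJ - pv = M·I(MJ - v) + v(MI - p), where the indicators I (frequency a²)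
-- and J (frequency e²) have means p/M and v/M. Both terms are lacunary sums whose
-- second moments are bounded through summation by parts, the variation of the
-- slower factors being small against the period of the fastest one. Chebyshev's
-- inequality and the Borel–Cantelli lemma along the lengths N = M⁶ conclude.
module Submission where

open import Defs
import Algebra.Construct.NaturalChoice.Min as Min
import Algebra.Properties.AbelianGroup as AbelianGroupProperties
import Algebra.Properties.Ring as RingProperties
import Algebra.Properties.Semiring.Exp as Exp
import Algebra.Properties.Semiring.Mult as Mult
import Algebra.Solver.Ring
open import Algebra.Solver.Ring.AlmostCommutativeRing using (fromCommutativeRing; _-Raw-AlmostCommutative⟶_)
open import Axiom.ExcludedMiddle using (ExcludedMiddle)
open import Data.Empty using (⊥; ⊥-elim)
open import Data.Integer.Base as ℤ using (ℤ; +_; -[1+_]; _⊖_; 0ℤ; 1ℤ; ∣_∣)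
import Data.Integer.Properties as ℤ
import Data.Integer.Tactic.RingSolver as ℤ-Solver
open import Data.List.Base using (List; []; _∷_; _++_; length; filter; upTo; cartesianProduct)
open import Data.List.Membership.Propositional using (_∈_)
open import Data.List.Membership.Propositional.Properties using (∈-∃++; ∈-++⁻; ∈-++⁺ˡ; ∈-++⁺ʳ; ∈-filter⁺; ∈-filter⁻; ∈-cartesianProduct⁺; ∈-upTo⁺)
open import Data.List.Properties using (length-++)
import Data.List.Relation.Unary.All as All
open import Data.List.Relation.Unary.AllPairs using ([]; _∷_)
open import Data.List.Relation.Unary.Any using (here; there)
open import Data.List.Relation.Unary.Unique.Propositional using (Unique)
import Data.List.Relation.Unary.Unique.Propositional.Properties as Unique
import Data.Maybe.Base as Maybe
open import Data.Nat.Base as ℕ using (ℕ; zero; suc; NonZero; _∸_; _!)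
import Data.Nat.Divisibility as ℕ
import Data.Nat.DivMod as ℕ
import Data.Nat.Properties as ℕ
import Data.Nat.Tactic.RingSolver as ℕ-Solver
open import Data.Product.Base using (∃; ∃-syntax; _×_; _,_; proj₁; proj₂)
open import Data.Sum.Base using (_⊎_; inj₁; inj₂; [_,_]′)
open import Function.Bundles using (mk⇔)
open import Level using (0ℓ)
open import Relation.Binary.Bundles using (StrictTotalOrder; DecTotalOrder)
open import Relation.Binary.Definitions using (tri<; tri≈; tri>)
open import Relation.Binary.PropositionalEquality as ≡ using (_≡_; _≢_)
open import Relation.Nullary using (¬_; yes; no; Dec)
open import Relation.Nullary.Decidable.Core using (dec⇒maybe)
open import Relation.Unary using (Pred)

-- The two coordinates u and w behave as if independent because the frequencies live on different
-- scales: e² is a quarter of the square of a², so αe² makes b² turns while αa² makes one, and both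
-- frequencies grow at least ninefold from one solution to the next. Every term of the split
-- therefore contains a factor whose mean over its own period is exactly zero, and all the rest
-- enters only through its variation. The grid makes these means exact integers, and its exceptional
-- cells are already the intervals by which a null set has to be covered.
--
-- The exponent 6 balances two demands. The tolerated relative deviation must shrink with the mesh
-- of the arcs; taken as 1/(4M²), it leaves a proportion of at most 96M⁴/N exceptional cells, and N
-- = M⁶ makes this summable. At the same time the ratio of consecutive lengths tends to 1, so that
-- the passage from these lengths to an arbitrary x costs nothing in the constant.
--
-- Infinitude on (0 , 1) is not derived from a union over s and t: the shrinking square of side 1/M
-- at the origin serves all α at once.

∑ : ℕ → (ℕ → ℤ) → ℤ
∑ zero    f = 0ℤ
∑ (suc n) f = ∑ n f ℤ.+ f n

∑ℕ : ℕ → (ℕ → ℕ) → ℕ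
∑ℕ zero    f = 0
∑ℕ (suc n) f = ∑ℕ n f ℕ.+ f n

∑-cong : ∀ n {f g} → (∀ i → f i ≡ g i) → ∑ n f ≡ ∑ n g
∑-cong zero    e = ≡.refl
∑-cong (suc n) e = ≡.cong₂ ℤ._+_ (∑-cong n e) (e n)

∑-+ : ∀ n f g → ∑ n (λ i → f i ℤ.+ g i) ≡ ∑ n f ℤ.+ ∑ n g
∑-+ zero    f g = ≡.refl
∑-+ (suc n) f g rewrite ∑-+ n f g = lemma (∑ n f) (∑ n g) (f n) (g n)
  where
  lemma : ∀ a b c d → (a ℤ.+ b) ℤ.+ (c ℤ.+ d) ≡ (a ℤ.+ c) ℤ.+ (b ℤ.+ d)
  lemma = ℤ-Solver.solve-∀

∑-*ˡ : ∀ n c f → ∑ n (λ i → c ℤ.* f i) ≡ c ℤ.* ∑ n f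
∑-*ˡ zero    c f = ≡.sym (ℤ.*-zeroʳ c)
∑-*ˡ (suc n) c f rewrite ∑-*ˡ n c f = ≡.sym (ℤ.*-distribˡ-+ c (∑ n f) (f n))

∑-const : ∀ n c → ∑ n (λ _ → c) ≡ + n ℤ.* c
∑-const zero    c = ≡.refl
∑-const (suc n) c rewrite ∑-const n c = ≡.trans (ℤ.+-comm (+ n ℤ.* c) c) (≡.sym (ℤ.suc-* (+ n) c))

∑-split : ∀ m n f → ∑ (m ℕ.+ n) f ≡ ∑ m f ℤ.+ ∑ n (λ i → f (m ℕ.+ i))
∑-split m zero    f rewrite ℕ.+-identityʳ m = ≡.sym (ℤ.+-identityʳ _)
∑-split m (suc n) f rewrite ℕ.+-suc m n | ∑-split m n f = ℤ.+-assoc (∑ m f) _ _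

∑-pos : ∀ n f → ∑ n (λ i → + f i) ≡ + ∑ℕ n f
∑-pos zero    f = ≡.refl
∑-pos (suc n) f rewrite ∑-pos n f = ≡.refl

∣∑∣≤∑ℕ : ∀ n {f g} → (∀ i → ∣ f i ∣ ℕ.≤ g i) → ∣ ∑ n f ∣ ℕ.≤ ∑ℕ n g
∣∑∣≤∑ℕ zero p = ℕ.z≤n
∣∑∣≤∑ℕ (suc n) {f} p =
  ℕ.≤-trans (ℤ.∣i+j∣≤∣i∣+∣j∣ (∑ n f) (f n)) (ℕ.+-mono-≤ (∣∑∣≤∑ℕ n p) (p n))

∑ℕ-mono : ∀ n {f g} → (∀ i → f i ℕ.≤ g i) → ∑ℕ n f ℕ.≤ ∑ℕ n g
∑ℕ-mono zero    p = ℕ.z≤n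
∑ℕ-mono (suc n) p = ℕ.+-mono-≤ (∑ℕ-mono n p) (p n)

∑ℕ-+ : ∀ n f g → ∑ℕ n (λ i → f i ℕ.+ g i) ≡ ∑ℕ n f ℕ.+ ∑ℕ n g
∑ℕ-+ zero    f g = ≡.refl
∑ℕ-+ (suc n) f g rewrite ∑ℕ-+ n f g = lemma (∑ℕ n f) (∑ℕ n g) (f n) (g n)
  where
  lemma : ∀ a b c d → (a ℕ.+ b) ℕ.+ (c ℕ.+ d) ≡ (a ℕ.+ c) ℕ.+ (b ℕ.+ d)
  lemma = ℕ-Solver.solve-∀

∑ℕ-*ˡ : ∀ n c f → ∑ℕ n (λ i → c ℕ.* f i) ≡ c ℕ.* ∑ℕ n f
∑ℕ-*ˡ zero    c f = ≡.sym (ℕ.*-zeroʳ c)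
∑ℕ-*ˡ (suc n) c f rewrite ∑ℕ-*ˡ n c f = ≡.sym (ℕ.*-distribˡ-+ c (∑ℕ n f) (f n))

∑ℕ-const : ∀ n c → ∑ℕ n (λ _ → c) ≡ n ℕ.* c
∑ℕ-const zero    c = ≡.refl
∑ℕ-const (suc n) c rewrite ∑ℕ-const n c = ℕ.+-comm (n ℕ.* c) c

∑ℕ-shift : ∀ n f → ∑ℕ n (λ i → f (suc i)) ℕ.+ f 0 ≡ ∑ℕ n f ℕ.+ f n
∑ℕ-shift zero    f = ≡.refl
∑ℕ-shift (suc n) f = ≡.trans (lemma (∑ℕ n (λ i → f (suc i))) (f (suc n)) (f 0))
  (≡.cong (ℕ._+ f (suc n)) (∑ℕ-shift n f))
  where
  lemma : ∀ a b c → (a ℕ.+ b) ℕ.+ c ≡ (a ℕ.+ c) ℕ.+ b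
  lemma = ℕ-Solver.solve-∀

-- Total variation and summation by parts

variation : ℕ → (ℕ → ℤ) → ℕ
variation n u = ∑ℕ n (λ i → ∣ u (suc i) ℤ.- u i ∣)

variation-+ : ∀ n u v → variation n (λ i → u i ℤ.+ v i) ℕ.≤ variation n u ℕ.+ variation n v
variation-+ n u v = ℕ.≤-trans
  (∑ℕ-mono n (λ i → ℕ.≤-trans (ℕ.≤-reflexive (≡.cong ∣_∣ (lemma (u (suc i)) (v (suc i)) (u i) (v i))))
    (ℤ.∣i+j∣≤∣i∣+∣j∣ (u (suc i) ℤ.- u i) (v (suc i) ℤ.- v i))))
  (ℕ.≤-reflexive (∑ℕ-+ n _ _))
  where
  lemma : ∀ a b c d → (a ℤ.+ b) ℤ.- (c ℤ.+ d) ≡ (a ℤ.- c) ℤ.+ (b ℤ.- d)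
  lemma = ℤ-Solver.solve-∀

variation-* : ∀ n u v {U V} → (∀ i → ∣ u i ∣ ℕ.≤ U) → (∀ i → ∣ v i ∣ ℕ.≤ V) →
  variation n (λ i → u i ℤ.* v i) ℕ.≤ U ℕ.* variation n v ℕ.+ V ℕ.* variation n u
variation-* n u v {U} {V} ∣u∣≤ ∣v∣≤ = ℕ.≤-trans
  (∑ℕ-mono n (λ i → begin
    ∣ u (suc i) ℤ.* v (suc i) ℤ.- u i ℤ.* v i ∣
      ≡⟨ ≡.cong ∣_∣ (lemma (u (suc i)) (v (suc i)) (u i) (v i)) ⟩
    ∣ u (suc i) ℤ.* (v (suc i) ℤ.- v i) ℤ.+ v i ℤ.* (u (suc i) ℤ.- u i) ∣
      ≤⟨ ℤ.∣i+j∣≤∣i∣+∣j∣ (u (suc i) ℤ.* (v (suc i) ℤ.- v i)) (v i ℤ.* (u (suc i) ℤ.- u i)) ⟩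
    ∣ u (suc i) ℤ.* (v (suc i) ℤ.- v i) ∣ ℕ.+ ∣ v i ℤ.* (u (suc i) ℤ.- u i) ∣
      ≡⟨ ≡.cong₂ ℕ._+_ (ℤ.abs-* (u (suc i)) (v (suc i) ℤ.- v i)) (ℤ.abs-* (v i) (u (suc i) ℤ.- u i)) ⟩
    ∣ u (suc i) ∣ ℕ.* ∣ v (suc i) ℤ.- v i ∣ ℕ.+ ∣ v i ∣ ℕ.* ∣ u (suc i) ℤ.- u i ∣
      ≤⟨ ℕ.+-mono-≤ (ℕ.*-monoˡ-≤ _ (∣u∣≤ (suc i))) (ℕ.*-monoˡ-≤ _ (∣v∣≤ i)) ⟩
    U ℕ.* ∣ v (suc i) ℤ.- v i ∣ ℕ.+ V ℕ.* ∣ u (suc i) ℤ.- u i ∣ ∎))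
  (ℕ.≤-reflexive (≡.trans (∑ℕ-+ n _ _) (≡.cong₂ ℕ._+_ (∑ℕ-*ˡ n U _) (∑ℕ-*ˡ n V _))))
  where
  open ℕ.≤-Reasoning
  lemma : ∀ a b c d → a ℤ.* b ℤ.- c ℤ.* d ≡ a ℤ.* (b ℤ.- d) ℤ.+ d ℤ.* (a ℤ.- c)
  lemma = ℤ-Solver.solve-∀

summation-by-parts : ∀ n (u φ : ℕ → ℤ) → ∑ n (λ i → u i ℤ.* φ i) ≡
  u n ℤ.* ∑ n φ ℤ.- ∑ n (λ i → (u (suc i) ℤ.- u i) ℤ.* ∑ (suc i) φ)
summation-by-parts zero u φ = lemma (u 0)
  where
  lemma : ∀ a → 0ℤ ≡ a ℤ.* 0ℤ ℤ.- 0ℤ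
  lemma = ℤ-Solver.solve-∀
summation-by-parts (suc n) u φ rewrite summation-by-parts n u φ =
  lemma (u n) (u (suc n)) (∑ n φ) (φ n) (∑ n (λ i → (u (suc i) ℤ.- u i) ℤ.* ∑ (suc i) φ))
  where
  lemma : ∀ a a′ s x t → (a ℤ.* s ℤ.- t) ℤ.+ a ℤ.* x ≡ a′ ℤ.* (s ℤ.+ x) ℤ.- (t ℤ.+ (a′ ℤ.- a) ℤ.* (s ℤ.+ x))
  lemma = ℤ-Solver.solve-∀

-- Abel's inequality: the bound depends on the size and variation of `u` and on the partial sums of
-- `φ`, but not on the number of terms.
∣∑*∣≤variation : ∀ n (u φ : ℕ → ℤ) {U K} → (∀ i → ∣ u i ∣ ℕ.≤ U) → (∀ i → ∣ ∑ i φ ∣ ℕ.≤ K) →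
  ∣ ∑ n (λ i → u i ℤ.* φ i) ∣ ℕ.≤ (U ℕ.+ variation n u) ℕ.* K
∣∑*∣≤variation n u φ {U} {K} ∣u∣≤ ∣∑φ∣≤ = begin
  ∣ ∑ n (λ i → u i ℤ.* φ i) ∣
    ≡⟨ ≡.cong ∣_∣ (summation-by-parts n u φ) ⟩
  ∣ u n ℤ.* ∑ n φ ℤ.- corrections ∣
    ≤⟨ ℤ.∣i-j∣≤∣i∣+∣j∣ (u n ℤ.* ∑ n φ) corrections ⟩
  ∣ u n ℤ.* ∑ n φ ∣ ℕ.+ ∣ corrections ∣
    ≤⟨ ℕ.+-mono-≤
         (ℕ.≤-trans (ℕ.≤-reflexive (ℤ.abs-* (u n) (∑ n φ))) (ℕ.*-mono-≤ (∣u∣≤ n) (∣∑φ∣≤ n)))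
         (∣∑∣≤∑ℕ n (λ i → ℕ.≤-trans (ℕ.≤-reflexive (≡.trans
             (ℤ.abs-* (u (suc i) ℤ.- u i) (∑ (suc i) φ)) (ℕ.*-comm _ ∣ ∑ (suc i) φ ∣)))
           (ℕ.*-monoˡ-≤ _ (∣∑φ∣≤ (suc i))))) ⟩
  U ℕ.* K ℕ.+ ∑ℕ n (λ i → K ℕ.* ∣ u (suc i) ℤ.- u i ∣)
    ≡⟨ ≡.cong (U ℕ.* K ℕ.+_) (≡.trans (∑ℕ-*ˡ n K _) (ℕ.*-comm K _)) ⟩
  U ℕ.* K ℕ.+ variation n u ℕ.* K
    ≡⟨ ≡.sym (ℕ.*-distribʳ-+ K U (variation n u)) ⟩
  (U ℕ.+ variation n u) ℕ.* K ∎
  where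
  open ℕ.≤-Reasoning
  corrections = ∑ n (λ i → (u (suc i) ℤ.- u i) ℤ.* ∑ (suc i) φ)

-- Second moment of a sum of oscillating functions

module SecondMoment
  (Q M : ℕ) (w φ : ℕ → ℕ → ℤ) (V F L : ℕ → ℕ) (N₀ : ℕ)
  (∣w∣≤1 : ∀ n i → ∣ w n i ∣ ℕ.≤ 1)
  (∣φ∣≤M : ∀ n i → ∣ φ n i ∣ ℕ.≤ M)
  (variation-w : ∀ n → n ℕ.< N₀ → variation Q (w n) ℕ.≤ V n)
  (variation-φ : ∀ n → n ℕ.< N₀ → variation Q (φ n) ℕ.≤ M ℕ.* F n)
  (∣∑φ∣≤ : ∀ n x → ∣ ∑ x (φ n) ∣ ℕ.≤ M ℕ.* L n)
  (separated : ∀ n → n ℕ.< N₀ → (n ℕ.+ ∑ℕ n (λ j → F j ℕ.+ V j) ℕ.+ n ℕ.* V n) ℕ.* L n ℕ.≤ Q)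
  where

  X : ℕ → ℕ → ℤ
  X n i = w n i ℤ.* φ n i

  S : ℕ → ℕ → ℤ
  S N i = ∑ N (λ n → X n i)

  ∣X∣≤M : ∀ n i → ∣ X n i ∣ ℕ.≤ M
  ∣X∣≤M n i = ℕ.≤-trans (ℕ.≤-reflexive (ℤ.abs-* (w n i) (φ n i)))
    (ℕ.≤-trans (ℕ.*-mono-≤ (∣w∣≤1 n i) (∣φ∣≤M n i)) (ℕ.≤-reflexive (ℕ.*-identityˡ M)))

  ∣S∣≤ : ∀ N i → ∣ S N i ∣ ℕ.≤ N ℕ.* M
  ∣S∣≤ N i = ℕ.≤-trans (∣∑∣≤∑ℕ N (λ n → ∣X∣≤M n i)) (ℕ.≤-reflexive (∑ℕ-const N M))

  variation-S : ∀ N → N ℕ.≤ N₀ → variation Q (S N) ℕ.≤ M ℕ.* ∑ℕ N (λ j → F j ℕ.+ V j)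
  variation-S zero    _ = ℕ.≤-trans (ℕ.≤-reflexive (≡.trans (∑ℕ-const Q 0) (ℕ.*-zeroʳ Q))) ℕ.z≤n
  variation-S (suc N) N<N₀ = begin
    variation Q (S (suc N))
      ≤⟨ variation-+ Q (S N) (X N) ⟩
    variation Q (S N) ℕ.+ variation Q (X N)
      ≤⟨ ℕ.+-mono-≤ (variation-S N (ℕ.<⇒≤ N<N₀)) (variation-* Q (w N) (φ N) (∣w∣≤1 N) (∣φ∣≤M N)) ⟩
    M ℕ.* Σ ℕ.+ (1 ℕ.* variation Q (φ N) ℕ.+ M ℕ.* variation Q (w N))
      ≤⟨ ℕ.+-monoʳ-≤ (M ℕ.* Σ) (ℕ.+-mono-≤ (ℕ.*-monoʳ-≤ 1 (variation-φ N N<N₀)) (ℕ.*-monoʳ-≤ M (variation-w N N<N₀))) ⟩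
    M ℕ.* Σ ℕ.+ (1 ℕ.* (M ℕ.* F N) ℕ.+ M ℕ.* V N)
      ≡⟨ lemma M Σ (F N) (V N) ⟩
    M ℕ.* (Σ ℕ.+ (F N ℕ.+ V N)) ∎
    where
    open ℕ.≤-Reasoning
    Σ = ∑ℕ N (λ j → F j ℕ.+ V j)
    lemma : ∀ m s f v → m ℕ.* s ℕ.+ (1 ℕ.* (m ℕ.* f) ℕ.+ m ℕ.* v) ≡ m ℕ.* (s ℕ.+ (f ℕ.+ v))
    lemma = ℕ-Solver.solve-∀

  -- The earlier sum `S N` and the weight `w N` both vary slowly compared with the period of `φ N`,
  -- so they are kept together as one multiplier in the summation by parts. The hypothesis
  -- `separated` is the resulting bound with M² divided out.
  ∣∑SX∣≤ : ∀ N → N ℕ.< N₀ → ∣ ∑ Q (λ i → S N i ℤ.* X N i) ∣ ℕ.≤ M ℕ.* M ℕ.* Q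
  ∣∑SX∣≤ N N<N₀ = begin
    ∣ ∑ Q (λ i → S N i ℤ.* X N i) ∣
      ≡⟨ ≡.cong ∣_∣ (∑-cong Q (λ i → ≡.sym (ℤ.*-assoc (S N i) (w N i) (φ N i)))) ⟩
    ∣ ∑ Q (λ i → S N i ℤ.* w N i ℤ.* φ N i) ∣
      ≤⟨ ∣∑*∣≤variation Q (λ i → S N i ℤ.* w N i) (φ N) ∣Sw∣≤ (∣∑φ∣≤ N) ⟩
    (N ℕ.* M ℕ.+ variation Q (λ i → S N i ℤ.* w N i)) ℕ.* (M ℕ.* L N)
      ≤⟨ ℕ.*-monoˡ-≤ (M ℕ.* L N) (ℕ.+-monoʳ-≤ (N ℕ.* M)
           (ℕ.≤-trans (variation-* Q (S N) (w N) (∣S∣≤ N) (∣w∣≤1 N))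
             (ℕ.+-mono-≤ (ℕ.*-monoʳ-≤ (N ℕ.* M) (variation-w N N<N₀))
                          (ℕ.*-monoʳ-≤ 1 (variation-S N (ℕ.<⇒≤ N<N₀)))))) ⟩
    (N ℕ.* M ℕ.+ (N ℕ.* M ℕ.* V N ℕ.+ 1 ℕ.* (M ℕ.* Σ))) ℕ.* (M ℕ.* L N)
      ≡⟨ lemma M N (V N) Σ (L N) ⟩
    M ℕ.* M ℕ.* ((N ℕ.+ Σ ℕ.+ N ℕ.* V N) ℕ.* L N)
      ≤⟨ ℕ.*-monoʳ-≤ (M ℕ.* M) (separated N N<N₀) ⟩
    M ℕ.* M ℕ.* Q ∎
    where
    open ℕ.≤-Reasoning
    Σ = ∑ℕ N (λ j → F j ℕ.+ V j)
    ∣Sw∣≤ : ∀ i → ∣ S N i ℤ.* w N i ∣ ℕ.≤ N ℕ.* M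
    ∣Sw∣≤ i = ℕ.≤-trans (ℕ.≤-reflexive (ℤ.abs-* (S N i) (w N i)))
      (ℕ.≤-trans (ℕ.*-mono-≤ (∣S∣≤ N i) (∣w∣≤1 N i)) (ℕ.≤-reflexive (ℕ.*-identityʳ _)))
    lemma : ∀ m n v s l → (n ℕ.* m ℕ.+ (n ℕ.* m ℕ.* v ℕ.+ 1 ℕ.* (m ℕ.* s))) ℕ.* (m ℕ.* l)
                        ≡ m ℕ.* m ℕ.* ((n ℕ.+ s ℕ.+ n ℕ.* v) ℕ.* l)
    lemma = ℕ-Solver.solve-∀

  -- Near orthogonality: each new summand adds twice a correlation and one diagonal term, each at
  -- most M²Q. Hence the 3, and growth linear in N where the trivial bound is quadratic.
  ∣∑S²∣≤ : ∀ N → N ℕ.≤ N₀ → ∣ ∑ Q (λ i → S N i ℤ.* S N i) ∣ ℕ.≤ 3 ℕ.* (M ℕ.* M ℕ.* Q) ℕ.* N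
  ∣∑S²∣≤ zero    _ = ℕ.≤-trans (ℕ.≤-reflexive (≡.cong ∣_∣ (≡.trans (∑-const Q 0ℤ) (ℤ.*-zeroʳ (+ Q))))) ℕ.z≤n
  ∣∑S²∣≤ (suc N) N<N₀ = begin
    ∣ ∑ Q (λ i → S (suc N) i ℤ.* S (suc N) i) ∣
      ≡⟨ ≡.cong ∣_∣ expand ⟩
    ∣ (SS ℤ.+ + 2 ℤ.* SX) ℤ.+ XX ∣
      ≤⟨ ℤ.∣i+j∣≤∣i∣+∣j∣ (SS ℤ.+ + 2 ℤ.* SX) XX ⟩
    ∣ SS ℤ.+ + 2 ℤ.* SX ∣ ℕ.+ ∣ XX ∣
      ≤⟨ ℕ.+-monoˡ-≤ ∣ XX ∣ (ℤ.∣i+j∣≤∣i∣+∣j∣ SS (+ 2 ℤ.* SX)) ⟩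
    (∣ SS ∣ ℕ.+ ∣ + 2 ℤ.* SX ∣) ℕ.+ ∣ XX ∣
      ≡⟨ ≡.cong (λ z → (∣ SS ∣ ℕ.+ z) ℕ.+ ∣ XX ∣) (ℤ.abs-* (+ 2) SX) ⟩
    (∣ SS ∣ ℕ.+ 2 ℕ.* ∣ SX ∣) ℕ.+ ∣ XX ∣
      ≤⟨ ℕ.+-mono-≤ (ℕ.+-mono-≤ (∣∑S²∣≤ N (ℕ.<⇒≤ N<N₀)) (ℕ.*-monoʳ-≤ 2 (∣∑SX∣≤ N N<N₀))) ∣XX∣≤ ⟩
    (3 ℕ.* M²Q ℕ.* N ℕ.+ 2 ℕ.* M²Q) ℕ.+ M²Q
      ≡⟨ lemma M²Q N ⟩
    3 ℕ.* M²Q ℕ.* suc N ∎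
    where
    open ℕ.≤-Reasoning
    M²Q = M ℕ.* M ℕ.* Q
    SS = ∑ Q (λ i → S N i ℤ.* S N i)
    SX = ∑ Q (λ i → S N i ℤ.* X N i)
    XX = ∑ Q (λ i → X N i ℤ.* X N i)
    square : ∀ s x → (s ℤ.+ x) ℤ.* (s ℤ.+ x) ≡ (s ℤ.* s ℤ.+ + 2 ℤ.* (s ℤ.* x)) ℤ.+ x ℤ.* x
    square = ℤ-Solver.solve-∀
    expand : ∑ Q (λ i → S (suc N) i ℤ.* S (suc N) i) ≡ (SS ℤ.+ + 2 ℤ.* SX) ℤ.+ XX
    expand = ≡.trans (∑-cong Q (λ i → square (S N i) (X N i)))
      (≡.trans (∑-+ Q _ _) (≡.cong (ℤ._+ XX)
        (≡.trans (∑-+ Q _ _) (≡.cong (λ z → SS ℤ.+ z) (∑-*ˡ Q (+ 2) _)))))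
    ∣XX∣≤ : ∣ XX ∣ ℕ.≤ M²Q
    ∣XX∣≤ = ℕ.≤-trans (∣∑∣≤∑ℕ Q {g = λ _ → M ℕ.* M} (λ i → ℕ.≤-trans
        (ℕ.≤-reflexive (ℤ.abs-* (X N i) (X N i))) (ℕ.*-mono-≤ (∣X∣≤M N i) (∣X∣≤M N i))))
      (ℕ.≤-reflexive (≡.trans (∑ℕ-const Q (M ℕ.* M)) (ℕ.*-comm Q (M ℕ.* M))))
    lemma : ∀ m n → (3 ℕ.* m ℕ.* n ℕ.+ 2 ℕ.* m) ℕ.+ m ≡ 3 ℕ.* m ℕ.* suc n
    lemma = ℕ-Solver.solve-∀

-- The indicator of |s| > t / h, cleared of denominators.
exceeds : ℕ → ℕ → ℤ → ℕ
exceeds t h s with t ℕ.<? h ℕ.* ∣ s ∣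
... | yes _ = 1
... | no  _ = 0

exceeds≡0 : ∀ {t h} s → exceeds t h s ≡ 0 → h ℕ.* ∣ s ∣ ℕ.≤ t
exceeds≡0 {t} {h} s e with t ℕ.<? h ℕ.* ∣ s ∣
exceeds≡0 s () | yes _
... | no ¬p = ℕ.≮⇒≥ ¬p

chebyshev : ∀ Q t h (S : ℕ → ℤ) →
  ∑ℕ Q (λ i → exceeds t h (S i)) ℕ.* (t ℕ.* t) ℕ.≤ h ℕ.* h ℕ.* ∣ ∑ Q (λ i → S i ℤ.* S i) ∣
chebyshev Q t h S = begin
  ∑ℕ Q (λ i → exceeds t h (S i)) ℕ.* (t ℕ.* t)
    ≡⟨ ≡.trans (ℕ.*-comm _ (t ℕ.* t)) (≡.sym (∑ℕ-*ˡ Q (t ℕ.* t) _)) ⟩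
  ∑ℕ Q (λ i → t ℕ.* t ℕ.* exceeds t h (S i))
    ≤⟨ ∑ℕ-mono Q (λ i → pointwise (S i)) ⟩
  ∑ℕ Q (λ i → h ℕ.* h ℕ.* (∣ S i ∣ ℕ.* ∣ S i ∣))
    ≡⟨ ∑ℕ-*ˡ Q (h ℕ.* h) _ ⟩
  h ℕ.* h ℕ.* ∑ℕ Q (λ i → ∣ S i ∣ ℕ.* ∣ S i ∣)
    ≡⟨ ≡.cong (λ z → h ℕ.* h ℕ.* ∣ z ∣) (≡.trans (≡.sym (∑-pos Q _)) (∑-cong Q (λ i → square (S i)))) ⟩
  h ℕ.* h ℕ.* ∣ ∑ Q (λ i → S i ℤ.* S i) ∣ ∎
  where
  open ℕ.≤-Reasoning
  square : ∀ s → + (∣ s ∣ ℕ.* ∣ s ∣) ≡ s ℤ.* s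
  square (+ n)    = ℤ.pos-* n n
  square -[1+ n ] = ≡.refl
  rearrange : ∀ a b → (a ℕ.* b) ℕ.* (a ℕ.* b) ≡ a ℕ.* a ℕ.* (b ℕ.* b)
  rearrange = ℕ-Solver.solve-∀
  pointwise : ∀ s → t ℕ.* t ℕ.* exceeds t h s ℕ.≤ h ℕ.* h ℕ.* (∣ s ∣ ℕ.* ∣ s ∣)
  pointwise s with t ℕ.<? h ℕ.* ∣ s ∣
  ... | yes p = ℕ.≤-trans (ℕ.≤-reflexive (ℕ.*-identityʳ _))
                  (ℕ.≤-trans (ℕ.*-mono-≤ (ℕ.<⇒≤ p) (ℕ.<⇒≤ p)) (ℕ.≤-reflexive (rearrange h ∣ s ∣)))
  ... | no  _ = ℕ.≤-trans (ℕ.≤-reflexive (ℕ.*-zeroʳ (t ℕ.* t))) ℕ.z≤n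

-- Variation and means of periodic indicators

∣m+d-m∣≡d : ∀ m d → ∣ + (m ℕ.+ d) ℤ.- + m ∣ ≡ d
∣m+d-m∣≡d m d = ≡.cong ∣_∣ (lemma (+ m) (+ d))
  where
  lemma : ∀ a b → (a ℤ.+ b) ℤ.- a ≡ b
  lemma = ℤ-Solver.solve-∀

variation-monotone : ∀ n (f : ℕ → ℕ) → (∀ i → f i ℕ.≤ f (suc i)) →
  variation n (λ i → + f i) ℕ.+ f 0 ≡ f n
variation-monotone zero    f mono = ≡.refl
variation-monotone (suc n) f mono = begin
  variation n (λ i → + f i) ℕ.+ ∣ + f (suc n) ℤ.- + f n ∣ ℕ.+ f 0
    ≡⟨ lemma (variation n (λ i → + f i)) ∣ + f (suc n) ℤ.- + f n ∣ (f 0) ⟩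
  variation n (λ i → + f i) ℕ.+ f 0 ℕ.+ ∣ + f (suc n) ℤ.- + f n ∣
    ≡⟨ ≡.cong₂ (λ a b → a ℕ.+ ∣ + b ℤ.- + f n ∣) (variation-monotone n f mono) (≡.sym (ℕ.m+[n∸m]≡n (mono n))) ⟩
  f n ℕ.+ ∣ + (f n ℕ.+ (f (suc n) ∸ f n)) ℤ.- + f n ∣
    ≡⟨ ≡.cong (f n ℕ.+_) (∣m+d-m∣≡d (f n) _) ⟩
  f n ℕ.+ (f (suc n) ∸ f n)
    ≡⟨ ℕ.m+[n∸m]≡n (mono n) ⟩
  f (suc n) ∎
  where
  open ≡.≡-Reasoning
  lemma : ∀ a b c → a ℕ.+ b ℕ.+ c ≡ a ℕ.+ c ℕ.+ b
  lemma = ℕ-Solver.solve-∀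

-- The indicator of lo ≤ i mod L < hi, written as a difference of two
-- staircases so that its variation and its sums can be read off.
module Indicator (L : ℕ) .{{_ : NonZero L}} where

  stair : ℕ → ℕ → ℕ
  stair c i = (i ℕ.+ c) ℕ./ L

  stair-mono : ∀ c i → stair c i ℕ.≤ stair c (suc i)
  stair-mono c i = ℕ./-monoˡ-≤ L (ℕ.n≤1+n (i ℕ.+ c))

  stair-period : ∀ c i → stair c (L ℕ.+ i) ≡ suc (stair c i)
  stair-period c i = ≡.trans (≡.cong (ℕ._/ L) (ℕ.+-assoc L i c))
    (≡.trans (ℕ.+-distrib-/-∣ˡ (i ℕ.+ c) ℕ.∣-refl) (≡.cong (ℕ._+ stair c i) (ℕ.n/n≡1 L)))

  stair-periods : ∀ c k i → stair c (k ℕ.* L ℕ.+ i) ≡ k ℕ.+ stair c i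
  stair-periods c zero    i = ≡.refl
  stair-periods c (suc k) i = ≡.trans (≡.cong (stair c) (ℕ.+-assoc L (k ℕ.* L) i))
    (≡.trans (stair-period c (k ℕ.* L ℕ.+ i)) (≡.cong suc (stair-periods c k i)))

  stair-lower : ∀ c i → stair c i ℕ.* L ℕ.≤ i ℕ.+ c
  stair-lower c i = ℕ.m/n*n≤m (i ℕ.+ c) L

  stair-upper : ∀ c i → i ℕ.+ c ℕ.< suc (stair c i) ℕ.* L
  stair-upper c i = ℕ.≤-<-trans (ℕ.≤-reflexive (ℕ.m≡m%n+[m/n]*n (i ℕ.+ c) L))
    (ℕ.+-monoˡ-< (stair c i ℕ.* L) (ℕ.m%n<n (i ℕ.+ c) L))

  -- Hermite's identity. Raising `c` by one shifts the staircase by one place, and over a full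
  -- period the shift gains exactly one step.
  ∑ℕ-stair : ∀ c → ∑ℕ L (stair c) ≡ c
  ∑ℕ-stair zero = below L ℕ.≤-refl
    where
    below : ∀ n → n ℕ.≤ L → ∑ℕ n (stair 0) ≡ 0
    below zero    _   = ≡.refl
    below (suc n) n<L rewrite below n (ℕ.<⇒≤ n<L) | ℕ.+-identityʳ n = ℕ.m<n⇒m/n≡0 n<L
  ∑ℕ-stair (suc c) = ℕ.+-cancelʳ-≡ (stair c 0) _ _ (begin
    ∑ℕ L (stair (suc c)) ℕ.+ stair c 0
      ≡⟨ ≡.cong (ℕ._+ stair c 0) (∑ℕ-cong L (λ i → ≡.cong (ℕ._/ L) (ℕ.+-suc i c))) ⟩
    ∑ℕ L (λ i → stair c (suc i)) ℕ.+ stair c 0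
      ≡⟨ ∑ℕ-shift L (stair c) ⟩
    ∑ℕ L (stair c) ℕ.+ stair c L
      ≡⟨ ≡.cong₂ ℕ._+_ (∑ℕ-stair c) (≡.trans (≡.cong (stair c) (≡.sym (ℕ.+-identityʳ L))) (stair-period c 0)) ⟩
    c ℕ.+ suc (stair c 0)
      ≡⟨ ℕ.+-suc c (stair c 0) ⟩
    suc c ℕ.+ stair c 0 ∎)
    where
    open ≡.≡-Reasoning
    ∑ℕ-cong : ∀ n {f g} → (∀ i → f i ≡ g i) → ∑ℕ n f ≡ ∑ℕ n g
    ∑ℕ-cong zero    e = ≡.refl
    ∑ℕ-cong (suc n) e = ≡.cong₂ ℕ._+_ (∑ℕ-cong n e) (e n)

  variation-stair : ∀ c k → variation (k ℕ.* L) (λ i → + stair c i) ≡ k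
  variation-stair c k = ℕ.+-cancelʳ-≡ (stair c 0) _ _
    (≡.trans (variation-monotone (k ℕ.* L) (stair c) (stair-mono c))
      (≡.trans (≡.cong (stair c) (≡.sym (ℕ.+-identityʳ (k ℕ.* L)))) (stair-periods c k 0)))

  module _ (lo hi : ℕ) (lo≤hi : lo ℕ.≤ hi) (hi≤L : hi ℕ.≤ L) where

    -- With these offsets the first staircase rises where i ≡ lo and the second where i ≡ hi modulo
    -- `L`.
    s₁ s₂ : ℕ → ℕ
    s₁ = stair (L ∸ lo)
    s₂ = stair (L ∸ hi)

    indicator : ℕ → ℕ
    indicator i = s₁ i ∸ s₂ i

    s₂≤s₁ : ∀ i → s₂ i ℕ.≤ s₁ i
    s₂≤s₁ i = ℕ./-monoˡ-≤ L (ℕ.+-monoʳ-≤ i (ℕ.∸-monoʳ-≤ L lo≤hi))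

    s₁≤1+s₂ : ∀ i → s₁ i ℕ.≤ suc (s₂ i)
    s₁≤1+s₂ i = ℕ.≤-trans
      (ℕ./-monoˡ-≤ L (begin
        i ℕ.+ (L ∸ lo)          ≤⟨ ℕ.+-monoʳ-≤ i (ℕ.m∸n≤m L lo) ⟩
        i ℕ.+ L                 ≡⟨ ℕ.+-comm i L ⟩
        L ℕ.+ i                 ≤⟨ ℕ.m≤m+n (L ℕ.+ i) (L ∸ hi) ⟩
        L ℕ.+ i ℕ.+ (L ∸ hi)    ∎))
      (ℕ.≤-reflexive (stair-period (L ∸ hi) i))
      where open ℕ.≤-Reasoning

    +indicator : ∀ i → + indicator i ≡ + s₁ i ℤ.+ ℤ.- (+ s₂ i)
    +indicator i = ≡.trans (≡.sym (ℤ.⊖-≥ (s₂≤s₁ i))) (≡.sym (ℤ.m-n≡m⊖n (s₁ i) (s₂ i)))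

    indicator≤1 : ∀ i → indicator i ℕ.≤ 1
    indicator≤1 i = ℕ.≤-trans (ℕ.∸-monoˡ-≤ (s₂ i) (s₁≤1+s₂ i)) (ℕ.≤-reflexive (ℕ.m+n∸n≡m 1 (s₂ i)))

    indicator≡1 : ∀ i → indicator i ≡ 1 → ∃[ k ] k ℕ.* L ℕ.+ lo ℕ.≤ i × i ℕ.< k ℕ.* L ℕ.+ hi
    indicator≡1 i e = k , lower , upper
      where
      -- Inside the arc the second staircase has not yet risen in the current period, so its value
      -- is the number of completed periods.
      k = s₂ i
      s₁≡1+k : s₁ i ≡ suc k
      s₁≡1+k = ≡.trans (≡.sym (ℕ.m∸n+n≡m (s₂≤s₁ i))) (≡.cong (ℕ._+ k) e)
      open ℕ.≤-Reasoning
      lower : k ℕ.* L ℕ.+ lo ℕ.≤ i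
      lower = ℕ.+-cancelʳ-≤ (L ∸ lo) _ _ (begin
        k ℕ.* L ℕ.+ lo ℕ.+ (L ∸ lo)   ≡⟨ ℕ.+-assoc (k ℕ.* L) lo (L ∸ lo) ⟩
        k ℕ.* L ℕ.+ (lo ℕ.+ (L ∸ lo)) ≡⟨ ≡.cong (k ℕ.* L ℕ.+_) (ℕ.m+[n∸m]≡n (ℕ.≤-trans lo≤hi hi≤L)) ⟩
        k ℕ.* L ℕ.+ L                 ≡⟨ ℕ.+-comm (k ℕ.* L) L ⟩
        suc k ℕ.* L                   ≡⟨ ≡.cong (ℕ._* L) (≡.sym s₁≡1+k) ⟩
        s₁ i ℕ.* L                    ≤⟨ stair-lower (L ∸ lo) i ⟩
        i ℕ.+ (L ∸ lo)                ∎)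
      upper : i ℕ.< k ℕ.* L ℕ.+ hi
      upper = ℕ.+-cancelʳ-< (L ∸ hi) _ _ (begin-strict
        i ℕ.+ (L ∸ hi)                <⟨ stair-upper (L ∸ hi) i ⟩
        suc k ℕ.* L                   ≡⟨ ℕ.+-comm L (k ℕ.* L) ⟩
        k ℕ.* L ℕ.+ L                 ≡⟨ ≡.cong (k ℕ.* L ℕ.+_) (≡.sym (ℕ.m+[n∸m]≡n hi≤L)) ⟩
        k ℕ.* L ℕ.+ (hi ℕ.+ (L ∸ hi)) ≡⟨ ≡.sym (ℕ.+-assoc (k ℕ.* L) hi (L ∸ hi)) ⟩
        k ℕ.* L ℕ.+ hi ℕ.+ (L ∸ hi)   ∎)

    -- Each period contributes one rise from `s₁` and one from `s₂`.
    variation-indicator : ∀ k → variation (k ℕ.* L) (λ i → + indicator i) ℕ.≤ 2 ℕ.* k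
    variation-indicator k = begin
      variation (k ℕ.* L) (λ i → + indicator i)
        ≡⟨ variation-cong (k ℕ.* L) +indicator ⟩
      variation (k ℕ.* L) (λ i → + s₁ i ℤ.+ ℤ.- (+ s₂ i))
        ≤⟨ variation-+ (k ℕ.* L) (λ i → + s₁ i) (λ i → ℤ.- (+ s₂ i)) ⟩
      variation (k ℕ.* L) (λ i → + s₁ i) ℕ.+ variation (k ℕ.* L) (λ i → ℤ.- (+ s₂ i))
        ≡⟨ ≡.cong₂ ℕ._+_ (variation-stair (L ∸ lo) k)
             (≡.trans (variation-neg (k ℕ.* L) (λ i → + s₂ i)) (variation-stair (L ∸ hi) k)) ⟩
      k ℕ.+ k
        ≡⟨ ≡.cong (k ℕ.+_) (≡.sym (ℕ.+-identityʳ k)) ⟩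
      2 ℕ.* k ∎
      where
      open ℕ.≤-Reasoning
      variation-cong : ∀ n {u v} → (∀ i → u i ≡ v i) → variation n u ≡ variation n v
      variation-cong zero    e = ≡.refl
      variation-cong (suc n) e = ≡.cong₂ ℕ._+_ (variation-cong n e)
        (≡.cong₂ (λ a b → ∣ a ℤ.- b ∣) (e (suc n)) (e n))
      lemma : ∀ a b → ℤ.- a ℤ.- ℤ.- b ≡ ℤ.- (a ℤ.- b)
      lemma = ℤ-Solver.solve-∀
      variation-neg : ∀ n (u : ℕ → ℤ) → variation n (λ i → ℤ.- u i) ≡ variation n u
      variation-neg zero    u = ≡.refl
      variation-neg (suc n) u = ≡.cong₂ ℕ._+_ (variation-neg n u)
        (≡.trans (≡.cong ∣_∣ (lemma (u (suc n)) (u n))) (ℤ.∣-i∣≡∣i∣ (u (suc n) ℤ.- u n)))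

    indicator-period : ∀ i → indicator (L ℕ.+ i) ≡ indicator i
    indicator-period i = ≡.cong₂ _∸_ (stair-period (L ∸ lo) i) (stair-period (L ∸ hi) i)

    ∑-indicator : ∑ L (λ i → + indicator i) ≡ + hi ℤ.- + lo
    ∑-indicator = begin
      ∑ L (λ i → + indicator i)
        ≡⟨ ∑-cong L +indicator ⟩
      ∑ L (λ i → + s₁ i ℤ.+ ℤ.- (+ s₂ i))
        ≡⟨ ∑-cong L (λ i → ≡.cong (λ z → + s₁ i ℤ.+ z) (neg (+ s₂ i))) ⟩
      ∑ L (λ i → + s₁ i ℤ.+ -[1+ 0 ] ℤ.* + s₂ i)
        ≡⟨ ∑-+ L _ _ ⟩
      ∑ L (λ i → + s₁ i) ℤ.+ ∑ L (λ i → -[1+ 0 ] ℤ.* + s₂ i)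
        ≡⟨ ≡.cong₂ ℤ._+_ (sum-stair (L ∸ lo)) (≡.trans (∑-*ˡ L -[1+ 0 ] _) (≡.cong (-[1+ 0 ] ℤ.*_) (sum-stair (L ∸ hi)))) ⟩
      + (L ∸ lo) ℤ.+ -[1+ 0 ] ℤ.* + (L ∸ hi)
        ≡⟨ ≡.cong₂ (λ a b → a ℤ.+ -[1+ 0 ] ℤ.* b) (monus (ℕ.≤-trans lo≤hi hi≤L)) (monus hi≤L) ⟩
      (+ L ℤ.- + lo) ℤ.+ -[1+ 0 ] ℤ.* (+ L ℤ.- + hi)
        ≡⟨ lemma (+ L) (+ lo) (+ hi) ⟩
      + hi ℤ.- + lo ∎
      where
      open ≡.≡-Reasoning
      neg : ∀ a → ℤ.- a ≡ -[1+ 0 ] ℤ.* a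
      neg = ℤ-Solver.solve-∀
      sum-stair : ∀ c → ∑ L (λ i → + stair c i) ≡ + c
      sum-stair c = ≡.trans (∑-pos L (stair c)) (≡.cong +_ (∑ℕ-stair c))
      monus : ∀ {m} → m ℕ.≤ L → + (L ∸ m) ≡ + L ℤ.- + m
      monus {m} m≤L = ≡.trans (≡.sym (ℤ.⊖-≥ m≤L)) (≡.sym (ℤ.m-n≡m⊖n L m))
      lemma : ∀ a b c → (a ℤ.- b) ℤ.+ -[1+ 0 ] ℤ.* (a ℤ.- c) ≡ c ℤ.- b
      lemma = ℤ-Solver.solve-∀

-- M times the indicator of the arc [q/M , r/M) with its mean r - q removed.
module Oscillation (M l : ℕ) .{{_ : NonZero (M ℕ.* l)}} (q r : ℕ) (q≤r : q ℕ.≤ r) (r≤M : r ℕ.≤ M) where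

  open Indicator (M ℕ.* l) public

  private
    lo≤hi : q ℕ.* l ℕ.≤ r ℕ.* l
    lo≤hi = ℕ.*-monoˡ-≤ l q≤r

    hi≤L : r ℕ.* l ℕ.≤ M ℕ.* l
    hi≤L = ℕ.*-monoˡ-≤ l r≤M

  arc : ℕ → ℕ
  arc = indicator (q ℕ.* l) (r ℕ.* l) lo≤hi hi≤L

  arc≤1 : ∀ i → arc i ℕ.≤ 1
  arc≤1 = indicator≤1 _ _ lo≤hi hi≤L

  arc≡1 : ∀ i → arc i ≡ 1 → ∃[ k ] k ℕ.* (M ℕ.* l) ℕ.+ q ℕ.* l ℕ.≤ i × i ℕ.< k ℕ.* (M ℕ.* l) ℕ.+ r ℕ.* l
  arc≡1 = indicator≡1 _ _ lo≤hi hi≤L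

  variation-arc : ∀ k → variation (k ℕ.* (M ℕ.* l)) (λ i → + arc i) ℕ.≤ 2 ℕ.* k
  variation-arc = variation-indicator _ _ lo≤hi hi≤L

  φ : ℕ → ℤ
  φ i = + M ℤ.* + arc i ℤ.- + (r ∸ q)

  private
    mean : + (r ∸ q) ≡ + r ℤ.- + q
    mean = ≡.trans (≡.sym (ℤ.⊖-≥ q≤r)) (≡.sym (ℤ.m-n≡m⊖n r q))

  ∣φ∣≤M : ∀ i → ∣ φ i ∣ ℕ.≤ M
  ∣φ∣≤M i with arc i | arc≤1 i
  ... | zero        | _ = ℕ.≤-trans (ℕ.≤-reflexive (≡.trans
          (≡.cong ∣_∣ (lemma (+ M) (+ (r ∸ q)))) (ℤ.∣-i∣≡∣i∣ (+ (r ∸ q)))))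
          (ℕ.≤-trans (ℕ.m∸n≤m r q) r≤M)
    where
    lemma : ∀ a b → a ℤ.* 0ℤ ℤ.- b ≡ ℤ.- b
    lemma = ℤ-Solver.solve-∀
  ... | suc zero    | _ = ℕ.≤-trans
          (ℕ.≤-reflexive (≡.cong ∣_∣ (≡.trans (≡.cong (λ z → z ℤ.- + (r ∸ q)) (ℤ.*-identityʳ (+ M)))
            (≡.trans (ℤ.m-n≡m⊖n M (r ∸ q)) (ℤ.⊖-≥ (ℕ.≤-trans (ℕ.m∸n≤m r q) r≤M))))))
          (ℕ.m∸n≤m M (r ∸ q))
  ... | suc (suc _) | ℕ.s≤s ()

  variation-φ : ∀ k → variation (k ℕ.* (M ℕ.* l)) φ ℕ.≤ M ℕ.* (2 ℕ.* k)
  variation-φ k = ℕ.≤-trans (ℕ.≤-reflexive (scale (k ℕ.* (M ℕ.* l)))) (ℕ.*-monoʳ-≤ M (variation-arc k))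
    where
    lemma : ∀ m a b c → (m ℤ.* a ℤ.- c) ℤ.- (m ℤ.* b ℤ.- c) ≡ m ℤ.* (a ℤ.- b)
    lemma = ℤ-Solver.solve-∀
    scale : ∀ n → variation n φ ≡ M ℕ.* variation n (λ i → + arc i)
    scale zero    = ≡.sym (ℕ.*-zeroʳ M)
    scale (suc n) = ≡.trans (≡.cong₂ ℕ._+_ (scale n) (≡.trans
        (≡.cong ∣_∣ (lemma (+ M) (+ arc (suc n)) (+ arc n) (+ (r ∸ q))))
        (ℤ.abs-* (+ M) (+ arc (suc n) ℤ.- + arc n))))
      (≡.sym (ℕ.*-distribˡ-+ M _ ∣ + arc (suc n) ℤ.- + arc n ∣))

  ∑φ-period : ∑ (M ℕ.* l) φ ≡ 0ℤ
  ∑φ-period = begin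
    ∑ (M ℕ.* l) (λ i → + M ℤ.* + arc i ℤ.+ ℤ.- (+ (r ∸ q)))
      ≡⟨ ∑-+ (M ℕ.* l) _ _ ⟩
    ∑ (M ℕ.* l) (λ i → + M ℤ.* + arc i) ℤ.+ ∑ (M ℕ.* l) (λ _ → ℤ.- (+ (r ∸ q)))
      ≡⟨ ≡.cong₂ ℤ._+_ (≡.trans (∑-*ˡ (M ℕ.* l) (+ M) _) (≡.cong (+ M ℤ.*_) (∑-indicator _ _ lo≤hi hi≤L)))
           (∑-const (M ℕ.* l) _) ⟩
    + M ℤ.* (+ (r ℕ.* l) ℤ.- + (q ℕ.* l)) ℤ.+ + (M ℕ.* l) ℤ.* ℤ.- (+ (r ∸ q))
      ≡⟨ ≡.cong₂ ℤ._+_ (≡.cong (+ M ℤ.*_) (≡.cong₂ ℤ._-_ (ℤ.pos-* r l) (ℤ.pos-* q l)))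
           (≡.cong₂ (λ a b → a ℤ.* ℤ.- b) (ℤ.pos-* M l) mean) ⟩
    + M ℤ.* (+ r ℤ.* + l ℤ.- + q ℤ.* + l) ℤ.+ + M ℤ.* + l ℤ.* ℤ.- (+ r ℤ.- + q)
      ≡⟨ lemma (+ M) (+ l) (+ r) (+ q) ⟩
    0ℤ ∎
    where
    open ≡.≡-Reasoning
    lemma : ∀ m l r q → m ℤ.* (r ℤ.* l ℤ.- q ℤ.* l) ℤ.+ m ℤ.* l ℤ.* ℤ.- (r ℤ.- q) ≡ 0ℤ
    lemma = ℤ-Solver.solve-∀

  ∑φ-periods : ∀ k x → ∑ (k ℕ.* (M ℕ.* l) ℕ.+ x) φ ≡ ∑ x φ
  ∑φ-periods zero    x = ≡.refl
  ∑φ-periods (suc k) x = begin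
    ∑ (M ℕ.* l ℕ.+ k ℕ.* (M ℕ.* l) ℕ.+ x) φ
      ≡⟨ ≡.cong (λ n → ∑ n φ) (ℕ.+-assoc (M ℕ.* l) (k ℕ.* (M ℕ.* l)) x) ⟩
    ∑ (M ℕ.* l ℕ.+ (k ℕ.* (M ℕ.* l) ℕ.+ x)) φ
      ≡⟨ ∑-split (M ℕ.* l) (k ℕ.* (M ℕ.* l) ℕ.+ x) φ ⟩
    ∑ (M ℕ.* l) φ ℤ.+ ∑ (k ℕ.* (M ℕ.* l) ℕ.+ x) (λ i → φ (M ℕ.* l ℕ.+ i))
      ≡⟨ ≡.cong₂ ℤ._+_ ∑φ-period (∑-cong (k ℕ.* (M ℕ.* l) ℕ.+ x) (λ i →
           ≡.cong (λ n → + M ℤ.* + n ℤ.- + (r ∸ q)) (indicator-period _ _ lo≤hi hi≤L i))) ⟩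
    0ℤ ℤ.+ ∑ (k ℕ.* (M ℕ.* l) ℕ.+ x) φ
      ≡⟨ ≡.trans (ℤ.+-identityˡ _) (∑φ-periods k x) ⟩
    ∑ x φ ∎
    where open ≡.≡-Reasoning

  -- Full periods cancel by `∑φ-period`; what remains is less than one period of terms of size at
  -- most M.
  ∣∑φ∣≤ : ∀ x → ∣ ∑ x φ ∣ ℕ.≤ M ℕ.* (M ℕ.* l)
  ∣∑φ∣≤ x = begin
    ∣ ∑ x φ ∣
      ≡⟨ ≡.cong (λ n → ∣ ∑ n φ ∣) (≡.trans (ℕ.m≡m%n+[m/n]*n x (M ℕ.* l)) (ℕ.+-comm (x ℕ.% (M ℕ.* l)) _)) ⟩
    ∣ ∑ (x ℕ./ (M ℕ.* l) ℕ.* (M ℕ.* l) ℕ.+ x ℕ.% (M ℕ.* l)) φ ∣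
      ≡⟨ ≡.cong ∣_∣ (∑φ-periods (x ℕ./ (M ℕ.* l)) (x ℕ.% (M ℕ.* l))) ⟩
    ∣ ∑ (x ℕ.% (M ℕ.* l)) φ ∣
      ≤⟨ ∣∑∣≤∑ℕ (x ℕ.% (M ℕ.* l)) ∣φ∣≤M ⟩
    ∑ℕ (x ℕ.% (M ℕ.* l)) (λ _ → M)
      ≡⟨ ∑ℕ-const (x ℕ.% (M ℕ.* l)) M ⟩
    x ℕ.% (M ℕ.* l) ℕ.* M
      ≤⟨ ℕ.*-monoˡ-≤ M (ℕ.<⇒≤ (ℕ.m%n<n x (M ℕ.* l))) ⟩
    M ℕ.* l ℕ.* M
      ≡⟨ ℕ.*-comm (M ℕ.* l) M ⟩
    M ℕ.* (M ℕ.* l) ∎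
    where open ℕ.≤-Reasoning

-- The solutions of d² = 8b² + 1, so that (2b , d) runs through d² = 2a² + 1.
mutual
  b : ℕ → ℕ
  b zero    = 1
  b (suc n) = 3 ℕ.* b n ℕ.+ d n

  d : ℕ → ℕ
  d zero    = 3
  d (suc n) = 8 ℕ.* b n ℕ.+ 3 ℕ.* d n

-- The recursion multiplies d + b√8 by 3 + √8, a unit of norm 9 - 8 = 1.
pell : ∀ n → d n ℕ.* d n ≡ 8 ℕ.* (b n ℕ.* b n) ℕ.+ 1
pell zero    = ≡.refl
pell (suc n) = ≡.trans (expand (b n) (d n))
  (≡.trans (≡.cong (λ x → 64 ℕ.* (b n ℕ.* b n) ℕ.+ 48 ℕ.* (b n ℕ.* d n) ℕ.+ 8 ℕ.* (d n ℕ.* d n) ℕ.+ x) (pell n))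
    (collect (b n) (d n)))
  where
  expand : ∀ x y → (8 ℕ.* x ℕ.+ 3 ℕ.* y) ℕ.* (8 ℕ.* x ℕ.+ 3 ℕ.* y) ≡
                   64 ℕ.* (x ℕ.* x) ℕ.+ 48 ℕ.* (x ℕ.* y) ℕ.+ 8 ℕ.* (y ℕ.* y) ℕ.+ y ℕ.* y
  expand = ℕ-Solver.solve-∀
  collect : ∀ x y → 64 ℕ.* (x ℕ.* x) ℕ.+ 48 ℕ.* (x ℕ.* y) ℕ.+ 8 ℕ.* (y ℕ.* y) ℕ.+ (8 ℕ.* (x ℕ.* x) ℕ.+ 1) ≡
                    8 ℕ.* ((3 ℕ.* x ℕ.+ y) ℕ.* (3 ℕ.* x ℕ.+ y)) ℕ.+ 1
  collect = ℕ-Solver.solve-∀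

-- `A n` = (2b)² and `B n` = (2b²)² are the frequencies a² and e² that multiply α. Since `B n` is
-- `A n` times `b² n`, a common multiple of the `B n` serves for the `A n` as well.
b² A B : ℕ → ℕ
b² n = b n ℕ.* b n
A n = 4 ℕ.* b² n
B n = 4 ℕ.* (b² n ℕ.* b² n)

b-nonZero : ∀ n → NonZero (b n)
b-nonZero zero    = _
b-nonZero (suc n) = ℕ.>-nonZero (ℕ.≤-trans (ℕ.>-nonZero⁻¹ (b n) {{b-nonZero n}})
  (ℕ.≤-trans (ℕ.m≤n*m (b n) 3) (ℕ.m≤m+n (3 ℕ.* b n) (d n))))

1≤b² : ∀ n → 1 ℕ.≤ b² n
1≤b² n = ℕ.*-mono-≤ {1} {b n} {1} 1≤b 1≤b
  where
  1≤b : 1 ℕ.≤ b n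
  1≤b = ℕ.>-nonZero⁻¹ (b n) {{b-nonZero n}}

9b²≤b² : ∀ n → 9 ℕ.* b² n ℕ.≤ b² (suc n)
9b²≤b² n = ℕ.≤-trans (ℕ.≤-reflexive (lemma (b n)))
  (ℕ.*-mono-≤ (ℕ.m≤m+n (3 ℕ.* b n) (d n)) (ℕ.m≤m+n (3 ℕ.* b n) (d n)))
  where
  lemma : ∀ x → 9 ℕ.* (x ℕ.* x) ≡ (3 ℕ.* x) ℕ.* (3 ℕ.* x)
  lemma = ℕ-Solver.solve-∀

B-nonZero : ∀ n → NonZero (B n)
B-nonZero n = ℕ.>-nonZero (ℕ.*-mono-≤ {1} {4} {1} (ℕ.s≤s ℕ.z≤n) (ℕ.*-mono-≤ {1} {b² n} {1} (1≤b² n) (1≤b² n)))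

A≤B : ∀ n → A n ℕ.≤ B n
A≤B n = ℕ.*-monoʳ-≤ 4 (ℕ.m≤n*m (b² n) (b² n) {{ℕ.>-nonZero (1≤b² n)}})

1≤A : ∀ n → 1 ℕ.≤ A n
1≤A n = ℕ.≤-trans (1≤b² n) (ℕ.m≤n*m (b² n) 4)

9A≤A : ∀ n → 9 ℕ.* A n ℕ.≤ A (suc n)
9A≤A n = ℕ.≤-trans (ℕ.≤-reflexive (lemma (b² n))) (ℕ.*-monoʳ-≤ 4 (9b²≤b² n))
  where
  lemma : ∀ x → 9 ℕ.* (4 ℕ.* x) ≡ 4 ℕ.* (9 ℕ.* x)
  lemma = ℕ-Solver.solve-∀

81B≤B : ∀ n → 81 ℕ.* B n ℕ.≤ B (suc n)
81B≤B n = ℕ.≤-trans (ℕ.≤-reflexive (lemma (b² n))) (ℕ.*-monoʳ-≤ 4 (ℕ.*-mono-≤ (9b²≤b² n) (9b²≤b² n)))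
  where
  lemma : ∀ x → 81 ℕ.* (4 ℕ.* (x ℕ.* x)) ≡ 4 ℕ.* ((9 ℕ.* x) ℕ.* (9 ℕ.* x))
  lemma = ℕ-Solver.solve-∀

-- The hypothesis `separated` for constant weights, whose variation supplies the zeros. Growth by a
-- factor 9 leaves room, since the induction needs only a factor 4.
separated-A : ∀ n → n ℕ.+ ∑ℕ n (λ j → 2 ℕ.* A j ℕ.+ 0) ℕ.+ n ℕ.* 0 ℕ.≤ A n
separated-A n = ℕ.≤-trans (ℕ.≤-reflexive (≡.trans (≡.cong (s ℕ.+_) (ℕ.*-zeroʳ n)) (ℕ.+-identityʳ s))) (go n)
  where
  s = n ℕ.+ ∑ℕ n (λ j → 2 ℕ.* A j ℕ.+ 0)
  open ℕ.≤-Reasoning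
  go : ∀ n → n ℕ.+ ∑ℕ n (λ j → 2 ℕ.* A j ℕ.+ 0) ℕ.≤ A n
  go zero    = ℕ.z≤n
  go (suc n) = begin
    suc n ℕ.+ (Σ ℕ.+ (2 ℕ.* A n ℕ.+ 0)) ≡⟨ lemma n Σ (A n) ⟩
    (n ℕ.+ Σ) ℕ.+ 1 ℕ.+ 2 ℕ.* A n       ≤⟨ ℕ.+-monoˡ-≤ (2 ℕ.* A n) (ℕ.+-mono-≤ (go n) (1≤A n)) ⟩
    A n ℕ.+ A n ℕ.+ 2 ℕ.* A n           ≡⟨ lemma′ (A n) ⟩
    4 ℕ.* A n                           ≤⟨ ℕ.*-monoˡ-≤ (A n) (ℕ.m≤m+n 4 5) ⟩
    9 ℕ.* A n                           ≤⟨ 9A≤A n ⟩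
    A (suc n)                           ∎
    where
    Σ = ∑ℕ n (λ j → 2 ℕ.* A j ℕ.+ 0)
    lemma : ∀ n s a → suc n ℕ.+ (s ℕ.+ (2 ℕ.* a ℕ.+ 0)) ≡ (n ℕ.+ s) ℕ.+ 1 ℕ.+ 2 ℕ.* a
    lemma = ℕ-Solver.solve-∀
    lemma′ : ∀ a → a ℕ.+ a ℕ.+ 2 ℕ.* a ≡ 4 ℕ.* a
    lemma′ = ℕ-Solver.solve-∀

-- Here the weight is the indicator of frequency `A n`, of variation 2 `A n`. `B n` is shared out in
-- halves: one half bounds the contribution of earlier solutions by geometric growth, the other
-- bounds the weight because 4n ≤ b².
separated-B : ∀ n → n ℕ.+ ∑ℕ n (λ j → 2 ℕ.* B j ℕ.+ 2 ℕ.* A j) ℕ.+ n ℕ.* (2 ℕ.* A n) ℕ.≤ B n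
separated-B n = ℕ.*-cancelˡ-≤ 2 (begin
  2 ℕ.* (n ℕ.+ Σ n ℕ.+ n ℕ.* (2 ℕ.* A n))             ≡⟨ lemma n (Σ n) (b² n) ⟩
  2 ℕ.* (n ℕ.+ Σ n) ℕ.+ 4 ℕ.* (4 ℕ.* n ℕ.* b² n)       ≤⟨ ℕ.+-mono-≤ (previous n) (ℕ.*-monoʳ-≤ 4 (ℕ.*-monoˡ-≤ (b² n) (4n≤b² n))) ⟩
  B n ℕ.+ B n                                         ≡⟨ ≡.cong (B n ℕ.+_) (≡.sym (ℕ.+-identityʳ (B n))) ⟩
  2 ℕ.* B n                                           ∎)
  where
  open ℕ.≤-Reasoning
  Σ : ℕ → ℕ
  Σ n = ∑ℕ n (λ j → 2 ℕ.* B j ℕ.+ 2 ℕ.* A j)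
  lemma : ∀ n s x → 2 ℕ.* (n ℕ.+ s ℕ.+ n ℕ.* (2 ℕ.* (4 ℕ.* x))) ≡ 2 ℕ.* (n ℕ.+ s) ℕ.+ 4 ℕ.* (4 ℕ.* n ℕ.* x)
  lemma = ℕ-Solver.solve-∀
  4n≤b² : ∀ n → 4 ℕ.* n ℕ.≤ b² n
  4n≤b² zero    = ℕ.z≤n
  4n≤b² (suc n) = begin
    4 ℕ.* suc n               ≡⟨ ℕ.*-suc 4 n ⟩
    4 ℕ.+ 4 ℕ.* n             ≤⟨ ℕ.+-mono-≤ (ℕ.≤-trans (ℕ.m≤m+n 4 4) (ℕ.*-monoʳ-≤ 8 (1≤b² n))) (4n≤b² n) ⟩
    8 ℕ.* b² n ℕ.+ b² n       ≡⟨ ℕ.+-comm (8 ℕ.* b² n) (b² n) ⟩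
    9 ℕ.* b² n                ≤⟨ 9b²≤b² n ⟩
    b² (suc n)                ∎
  previous : ∀ n → 2 ℕ.* (n ℕ.+ Σ n) ℕ.≤ B n
  previous zero    = ℕ.z≤n
  previous (suc n) = begin
    2 ℕ.* (suc n ℕ.+ (Σ n ℕ.+ (2 ℕ.* B n ℕ.+ 2 ℕ.* A n)))
      ≡⟨ step n (Σ n) (B n) (A n) ⟩
    2 ℕ.* (n ℕ.+ Σ n) ℕ.+ 2 ℕ.* 1 ℕ.+ 4 ℕ.* B n ℕ.+ 4 ℕ.* A n
      ≤⟨ ℕ.+-mono-≤ (ℕ.+-monoˡ-≤ (4 ℕ.* B n) (ℕ.+-mono-≤ (previous n) (ℕ.*-monoʳ-≤ 2 (ℕ.≤-trans (1≤A n) (A≤B n)))))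
                    (ℕ.*-monoʳ-≤ 4 (A≤B n)) ⟩
    B n ℕ.+ 2 ℕ.* B n ℕ.+ 4 ℕ.* B n ℕ.+ 4 ℕ.* B n
      ≡⟨ collect (B n) ⟩
    11 ℕ.* B n
      ≤⟨ ℕ.*-monoˡ-≤ (B n) (ℕ.m≤m+n 11 70) ⟩
    81 ℕ.* B n
      ≤⟨ 81B≤B n ⟩
    B (suc n) ∎
    where
    step : ∀ n s x y → 2 ℕ.* (suc n ℕ.+ (s ℕ.+ (2 ℕ.* x ℕ.+ 2 ℕ.* y))) ≡ 2 ℕ.* (n ℕ.+ s) ℕ.+ 2 ℕ.* 1 ℕ.+ 4 ℕ.* x ℕ.+ 4 ℕ.* y
    step = ℕ-Solver.solve-∀
    collect : ∀ x → x ℕ.+ 2 ℕ.* x ℕ.+ 4 ℕ.* x ℕ.+ 4 ℕ.* x ≡ 11 ℕ.* x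
    collect = ℕ-Solver.solve-∀

-- A common multiple of the frequencies, and counting on the grid

∏B : ℕ → ℕ
∏B zero    = 1
∏B (suc N) = ∏B N ℕ.* B N

-- The product of the `B j` with j < N and j ≠ n, built without division. For n ≥ N it is the full
-- product, so the periods formed from it are nonzero for every n.
cofactor : ℕ → ℕ → ℕ
cofactor zero    n = 1
cofactor (suc N) n with n ℕ.≟ N
... | yes _ = ∏B N
... | no  _ = cofactor N n ℕ.* B N

∏B-nonZero : ∀ N → NonZero (∏B N)
∏B-nonZero zero    = _
∏B-nonZero (suc N) = ℕ.m*n≢0 (∏B N) (B N) {{∏B-nonZero N}} {{B-nonZero N}}

cofactor-nonZero : ∀ N n → NonZero (cofactor N n)
cofactor-nonZero zero    n = _
cofactor-nonZero (suc N) n with n ℕ.≟ N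
... | yes _ = ∏B-nonZero N
... | no  _ = ℕ.m*n≢0 (cofactor N n) (B N) {{cofactor-nonZero N n}} {{B-nonZero N}}

B*cofactor : ∀ {N n} → n ℕ.< N → B n ℕ.* cofactor N n ≡ ∏B N
B*cofactor {suc N} {n} n<1+N with n ℕ.≟ N
... | yes ≡.refl = ℕ.*-comm (B N) (∏B N)
... | no  n≢N    = ≡.trans (≡.sym (ℕ.*-assoc (B n) (cofactor N n) (B N)))
  (≡.cong (ℕ._* B N) (B*cofactor (ℕ.≤∧≢⇒< (ℕ.≤-pred n<1+N) n≢N)))

-- Every α in the cell [i/Q , (i+1)/Q) has lo/M ≤ α·C - k < hi/M for some natural number k.
InArc : (Q i C M lo hi : ℕ) → Set
InArc Q i C M lo hi = ∃[ k ]
  (M ℕ.* k ℕ.+ lo) ℕ.* Q ℕ.≤ M ℕ.* (i ℕ.* C) × M ℕ.* (suc i ℕ.* C) ℕ.≤ (M ℕ.* k ℕ.+ hi) ℕ.* Q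

-- As `Q` is C times `M * l`, the number (i/Q)·C is i/(M·l): one turn takes `M * l` cells, and an
-- arc of k/M turns takes k·l of them.
inArc : ∀ {Q i} M lo hi C l → C ℕ.* (M ℕ.* l) ≡ Q →
  ∃[ k ] k ℕ.* (M ℕ.* l) ℕ.+ lo ℕ.* l ℕ.≤ i × i ℕ.< k ℕ.* (M ℕ.* l) ℕ.+ hi ℕ.* l →
  InArc Q i C M lo hi
inArc {Q} {i} M lo hi C l ≡.refl (k , lower , upper) = k ,
  ℕ.≤-trans (ℕ.≤-reflexive (lemma M k lo C l)) (ℕ.*-monoʳ-≤ M (ℕ.*-monoˡ-≤ C lower)) ,
  ℕ.≤-trans (ℕ.*-monoʳ-≤ M (ℕ.*-monoˡ-≤ C upper)) (ℕ.≤-reflexive (≡.sym (lemma M k hi C l)))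
  where
  lemma : ∀ m k x c l → (m ℕ.* k ℕ.+ x) ℕ.* (c ℕ.* (m ℕ.* l)) ≡ m ℕ.* ((k ℕ.* (m ℕ.* l) ℕ.+ x ℕ.* l) ℕ.* c)
  lemma = ℕ-Solver.solve-∀

-- The first N solutions are tested against the rectangle [0 , p/M) × [q/M , r/M). The tolerated
-- deviation of either lacunary sum is 1/h times its trivial bound N·M.
module Discretised (N M p q r h : ℕ) .{{N≢0 : NonZero N}} .{{M≢0 : NonZero M}}
  (p≤M : p ℕ.≤ M) (q≤r : q ℕ.≤ r) (r≤M : r ℕ.≤ M) where

  Q : ℕ
  Q = M ℕ.* ∏B N

  lA lB : ℕ → ℕ
  lB n = cofactor N n
  lA n = cofactor N n ℕ.* b² n

  instance
    lB-nonZero : ∀ {n} → NonZero (M ℕ.* lB n)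
    lB-nonZero {n} = ℕ.m*n≢0 M (lB n) {{M≢0}} {{cofactor-nonZero N n}}

    lA-nonZero : ∀ {n} → NonZero (M ℕ.* lA n)
    lA-nonZero {n} = ℕ.m*n≢0 M (lA n) {{M≢0}}
      {{ℕ.m*n≢0 (cofactor N n) (b² n) {{cofactor-nonZero N n}} {{ℕ.>-nonZero (1≤b² n)}}}}

  B*lB : ∀ {n} → n ℕ.< N → B n ℕ.* (M ℕ.* lB n) ≡ Q
  B*lB {n} n<N = ≡.trans (lemma (B n) M (lB n)) (≡.cong (M ℕ.*_) (B*cofactor n<N))
    where
    lemma : ∀ x y z → x ℕ.* (y ℕ.* z) ≡ y ℕ.* (x ℕ.* z)
    lemma = ℕ-Solver.solve-∀

  A*lA : ∀ {n} → n ℕ.< N → A n ℕ.* (M ℕ.* lA n) ≡ Q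
  A*lA {n} n<N = ≡.trans (lemma (b² n) M (lB n)) (B*lB n<N)
    where
    lemma : ∀ x y z → 4 ℕ.* x ℕ.* (y ℕ.* (z ℕ.* x)) ≡ 4 ℕ.* (x ℕ.* x) ℕ.* (y ℕ.* z)
    lemma = ℕ-Solver.solve-∀

  module OA (n : ℕ) = Oscillation M (lA n) 0 p ℕ.z≤n p≤M
  module OB (n : ℕ) = Oscillation M (lB n) q r q≤r r≤M

  module MA = SecondMoment Q M (λ _ _ → 1ℤ) OA.φ (λ _ → 0) (λ n → 2 ℕ.* A n) (λ n → M ℕ.* lA n) N
    (λ _ _ → ℕ.≤-refl) OA.∣φ∣≤M
    (λ _ _ → ℕ.≤-reflexive (≡.trans (∑ℕ-const Q 0) (ℕ.*-zeroʳ Q)))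
    (λ n n<N → ≡.subst (λ Q → variation Q (OA.φ n) ℕ.≤ M ℕ.* (2 ℕ.* A n)) (A*lA n<N) (OA.variation-φ n (A n)))
    OA.∣∑φ∣≤
    (λ n n<N → ℕ.≤-trans (ℕ.*-monoˡ-≤ (M ℕ.* lA n) (separated-A n)) (ℕ.≤-reflexive (A*lA n<N)))

  -- The slow indicator of frequency `A n` is the weight and the fast one of frequency `B n`
  -- oscillates; the opposite choice would violate `separated`.
  module MB = SecondMoment Q M (λ n i → + OA.arc n i) OB.φ (λ n → 2 ℕ.* A n) (λ n → 2 ℕ.* B n) (λ n → M ℕ.* lB n) N
    OA.arc≤1 OB.∣φ∣≤M
    (λ n n<N → ≡.subst (λ Q → variation Q (λ i → + OA.arc n i) ℕ.≤ 2 ℕ.* A n) (A*lA n<N) (OA.variation-arc n (A n)))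
    (λ n n<N → ≡.subst (λ Q → variation Q (OB.φ n) ℕ.≤ M ℕ.* (2 ℕ.* B n)) (B*lB n<N) (OB.variation-φ n (B n)))
    OB.∣∑φ∣≤
    (λ n n<N → ℕ.≤-trans (ℕ.*-monoˡ-≤ (M ℕ.* lB n) (separated-B n)) (ℕ.≤-reflexive (B*lB n<N)))

  hit : ℕ → ℕ → ℕ
  hit i n = OA.arc n i ℕ.* OB.arc n i

  exceptional : ℕ → ℕ
  exceptional i = exceeds (N ℕ.* M) h (MA.S N i) ℕ.+ exceeds (N ℕ.* M) h (MB.S N i)

  hit≤1 : ∀ i n → hit i n ℕ.≤ 1
  hit≤1 i n = ℕ.*-mono-≤ {OA.arc n i} {1} (OA.arc≤1 n i) (OB.arc≤1 n i)

  hit≡1 : ∀ {i n} → n ℕ.< N → hit i n ≡ 1 → InArc Q i (A n) M 0 p × InArc Q i (B n) M q r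
  hit≡1 {i} {n} n<N e =
    inArc M 0 p (A n) (lA n) (A*lA n<N) (OA.arc≡1 n i (ℕ.m*n≡1⇒m≡1 (OA.arc n i) (OB.arc n i) e)) ,
    inArc M q r (B n) (lB n) (B*lB n<N) (OB.arc≡1 n i (ℕ.m*n≡1⇒n≡1 (OA.arc n i) (OB.arc n i) e))

  -- Chebyshev at threshold NM/h against a second moment of at most 3M²QN: the factors M² cancel,
  -- and a proportion of 3h²/N of the cells remains.
  few-exceed : ∀ (S : ℕ → ℤ) → ∣ ∑ Q (λ i → S i ℤ.* S i) ∣ ℕ.≤ 3 ℕ.* (M ℕ.* M ℕ.* Q) ℕ.* N →
    ∑ℕ Q (λ i → exceeds (N ℕ.* M) h (S i)) ℕ.* N ℕ.≤ 3 ℕ.* (h ℕ.* h) ℕ.* Q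
  few-exceed S bound = ℕ.*-cancelʳ-≤ _ _ (N ℕ.* (M ℕ.* M))
    {{ℕ.m*n≢0 N (M ℕ.* M) {{N≢0}} {{ℕ.m*n≢0 M M {{M≢0}} {{M≢0}}}}}} (begin
    E ℕ.* N ℕ.* (N ℕ.* (M ℕ.* M))                  ≡⟨ lemma E N M ⟩
    E ℕ.* ((N ℕ.* M) ℕ.* (N ℕ.* M))                ≤⟨ chebyshev Q (N ℕ.* M) h S ⟩
    h ℕ.* h ℕ.* ∣ ∑ Q (λ i → S i ℤ.* S i) ∣        ≤⟨ ℕ.*-monoʳ-≤ (h ℕ.* h) bound ⟩
    h ℕ.* h ℕ.* (3 ℕ.* (M ℕ.* M ℕ.* Q) ℕ.* N)      ≡⟨ lemma′ h M Q N ⟩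
    3 ℕ.* (h ℕ.* h) ℕ.* Q ℕ.* (N ℕ.* (M ℕ.* M))    ∎)
    where
    open ℕ.≤-Reasoning
    E = ∑ℕ Q (λ i → exceeds (N ℕ.* M) h (S i))
    lemma : ∀ e n m → e ℕ.* n ℕ.* (n ℕ.* (m ℕ.* m)) ≡ e ℕ.* ((n ℕ.* m) ℕ.* (n ℕ.* m))
    lemma = ℕ-Solver.solve-∀
    lemma′ : ∀ h m q n → h ℕ.* h ℕ.* (3 ℕ.* (m ℕ.* m ℕ.* q) ℕ.* n) ≡ 3 ℕ.* (h ℕ.* h) ℕ.* q ℕ.* (n ℕ.* (m ℕ.* m))
    lemma′ = ℕ-Solver.solve-∀

  ∑-exceptional : ∑ℕ Q exceptional ℕ.* N ℕ.≤ 6 ℕ.* (h ℕ.* h) ℕ.* Q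
  ∑-exceptional = begin
    ∑ℕ Q exceptional ℕ.* N
      ≡⟨ ≡.cong (ℕ._* N) (∑ℕ-+ Q _ _) ⟩
    (EA ℕ.+ EB) ℕ.* N
      ≡⟨ ℕ.*-distribʳ-+ N EA EB ⟩
    EA ℕ.* N ℕ.+ EB ℕ.* N
      ≤⟨ ℕ.+-mono-≤ (few-exceed (MA.S N) (MA.∣∑S²∣≤ N ℕ.≤-refl)) (few-exceed (MB.S N) (MB.∣∑S²∣≤ N ℕ.≤-refl)) ⟩
    3 ℕ.* (h ℕ.* h) ℕ.* Q ℕ.+ 3 ℕ.* (h ℕ.* h) ℕ.* Q
      ≡⟨ lemma (h ℕ.* h) Q ⟩
    6 ℕ.* (h ℕ.* h) ℕ.* Q ∎
    where
    open ℕ.≤-Reasoning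
    EA = ∑ℕ Q (λ i → exceeds (N ℕ.* M) h (MA.S N i))
    EB = ∑ℕ Q (λ i → exceeds (N ℕ.* M) h (MB.S N i))
    lemma : ∀ x y → 3 ℕ.* x ℕ.* y ℕ.+ 3 ℕ.* x ℕ.* y ≡ 6 ℕ.* x ℕ.* y
    lemma = ℕ-Solver.solve-∀

  hits-decomposed : ∀ i n → + (M ℕ.* M) ℤ.* + ∑ℕ n (hit i) ≡
    + M ℤ.* MB.S n i ℤ.+ + (r ∸ q) ℤ.* MA.S n i ℤ.+ + n ℤ.* (+ p ℤ.* + (r ∸ q))
  hits-decomposed i zero = lemma (+ (M ℕ.* M)) (+ M) (+ (r ∸ q)) (+ p ℤ.* + (r ∸ q))
    where
    lemma : ∀ x m w t → x ℤ.* 0ℤ ≡ m ℤ.* 0ℤ ℤ.+ w ℤ.* 0ℤ ℤ.+ 0ℤ ℤ.* t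
    lemma = ℤ-Solver.solve-∀
  hits-decomposed i (suc n) = begin
    + (M ℕ.* M) ℤ.* (+ ∑ℕ n (hit i) ℤ.+ + (I ℕ.* J))
      ≡⟨ ℤ.*-distribˡ-+ (+ (M ℕ.* M)) (+ ∑ℕ n (hit i)) (+ (I ℕ.* J)) ⟩
    + (M ℕ.* M) ℤ.* + ∑ℕ n (hit i) ℤ.+ + (M ℕ.* M) ℤ.* + (I ℕ.* J)
      ≡⟨ ≡.cong₂ ℤ._+_ (hits-decomposed i n) (≡.cong₂ ℤ._*_ (ℤ.pos-* M M) (ℤ.pos-* I J)) ⟩
    + M ℤ.* MB.S n i ℤ.+ + w ℤ.* MA.S n i ℤ.+ + n ℤ.* (+ p ℤ.* + w) ℤ.+ + M ℤ.* + M ℤ.* (+ I ℤ.* + J)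
      ≡⟨ lemma (+ M) (MB.S n i) (+ w) (MA.S n i) (+ n) (+ p) (+ I) (+ J) ⟩
    + M ℤ.* (MB.S n i ℤ.+ + I ℤ.* (+ M ℤ.* + J ℤ.- + w))
      ℤ.+ + w ℤ.* (MA.S n i ℤ.+ 1ℤ ℤ.* (+ M ℤ.* + I ℤ.- + p)) ℤ.+ (1ℤ ℤ.+ + n) ℤ.* (+ p ℤ.* + w) ∎
    where
    open ≡.≡-Reasoning
    I = OA.arc n i
    J = OB.arc n i
    w = r ∸ q
    lemma : ∀ m s w t n p x y →
      m ℤ.* s ℤ.+ w ℤ.* t ℤ.+ n ℤ.* (p ℤ.* w) ℤ.+ m ℤ.* m ℤ.* (x ℤ.* y) ≡
      m ℤ.* (s ℤ.+ x ℤ.* (m ℤ.* y ℤ.- w)) ℤ.+ w ℤ.* (t ℤ.+ 1ℤ ℤ.* (m ℤ.* x ℤ.- p)) ℤ.+ (1ℤ ℤ.+ n) ℤ.* (p ℤ.* w)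
    lemma = ℤ-Solver.solve-∀

  -- In an unexceptional cell both sums are at most NM/h in absolute value. In the decomposition of
  -- the hits they carry the factors M and r - q ≤ M, so together they cost at most 2M²N/h.
  many-hits : ∀ i → exceptional i ≡ 0 →
    h ℕ.* (N ℕ.* (p ℕ.* (r ∸ q))) ℕ.≤ h ℕ.* (M ℕ.* M ℕ.* ∑ℕ N (hit i)) ℕ.+ 2 ℕ.* (M ℕ.* M) ℕ.* N
  many-hits i e = ℤ.drop‿+≤+ (begin
    + (h ℕ.* (N ℕ.* (p ℕ.* w)))
      ≡⟨ ≡.trans (ℤ.pos-* h _) (≡.cong (+ h ℤ.*_) (≡.trans (ℤ.pos-* N _) (≡.cong (+ N ℤ.*_) (ℤ.pos-* p w)))) ⟩
    + h ℤ.* (+ N ℤ.* (+ p ℤ.* + w))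
      ≡⟨ lemma (+ h) (+ N ℤ.* (+ p ℤ.* + w)) (+ M) (MB.S N i) (+ w) (MA.S N i) ⟩
    + h ℤ.* (+ M ℤ.* MB.S N i ℤ.+ + w ℤ.* MA.S N i ℤ.+ + N ℤ.* (+ p ℤ.* + w))
      ℤ.+ (+ M ℤ.* (+ h ℤ.* ℤ.- MB.S N i) ℤ.+ + w ℤ.* (+ h ℤ.* ℤ.- MA.S N i))
      ≤⟨ ℤ.+-mono-≤ (ℤ.≤-reflexive (≡.cong (+ h ℤ.*_) (≡.sym (hits-decomposed i N))))
           (ℤ.+-mono-≤ (scaled M (MB.S N i) (exceeds≡0 (MB.S N i) (ℕ.m+n≡0⇒n≡0 EA e)))
                       (scaled w (MA.S N i) (exceeds≡0 (MA.S N i) (ℕ.m+n≡0⇒m≡0 EA e)))) ⟩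
    + h ℤ.* (+ (M ℕ.* M) ℤ.* + ∑ℕ N (hit i)) ℤ.+ (+ (M ℕ.* (N ℕ.* M)) ℤ.+ + (w ℕ.* (N ℕ.* M)))
      ≡⟨ ≡.cong (λ z → z ℤ.+ (+ (M ℕ.* (N ℕ.* M)) ℤ.+ + (w ℕ.* (N ℕ.* M))))
           (≡.trans (≡.cong (+ h ℤ.*_) (≡.sym (ℤ.pos-* (M ℕ.* M) _))) (≡.sym (ℤ.pos-* h _))) ⟩
    + (h ℕ.* (M ℕ.* M ℕ.* ∑ℕ N (hit i)) ℕ.+ (M ℕ.* (N ℕ.* M) ℕ.+ w ℕ.* (N ℕ.* M)))
      ≤⟨ ℤ.+≤+ (ℕ.+-monoʳ-≤ (h ℕ.* (M ℕ.* M ℕ.* ∑ℕ N (hit i)))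
           (ℕ.+-monoʳ-≤ (M ℕ.* (N ℕ.* M)) (ℕ.*-monoˡ-≤ (N ℕ.* M) (ℕ.≤-trans (ℕ.m∸n≤m r q) r≤M)))) ⟩
    + (h ℕ.* (M ℕ.* M ℕ.* ∑ℕ N (hit i)) ℕ.+ (M ℕ.* (N ℕ.* M) ℕ.+ M ℕ.* (N ℕ.* M)))
      ≡⟨ ≡.cong (λ z → + (h ℕ.* (M ℕ.* M ℕ.* ∑ℕ N (hit i)) ℕ.+ z)) (lemma′ M N) ⟩
    + (h ℕ.* (M ℕ.* M ℕ.* ∑ℕ N (hit i)) ℕ.+ 2 ℕ.* (M ℕ.* M) ℕ.* N) ∎)
    where
    open ℤ.≤-Reasoning
    w = r ∸ q
    EA = exceeds (N ℕ.* M) h (MA.S N i)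
    lemma : ∀ h t m s w u → h ℤ.* t ≡ h ℤ.* (m ℤ.* s ℤ.+ w ℤ.* u ℤ.+ t) ℤ.+ (m ℤ.* (h ℤ.* ℤ.- s) ℤ.+ w ℤ.* (h ℤ.* ℤ.- u))
    lemma = ℤ-Solver.solve-∀
    lemma′ : ∀ m n → m ℕ.* (n ℕ.* m) ℕ.+ m ℕ.* (n ℕ.* m) ≡ 2 ℕ.* (m ℕ.* m) ℕ.* n
    lemma′ = ℕ-Solver.solve-∀
    -i≤∣i∣ : ∀ i → ℤ.- i ℤ.≤ + ∣ i ∣
    -i≤∣i∣ (+ zero)  = ℤ.≤-refl
    -i≤∣i∣ (+ suc n) = ℤ.-≤+
    -i≤∣i∣ -[1+ n ]  = ℤ.≤-refl
    scaled : ∀ m s {t} → h ℕ.* ∣ s ∣ ℕ.≤ t → + m ℤ.* (+ h ℤ.* ℤ.- s) ℤ.≤ + (m ℕ.* t)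
    scaled m s {t} bound = begin
      + m ℤ.* (+ h ℤ.* ℤ.- s)      ≤⟨ ℤ.*-monoˡ-≤-nonNeg (+ m) (ℤ.*-monoˡ-≤-nonNeg (+ h) (-i≤∣i∣ s)) ⟩
      + m ℤ.* (+ h ℤ.* + ∣ s ∣)    ≡⟨ ≡.trans (≡.cong (+ m ℤ.*_) (≡.sym (ℤ.pos-* h ∣ s ∣))) (≡.sym (ℤ.pos-* m _)) ⟩
      + (m ℕ.* (h ℕ.* ∣ s ∣))      ≤⟨ ℤ.+≤+ (ℕ.*-monoʳ-≤ m bound) ⟩
      + (m ℕ.* t)                  ∎

-- Ordered field arithmetic, the Archimedean property and powers

module OrderedField (em : ExcludedMiddle 0ℓ) (R : CompleteOrderedField) where

  open CompleteOrderedField R public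
  open Mult semiring public using (×1-homo-*; ×-homo-+) renaming (_×_ to _×ℝ_)
  open Exp semiring public using (_^_; ^-homo-*; ^-congˡ; ^-assocʳ)
  open RingProperties ring using (-‿distribˡ-*; -‿distribʳ-*; -‿involutive; -0#≈0#)
  open AbelianGroupProperties +-abelianGroup using (⁻¹-∙-comm)
  open DecTotalOrder decTotalOrder public using ()
    renaming (refl to ≤-refl; trans to ≤-trans; antisym to ≤-antisym)
  open StrictTotalOrder strictTotalOrder public using (compare)
    renaming (trans to <-trans; irrefl to <-irrefl; asym to <-asym; <-respʳ-≈ to <-respʳ; <-respˡ-≈ to <-respˡ)
  open import Relation.Binary.Reasoning.Setoid setoid

  fromℕ : ℕ → Carrier
  fromℕ n = n ×ℝ 1#

  fromℕ-+ : ∀ m n → fromℕ (m ℕ.+ n) ≈ fromℕ m + fromℕ n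
  fromℕ-+ = ×-homo-+ 1#

  fromℕ-* : ∀ m n → fromℕ (m ℕ.* n) ≈ fromℕ m * fromℕ n
  fromℕ-* = ×1-homo-*

  fromℕ-1 : fromℕ 1 ≈ 1#
  fromℕ-1 = +-identityʳ 1#

  fromℤ : ℤ → Carrier
  fromℤ (+ n)    = fromℕ n
  fromℤ -[1+ n ] = - fromℕ (suc n)

  fromℤ-⊖ : ∀ m n → fromℤ (m ⊖ n) ≈ fromℕ m - fromℕ n
  fromℤ-⊖ m zero    = sym (trans (+-congˡ -0#≈0#) (+-identityʳ _))
  fromℤ-⊖ zero (suc n) = sym (+-identityˡ _)
  fromℤ-⊖ (suc m) (suc n) rewrite ℤ.[1+m]⊖[1+n]≡m⊖n m n = begin
    fromℤ (m ⊖ n)                               ≈⟨ fromℤ-⊖ m n ⟩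
    fromℕ m - fromℕ n                           ≈⟨ +-congʳ (+-identityʳ _) ⟨
    (fromℕ m + 0#) - fromℕ n                    ≈⟨ +-congʳ (+-congˡ (-‿inverseʳ 1#)) ⟨
    (fromℕ m + (1# - 1#)) - fromℕ n             ≈⟨ +-congʳ (+-assoc _ _ _) ⟨
    ((fromℕ m + 1#) - 1#) - fromℕ n             ≈⟨ +-congʳ (+-congʳ (+-comm _ _)) ⟩
    ((1# + fromℕ m) - 1#) - fromℕ n             ≈⟨ +-assoc _ _ _ ⟩
    (1# + fromℕ m) + (- 1# - fromℕ n)           ≈⟨ +-congˡ (⁻¹-∙-comm _ _) ⟩
    fromℕ (suc m) - fromℕ (suc n)               ∎

  fromℤ-neg : ∀ i → fromℤ (ℤ.- i) ≈ - fromℤ i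
  fromℤ-neg (+ zero)  = sym -0#≈0#
  fromℤ-neg (+ suc n) = refl
  fromℤ-neg -[1+ n ]  = sym (-‿involutive _)

  fromℤ-+ : ∀ i j → fromℤ (i ℤ.+ j) ≈ fromℤ i + fromℤ j
  fromℤ-+ (+ m)    (+ n)    = fromℕ-+ m n
  fromℤ-+ (+ m)    -[1+ n ] = fromℤ-⊖ m (suc n)
  fromℤ-+ -[1+ m ] (+ n)    = trans (fromℤ-⊖ n (suc m)) (+-comm _ _)
  fromℤ-+ -[1+ m ] -[1+ n ] = begin
    - fromℕ (suc (suc (m ℕ.+ n)))          ≡⟨ ≡.cong (λ k → - fromℕ (suc k)) (≡.sym (ℕ.+-suc m n)) ⟩
    - fromℕ (suc m ℕ.+ suc n)              ≈⟨ -‿cong (fromℕ-+ (suc m) (suc n)) ⟩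
    - (fromℕ (suc m) + fromℕ (suc n))      ≈⟨ ⁻¹-∙-comm _ _ ⟨
    - fromℕ (suc m) - fromℕ (suc n)        ∎

  fromℤ-*⁺ : ∀ m j → fromℤ (+ m ℤ.* j) ≈ fromℕ m * fromℤ j
  fromℤ-*⁺ m (+ n)    rewrite ≡.sym (ℤ.pos-* m n) = fromℕ-* m n
  fromℤ-*⁺ m -[1+ n ] = begin
    fromℤ (+ m ℤ.* -[1+ n ])          ≡⟨ ≡.cong fromℤ (≡.sym (ℤ.neg-distribʳ-* (+ m) (+ suc n))) ⟩
    fromℤ (ℤ.- (+ m ℤ.* + suc n))     ≈⟨ fromℤ-neg (+ m ℤ.* + suc n) ⟩
    - fromℤ (+ m ℤ.* + suc n)         ≈⟨ -‿cong (fromℤ-*⁺ m (+ suc n)) ⟩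
    - (fromℕ m * fromℕ (suc n))       ≈⟨ -‿distribʳ-* _ _ ⟩
    fromℕ m * - fromℕ (suc n)         ∎

  fromℤ-* : ∀ i j → fromℤ (i ℤ.* j) ≈ fromℤ i * fromℤ j
  fromℤ-* (+ m) j = fromℤ-*⁺ m j
  fromℤ-* -[1+ m ] j = begin
    fromℤ (-[1+ m ] ℤ.* j)            ≡⟨ ≡.cong fromℤ (≡.sym (ℤ.neg-distribˡ-* (+ suc m) j)) ⟩
    fromℤ (ℤ.- (+ suc m ℤ.* j))       ≈⟨ fromℤ-neg (+ suc m ℤ.* j) ⟩
    - fromℤ (+ suc m ℤ.* j)           ≈⟨ -‿cong (fromℤ-*⁺ (suc m) j) ⟩
    - (fromℕ (suc m) * fromℤ j)       ≈⟨ -‿distribˡ-* _ _ ⟩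
    - fromℕ (suc m) * fromℤ j         ∎

  coefficient : ℤ → Carrier
  coefficient (+ 1) = 1#
  coefficient i     = fromℤ i

  coefficient≈fromℤ : ∀ i → coefficient i ≈ fromℤ i
  coefficient≈fromℤ (+ zero)        = refl
  coefficient≈fromℤ (+ suc zero)    = sym fromℕ-1
  coefficient≈fromℤ (+ suc (suc n)) = refl
  coefficient≈fromℤ -[1+ n ]        = refl

  -- Sending + 1 to 1# itself lets the solver's constants match both 1# and fromℕ n for n ≥ 2.
  coefficient-homomorphism : ℤ.+-*-rawRing -Raw-AlmostCommutative⟶ fromCommutativeRing commutativeRing
  coefficient-homomorphism = record
    { ⟦_⟧    = coefficient
    ; +-homo = λ i j → via₂ (i ℤ.+ j) (fromℤ-+ i j) (+-cong (≈ᶜ i) (≈ᶜ j))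
    ; *-homo = λ i j → via₂ (i ℤ.* j) (fromℤ-* i j) (*-cong (≈ᶜ i) (≈ᶜ j))
    ; -‿homo = λ i → via₂ (ℤ.- i) (fromℤ-neg i) (-‿cong (≈ᶜ i))
    ; 0-homo = refl
    ; 1-homo = refl
    }
    where
    ≈ᶜ = coefficient≈fromℤ
    via₂ : ∀ i {x y} → fromℤ i ≈ x → y ≈ x → coefficient i ≈ y
    via₂ i p q = trans (≈ᶜ i) (trans p (sym q))

  open Algebra.Solver.Ring ℤ.+-*-rawRing (fromCommutativeRing commutativeRing) coefficient-homomorphism
    (λ i j → Maybe.map (λ eq → reflexive (≡.cong coefficient eq)) (dec⇒maybe (i ℤ.≟ j))) public
    using (solve; _:=_; _:+_; _:*_; _:-_; :-_; _:^_; con; Polynomial)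

  κ : ∀ {n} → ℕ → Polynomial n
  κ n = con (+ n)

  private
    variable x y z w : Carrier

  <⇒≤ : x < y → x ≤ y
  <⇒≤ = inj₁

  ≈⇒≤ : x ≈ y → x ≤ y
  ≈⇒≤ = inj₂

  ≤-respʳ : y ≈ z → x ≤ y → x ≤ z
  ≤-respʳ e p = ≤-trans p (≈⇒≤ e)

  ≤-respˡ : y ≈ z → y ≤ x → z ≤ x
  ≤-respˡ e p = ≤-trans (≈⇒≤ (sym e)) p

  <-≤-trans : x < y → y ≤ z → x < z
  <-≤-trans p (inj₁ q) = <-trans p q
  <-≤-trans p (inj₂ q) = <-respʳ q p

  ≤-<-trans : x ≤ y → y < z → x < z
  ≤-<-trans (inj₁ p) q = <-trans p q
  ≤-<-trans (inj₂ p) q = <-respˡ (sym p) q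

  <⇒≱ : x < y → ¬ (y ≤ x)
  <⇒≱ p q = <-irrefl refl (<-≤-trans p q)

  <-or-≥ : ∀ x y → x < y ⊎ y ≤ x
  <-or-≥ x y with compare x y
  ... | tri< p _ _ = inj₁ p
  ... | tri≈ _ p _ = inj₂ (inj₂ (sym p))
  ... | tri> _ _ p = inj₂ (inj₁ p)

  ≮⇒≥ : ¬ (x < y) → y ≤ x
  ≮⇒≥ {x} {y} p = [ (λ q → ⊥-elim (p q)) , (λ q → q) ]′ (<-or-≥ x y)

  0<-diff : x < y → 0# < y - x
  0<-diff {x} {y} p = <-respˡ (-‿inverseˡ x) (<-respʳ (+-comm _ _) (+-monoʳ-< (- x) p))

  0≤-diff : x ≤ y → 0# ≤ y - x
  0≤-diff (inj₁ p) = inj₁ (0<-diff p)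
  0≤-diff (inj₂ p) = inj₂ (trans (sym (-‿inverseʳ _)) (+-congʳ p))

  -- Inequalities are proved by exhibiting the difference of the two sides as
  -- a positive expression; the equation is left to the ring solver.
  <-by : y - x ≈ z → 0# < z → x < y
  <-by {y} {x} {z} e p = <-respˡ (+-identityʳ x) (<-respʳ eq (+-monoʳ-< x p))
    where
    eq : x + z ≈ y
    eq = trans (+-congˡ (sym e)) (solve 2 (λ x y → x :+ (y :- x) := y) refl x y)

  ≤-by : y - x ≈ z → 0# ≤ z → x ≤ y
  ≤-by e (inj₁ p) = inj₁ (<-by e p)
  ≤-by {y} {x} {z} e (inj₂ p) = inj₂ (trans (sym (+-identityʳ x))
    (trans (+-congˡ (trans p (sym e))) (solve 2 (λ x y → x :+ (y :- x) := y) refl x y)))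

  0<+ : 0# < x → 0# ≤ y → 0# < x + y
  0<+ {x} {y} p (inj₁ q) = <-trans p (<-respˡ (+-identityʳ x) (+-monoʳ-< x q))
  0<+ {x} {y} p (inj₂ q) = <-respʳ (trans (sym (+-identityʳ x)) (+-congˡ q)) p

  0≤+ : 0# ≤ x → 0# ≤ y → 0# ≤ x + y
  0≤+ (inj₁ p) q = inj₁ (0<+ p q)
  0≤+ (inj₂ p) q = ≤-trans q (inj₂ (trans (sym (+-identityˡ _)) (+-congʳ p)))

  0≤* : 0# ≤ x → 0# ≤ y → 0# ≤ x * y
  0≤* (inj₁ p) (inj₁ q) = inj₁ (*-pos p q)
  0≤* {x} (inj₁ p) (inj₂ q) = inj₂ (trans (sym (zeroʳ x)) (*-congˡ q))
  0≤* {_} {y} (inj₂ p) _ = inj₂ (trans (sym (zeroˡ y)) (*-congʳ p))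

  0≤1 : 0# ≤ 1#
  0≤1 = inj₁ 0#<1#

  +-mono-≤ : x ≤ y → z ≤ w → x + z ≤ y + w
  +-mono-≤ {x} {y} {z} {w} p q = ≤-by
    (solve 4 (λ x y z w → (y :+ w) :- (x :+ z) := (y :- x) :+ (w :- z)) refl x y z w)
    (0≤+ (0≤-diff p) (0≤-diff q))

  *-monoʳ-≤ : 0# ≤ z → x ≤ y → z * x ≤ z * y
  *-monoʳ-≤ {z} {x} {y} p q = ≤-by
    (solve 3 (λ x y z → z :* y :- z :* x := z :* (y :- x)) refl x y z) (0≤* p (0≤-diff q))

  *-monoˡ-≤ : 0# ≤ z → x ≤ y → x * z ≤ y * z
  *-monoˡ-≤ {z} {x} {y} p q = ≤-by
    (solve 3 (λ x y z → y :* z :- x :* z := z :* (y :- x)) refl x y z) (0≤* p (0≤-diff q))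

  *-mono-≤ : 0# ≤ x → 0# ≤ w → x ≤ y → z ≤ w → x * z ≤ y * w
  *-mono-≤ p q r s = ≤-trans (*-monoʳ-≤ p s) (*-monoˡ-≤ q r)

  *-monoʳ-< : 0# < z → x < y → z * x < z * y
  *-monoʳ-< {z} {x} {y} p q = <-by
    (solve 3 (λ x y z → z :* y :- z :* x := z :* (y :- x)) refl x y z) (*-pos p (0<-diff q))

  *-cancelʳ-< : 0# ≤ z → x * z < y * z → x < y
  *-cancelʳ-< {z} {x} {y} p q = [ (λ r → r) , (λ r → ⊥-elim (<⇒≱ q (*-monoˡ-≤ p r))) ]′ (<-or-≥ x y)

  *-cancelʳ-≤ : 0# < z → x * z ≤ y * z → x ≤ y
  *-cancelʳ-≤ {z} {x} {y} p q =
    ≮⇒≥ (λ r → <⇒≱ (<-respˡ (*-comm _ _) (<-respʳ (*-comm _ _) (*-monoʳ-< p r))) q)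

  ⁻¹-inverse : 0# < x → x * x ⁻¹ ≈ 1#
  ⁻¹-inverse p = ⁻¹-inverseʳ (λ e → <-irrefl (sym e) p)

  0<⁻¹ : 0# < x → 0# < x ⁻¹
  0<⁻¹ {x} p with compare 0# (x ⁻¹)
  ... | tri< q _ _ = q
  ... | tri≈ _ q _ = ⊥-elim (<-irrefl (trans (sym (zeroʳ x)) (trans (*-congˡ q) (⁻¹-inverse p))) 0#<1#)
  ... | tri> _ _ q = ⊥-elim (<-asym 0#<1# (<-by
    (trans (solve 2 (λ x y → κ 0 :- κ 1 := x :* (κ 0 :- y) :+ (x :* y :- κ 1)) refl x (x ⁻¹))
      (trans (+-congˡ (trans (+-congʳ (⁻¹-inverse p)) (-‿inverseʳ 1#))) (+-identityʳ _)))
    (*-pos p (0<-diff q))))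

  /-*-cancel : 0# < y → x / y * y ≈ x
  /-*-cancel {y} {x} p = trans (solve 3 (λ x y z → x :* z :* y := x :* (y :* z)) refl x y (y ⁻¹))
    (trans (*-congˡ (⁻¹-inverse p)) (*-identityʳ x))

  /-≤ : 0# < y → x ≤ z * y → x / y ≤ z
  /-≤ p q = *-cancelʳ-≤ p (≤-respˡ (sym (/-*-cancel p)) q)

  ≤-/ : 0# < y → z * y ≤ x → z ≤ x / y
  ≤-/ p q = *-cancelʳ-≤ p (≤-respʳ (sym (/-*-cancel p)) q)

  </ : 0# < y → z * y < x → z < x / y
  </ p q = *-cancelʳ-< (inj₁ p) (<-respʳ (sym (/-*-cancel p)) q)

  /-< : 0# < y → x < z * y → x / y < z
  /-< p q = *-cancelʳ-< (inj₁ p) (<-respˡ (sym (/-*-cancel p)) q)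

  0</ : 0# < x → 0# < y → 0# < x / y
  0</ p q = *-pos p (0<⁻¹ q)

  0≤/ : 0# ≤ x → 0# < y → 0# ≤ x / y
  0≤/ p q = 0≤* p (inj₁ (0<⁻¹ q))

  0≤fromℕ : ∀ n → 0# ≤ fromℕ n
  0≤fromℕ zero    = ≤-refl
  0≤fromℕ (suc n) = 0≤+ 0≤1 (0≤fromℕ n)

  0<fromℕ : ∀ n .{{_ : ℕ.NonZero n}} → 0# < fromℕ n
  0<fromℕ (suc n) = 0<+ 0#<1# (0≤fromℕ n)

  fromℕ-mono-≤ : ∀ {m n} → m ℕ.≤ n → fromℕ m ≤ fromℕ n
  fromℕ-mono-≤ (ℕ.z≤n {n}) = 0≤fromℕ n
  fromℕ-mono-≤ (ℕ.s≤s {m} {n} p) = +-mono-≤ ≤-refl (fromℕ-mono-≤ {m} {n} p)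

  fromℕ-mono-< : ∀ {m n} → m ℕ.< n → fromℕ m < fromℕ n
  fromℕ-mono-< {m} {n} p = <-≤-trans
    (<-by (solve 1 (λ x → (κ 1 :+ x) :- x := κ 1) refl (fromℕ m)) 0#<1#) (fromℕ-mono-≤ {suc m} {n} p)

  fromℕ-cancel-< : ∀ {m n} → fromℕ m < fromℕ n → m ℕ.< n
  fromℕ-cancel-< {m} {n} p = ℕ.≰⇒> (λ q → <⇒≱ p (fromℕ-mono-≤ {n} {m} q))

  fromℕ-cancel-≤ : ∀ {m n} → fromℕ m ≤ fromℕ n → m ℕ.≤ n
  fromℕ-cancel-≤ {m} {n} p = ℕ.≮⇒≥ (λ q → <⇒≱ (fromℕ-mono-< {n} {m} q) p)

  fromℕ-≤-<suc : ∀ {m n} → fromℕ m < fromℕ n + 1# → m ℕ.≤ n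
  fromℕ-≤-<suc {m} {n} p = ℕ.≤-pred (fromℕ-cancel-< {m} {suc n} (<-respʳ (+-comm _ _) p))

  1≤^ : ∀ n → 1# ≤ x → 1# ≤ x ^ n
  1≤^ zero    p = ≤-refl
  1≤^ (suc n) p = ≤-respˡ (*-identityˡ 1#) (*-mono-≤ 0≤1 (≤-trans 0≤1 (1≤^ n p)) p (1≤^ n p))

  0≤^ : ∀ n → 0# ≤ x → 0# ≤ x ^ n
  0≤^ zero    p = 0≤1
  0≤^ (suc n) p = 0≤* p (0≤^ n p)

  ^-monoˡ-≤ : ∀ n → 0# ≤ x → x ≤ y → x ^ n ≤ y ^ n
  ^-monoˡ-≤ zero    p q = ≤-refl
  ^-monoˡ-≤ (suc n) p q = *-mono-≤ p (0≤^ n (≤-trans p q)) q (^-monoˡ-≤ n p q)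

  ^-monoʳ-≤ : ∀ {m n} → 1# ≤ x → m ℕ.≤ n → x ^ m ≤ x ^ n
  ^-monoʳ-≤ p (ℕ.z≤n {n}) = 1≤^ n p
  ^-monoʳ-≤ p (ℕ.s≤s q)   = *-monoʳ-≤ (≤-trans 0≤1 p) (^-monoʳ-≤ p q)

  bernoulli : ∀ n → 0# ≤ x → 1# + fromℕ n * x ≤ (1# + x) ^ n
  bernoulli {x} zero p = ≈⇒≤ (solve 1 (λ x → κ 1 :+ κ 0 :* x := κ 1) refl x)
  bernoulli {x} (suc n) p = ≤-trans
    (≤-by (solve 2 (λ x m → ((κ 1 :+ x) :* (κ 1 :+ m :* x)) :- (κ 1 :+ (κ 1 :+ m) :* x) := m :* (x :* x))
             refl x (fromℕ n))
       (0≤* (0≤fromℕ n) (0≤* p p)))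
    (*-monoʳ-≤ (0≤+ 0≤1 p) (bernoulli n p))

  -- If ℕ were bounded with supremum s, then s - 1 would be a smaller upper bound.
  archimedean : ∀ x → ∃[ n ] x < fromℕ n
  archimedean x with em {∃[ n ] x < fromℕ n}
  ... | yes p = p
  ... | no ¬p = ⊥-elim (<⇒≱ s-1<s (least (s - 1#) smaller))
    where
    N : Carrier → Set
    N y = ∃[ n ] y ≈ fromℕ n
    sup = supremum N (0# , 0 , refl)
      (x , λ y (n , e) → ≤-respˡ (sym e) (≮⇒≥ (λ q → ¬p (n , q))))
    s = proj₁ sup
    upper = proj₁ (proj₂ sup)
    least = proj₂ (proj₂ sup)
    s-1<s : s - 1# < s
    s-1<s = <-by (solve 1 (λ s → s :- (s :- κ 1) := κ 1) refl s) 0#<1#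
    smaller : UpperBound N (s - 1#)
    smaller y (n , e) = ≤-respˡ (sym e) (≤-by
      (solve 2 (λ s n → (s :- κ 1) :- n := s :- (κ 1 :+ n)) refl s (fromℕ n))
      (0≤-diff (upper _ (suc n , refl))))

  -- A discrete intermediate value theorem. It yields integer parts, with `f` = `fromℕ`, and later
  -- places 16x between two consecutive stages.
  crossing : ∀ (f : ℕ → Carrier) x k j → f k ≤ x → x < f (j ℕ.+ k) →
             ∃[ i ] k ℕ.≤ i × f i ≤ x × x < f (suc i)
  crossing f x k zero p q = ⊥-elim (<⇒≱ q p)
  crossing f x k (suc j) p q with <-or-≥ x (f (suc k))
  ... | inj₁ r = k , ℕ.≤-refl , p , r
  ... | inj₂ r =
    let i , k<i , r′ = crossing f x (suc k) j r (≡.subst (λ i → x < f i) (≡.sym (ℕ.+-suc j k)) q)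
    in i , ℕ.<⇒≤ k<i , r′

  floor : ∀ {x} → 0# ≤ x → ∃[ k ] fromℕ k ≤ x × x < fromℕ k + 1#
  floor {x} p =
    let n , q = archimedean x
        k , _ , r , r′ = crossing fromℕ x 0 n p (≡.subst (λ i → x < fromℕ i) (≡.sym (ℕ.+-identityʳ n)) q)
    in k , r , <-respʳ (+-comm _ _) r′

  ^-unbounded : 1# < x → ∀ y → ∃[ n ] y < x ^ n
  ^-unbounded {x} p y =
    let n , q = archimedean (y / (x - 1#)) in
    n , <-≤-trans
      (<-respˡ (/-*-cancel (0<-diff p)) (<-respˡ (*-comm _ _) (<-respʳ (*-comm _ _) (*-monoʳ-< (0<-diff p) q))))
      (≤-trans (≤-by (solve 1 (λ z → (κ 1 :+ z) :- z := κ 1) refl _) 0≤1)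
        (≤-respʳ (^-congˡ n (solve 1 (λ x → κ 1 :+ (x :- κ 1) := x) refl x)) (bernoulli n (<⇒≤ (0<-diff p)))))

-- Finite sums and Cauchy products

module Series (em : ExcludedMiddle 0ℓ) (R : CompleteOrderedField) where

  open OrderedField em R public
  open Analysis em R public using (the; ∑<; Converges; lim; √_; exp; log; IsFloor; Null; ForAlmostAll∈⟨_,_⟩; SFrom; S; T≤)

  open import Relation.Binary.Reasoning.Setoid setoid

  private
    variable
      f g F G : ℕ → Carrier

  -- `∑<` unfolds at the first term; a sum that unfolds at the last one suits inductions over
  -- partial sums.
  sumTo : ℕ → (ℕ → Carrier) → Carrier
  sumTo zero    f = 0#
  sumTo (suc n) f = sumTo n f + f n

  tail : (ℕ → Carrier) → ℕ → Carrier
  tail f i = f (suc i)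

  sumTo-cons : ∀ n f → sumTo (suc n) f ≈ f 0 + sumTo n (tail f)
  sumTo-cons zero    f = +-comm 0# (f 0)
  sumTo-cons (suc n) f = trans (+-congʳ (sumTo-cons n f)) (+-assoc _ _ _)

  ∑<≈sumTo : ∀ n f → ∑< n f ≈ sumTo n f
  ∑<≈sumTo zero    f = refl
  ∑<≈sumTo (suc n) f = trans (+-congˡ (∑<≈sumTo n (tail f))) (sym (sumTo-cons n f))

  sumTo-cong : ∀ n → (∀ i → f i ≈ g i) → sumTo n f ≈ sumTo n g
  sumTo-cong zero    e = refl
  sumTo-cong (suc n) e = +-cong (sumTo-cong n e) (e n)

  sumTo-mono : ∀ n → (∀ i → f i ≤ g i) → sumTo n f ≤ sumTo n g
  sumTo-mono zero    p = ≤-refl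
  sumTo-mono (suc n) p = +-mono-≤ (sumTo-mono n p) (p n)

  sumTo-*ˡ : ∀ n c → sumTo n (λ i → c * f i) ≈ c * sumTo n f
  sumTo-*ˡ zero    c = sym (zeroʳ c)
  sumTo-*ˡ (suc n) c = trans (+-congʳ (sumTo-*ˡ n c)) (sym (distribˡ c _ _))

  0≤sumTo : ∀ n → (∀ i → 0# ≤ f i) → 0# ≤ sumTo n f
  0≤sumTo zero    p = ≤-refl
  0≤sumTo (suc n) p = 0≤+ (0≤sumTo n p) (p n)

  sumTo-monoˡ : ∀ {m n} → (∀ i → 0# ≤ f i) → m ℕ.≤ n → sumTo m f ≤ sumTo n f
  sumTo-monoˡ {f} p (ℕ.z≤n {n})     = 0≤sumTo n p
  sumTo-monoˡ {f} p (ℕ.s≤s {m} {n} q) =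
    ≤-respˡ (sym (sumTo-cons m f)) (≤-respʳ (sym (sumTo-cons n f))
      (+-mono-≤ ≤-refl (sumTo-monoˡ (λ i → p (suc i)) q)))

  -- Cauchy products

  conv : (ℕ → Carrier) → (ℕ → Carrier) → ℕ → Carrier
  conv f g zero    = f 0 * g 0
  conv f g (suc k) = f 0 * g (suc k) + conv (tail f) g k

  conv-congˡ : ∀ k → (∀ i → f i ≈ g i) → conv f F k ≈ conv g F k
  conv-congˡ zero    e = *-congʳ (e 0)
  conv-congˡ (suc k) e = +-cong (*-congʳ (e 0)) (conv-congˡ k (λ i → e (suc i)))

  conv-congʳ : ∀ k → (∀ i → f i ≈ g i) → conv F f k ≈ conv F g k
  conv-congʳ zero    e = *-congˡ (e 0)
  conv-congʳ (suc k) e = +-cong (*-congˡ (e (suc k))) (conv-congʳ k e)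

  conv-+ˡ : ∀ k → conv (λ i → f i + g i) F k ≈ conv f F k + conv g F k
  conv-+ˡ zero    = distribʳ _ _ _
  conv-+ˡ {f} {g} {F} (suc k) = trans (+-congˡ (conv-+ˡ k))
    (solve 5 (λ a b c u v → (a :+ b) :* c :+ (u :+ v) := (a :* c :+ u) :+ (b :* c :+ v)) refl
      (f 0) (g 0) (F (suc k)) (conv (tail f) F k) (conv (tail g) F k))

  conv-*ˡ : ∀ c k → conv (λ i → c * f i) F k ≈ c * conv f F k
  conv-*ˡ c zero    = *-assoc _ _ _
  conv-*ˡ {f} {F} c (suc k) = trans (+-congˡ (conv-*ˡ c k))
    (solve 4 (λ c a b u → c :* a :* b :+ c :* u := c :* (a :* b :+ u)) refl c (f 0) (F (suc k)) (conv (tail f) F k))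

  conv-*ʳ : ∀ c k → conv F (λ i → c * f i) k ≈ c * conv F f k
  conv-*ʳ {F} {f} c zero    = solve 3 (λ c a b → a :* (c :* b) := c :* (a :* b)) refl c (F 0) (f 0)
  conv-*ʳ {F} {f} c (suc k) = trans (+-congˡ (conv-*ʳ c k))
    (solve 4 (λ c a b u → a :* (c :* b) :+ c :* u := c :* (a :* b :+ u)) refl c (F 0) (f (suc k)) (conv (tail F) f k))

  0≤conv : ∀ k → (∀ i → 0# ≤ f i) → (∀ i → 0# ≤ g i) → 0# ≤ conv f g k
  0≤conv zero    p q = 0≤* (p 0) (q 0)
  0≤conv (suc k) p q = 0≤+ (0≤* (p 0) (q (suc k))) (0≤conv k (λ i → p (suc i)) q)

  -- The coefficients of the formal derivative of the power series with coefficients `f`. The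
  -- product rule below replaces binomial coefficients in the addition theorem of the exponential
  -- series.
  derivative : (ℕ → Carrier) → ℕ → Carrier
  derivative f i = fromℕ (suc i) * f (suc i)

  derivative-tail : ∀ f i → derivative (tail f) i + tail (tail f) i ≈ tail (derivative f) i
  derivative-tail f i = solve 2 (λ n x → (κ 1 :+ n) :* x :+ x := (κ 1 :+ (κ 1 :+ n)) :* x) refl (fromℕ i) (f (suc (suc i)))

  leibniz : ∀ f g k → derivative (conv f g) k ≈ conv (derivative f) g k + conv f (derivative g) k
  leibniz f g zero = solve 4 (λ a b c e → (κ 1 :+ κ 0) :* (a :* b :+ c :* e) :=
    (κ 1 :+ κ 0) :* c :* e :+ a :* ((κ 1 :+ κ 0) :* b)) refl (f 0) (g 1) (f 1) (g 0)
  leibniz f g (suc k) = begin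
    (1# + fromℕ (suc k)) * (f 0 * g (suc (suc k)) + conv (tail f) g (suc k))
      ≈⟨ solve 4 (λ n a b c → (κ 1 :+ n) :* (a :* b :+ c) := (κ 1 :+ n) :* (a :* b) :+ (c :+ n :* c)) refl
           (fromℕ (suc k)) (f 0) (g (suc (suc k))) (conv (tail f) g (suc k)) ⟩
    (1# + fromℕ (suc k)) * (f 0 * g (suc (suc k))) + (conv (tail f) g (suc k) + derivative (conv (tail f) g) k)
      ≈⟨ +-congˡ (+-congˡ (leibniz (tail f) g k)) ⟩
    (1# + fromℕ (suc k)) * (f 0 * g (suc (suc k))) +
      ((f 1 * g (suc k) + conv (tail (tail f)) g k) + (conv (derivative (tail f)) g k + conv (tail f) (derivative g) k))
      ≈⟨ solve 8 (λ n a b c e t u v → (κ 1 :+ n) :* (a :* b) :+ ((c :* e :+ t) :+ (u :+ v)) :=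
           ((κ 1 :+ κ 0) :* c :* e :+ (u :+ t)) :+ (a :* ((κ 1 :+ n) :* b) :+ v)) refl
           (fromℕ (suc k)) (f 0) (g (suc (suc k))) (f 1) (g (suc k)) (conv (tail (tail f)) g k)
           (conv (derivative (tail f)) g k) (conv (tail f) (derivative g) k) ⟩
    (derivative f 0 * g (suc k) + (conv (derivative (tail f)) g k + conv (tail (tail f)) g k))
      + conv f (derivative g) (suc k)
      ≈⟨ +-congʳ (+-congˡ (trans (sym (conv-+ˡ k)) (conv-congˡ k (derivative-tail f)))) ⟩
    conv (derivative f) g (suc k) + conv f (derivative g) (suc k) ∎

  sumTo-conv-cons : ∀ n f g →
    sumTo (suc n) (conv f g) ≈ f 0 * sumTo (suc n) g + sumTo n (conv (tail f) g)
  sumTo-conv-cons n f g = begin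
    sumTo (suc n) (conv f g)
      ≈⟨ sumTo-cons n (conv f g) ⟩
    f 0 * g 0 + sumTo n (λ k → f 0 * g (suc k) + conv (tail f) g k)
      ≈⟨ +-congˡ (sumTo-+ n) ⟩
    f 0 * g 0 + (sumTo n (λ k → f 0 * g (suc k)) + sumTo n (conv (tail f) g))
      ≈⟨ +-congˡ (+-congʳ (sumTo-*ˡ n (f 0))) ⟩
    f 0 * g 0 + (f 0 * sumTo n (tail g) + sumTo n (conv (tail f) g))
      ≈⟨ solve 4 (λ a b s t → a :* b :+ (a :* s :+ t) := a :* (b :+ s) :+ t) refl (f 0) (g 0) (sumTo n (tail g)) _ ⟩
    f 0 * (g 0 + sumTo n (tail g)) + sumTo n (conv (tail f) g)
      ≈⟨ +-congʳ (*-congˡ (sumTo-cons n g)) ⟨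
    f 0 * sumTo (suc n) g + sumTo n (conv (tail f) g) ∎
    where
    sumTo-+ : ∀ {f g} n → sumTo n (λ i → f i + g i) ≈ sumTo n f + sumTo n g
    sumTo-+ zero = sym (+-identityʳ 0#)
    sumTo-+ {f} {g} (suc n) = trans (+-congʳ (sumTo-+ n))
      (solve 4 (λ a b c e → (a :+ b) :+ (c :+ e) := (a :+ c) :+ (b :+ e)) refl (sumTo n f) (sumTo n g) (f n) (g n))

  -- The product runs over the index pairs of an m by n rectangle, all of which lie in the triangle
  -- of pairs with sum below m + n.
  sumTo-*-≤-conv : ∀ m n → (∀ i → 0# ≤ f i) → (∀ i → 0# ≤ g i) →
    sumTo m f * sumTo n g ≤ sumTo (m ℕ.+ n) (conv f g)
  sumTo-*-≤-conv {f} {g} zero n p q = ≤-respˡ (sym (zeroˡ _)) (0≤sumTo n (λ k → 0≤conv k p q))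
  sumTo-*-≤-conv {f} {g} (suc m) n p q = ≤-respˡ
    (trans (sym (distribʳ _ _ _)) (*-congʳ (sym (sumTo-cons m f))))
    (≤-respʳ (sym (sumTo-conv-cons (m ℕ.+ n) f g))
      (+-mono-≤ (*-monoʳ-≤ (p 0) (sumTo-monoˡ q (ℕ.m≤n+m n (suc m))))
                (sumTo-*-≤-conv m n (λ i → p (suc i)) q)))

  -- x ⊴ y means |x| ≤ y.
  infix 4 _⊴_
  _⊴_ : Carrier → Carrier → Set
  x ⊴ y = 0# ≤ y + x × 0# ≤ y - x

  ⊴-resp : ∀ {x x′ y y′} → x ≈ x′ → y ≈ y′ → x ⊴ y → x′ ⊴ y′
  ⊴-resp e e′ (p , q) = ≤-respʳ (+-cong e′ e) p , ≤-respʳ (+-cong e′ (-‿cong e)) q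

  ⊴-+ : ∀ {x y x′ y′} → x ⊴ y → x′ ⊴ y′ → x + x′ ⊴ y + y′
  ⊴-+ {x} {y} {x′} {y′} (p , q) (p′ , q′) =
    ≤-respʳ (solve 4 (λ x y u v → (y :+ x) :+ (v :+ u) := (y :+ v) :+ (x :+ u)) refl x y x′ y′) (0≤+ p p′) ,
    ≤-respʳ (solve 4 (λ x y u v → (y :- x) :+ (v :- u) := (y :+ v) :- (x :+ u)) refl x y x′ y′) (0≤+ q q′)

  halve-0≤ : ∀ {x} → 0# ≤ x + x → 0# ≤ x
  halve-0≤ {x} p = ≮⇒≥ (λ q → <⇒≱ (<-by (solve 1 (λ x → κ 0 :- (x :+ x) := (κ 0 :- x) :+ (κ 0 :- x)) refl x)
    (0<+ (0<-diff q) (<⇒≤ (0<-diff q)))) p)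

  -- No signs are distinguished: (y + x)(v + u) + (y - x)(v - u) = 2(yv + xu), and likewise for the
  -- difference.
  ⊴-* : ∀ {x y x′ y′} → x ⊴ y → x′ ⊴ y′ → x * x′ ⊴ y * y′
  ⊴-* {x} {y} {x′} {y′} (p , q) (p′ , q′) =
    halve-0≤ (≤-respʳ (solve 4 (λ x y u v → (y :+ x) :* (v :+ u) :+ (y :- x) :* (v :- u) := (y :* v :+ x :* u) :+ (y :* v :+ x :* u))
      refl x y x′ y′) (0≤+ (0≤* p p′) (0≤* q q′))) ,
    halve-0≤ (≤-respʳ (solve 4 (λ x y u v → (y :- x) :* (v :+ u) :+ (y :+ x) :* (v :- u) := (y :* v :- x :* u) :+ (y :* v :- x :* u))
      refl x y x′ y′) (0≤+ (0≤* q p′) (0≤* p q′)))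

  sumTo-diff-⊴ : ∀ j n → (∀ i → g i ⊴ G i) → sumTo (j ℕ.+ n) g - sumTo n g ⊴ sumTo (j ℕ.+ n) G - sumTo n G
  sumTo-diff-⊴ {g} {G} zero n p = ⊴-resp (sym (-‿inverseʳ _)) (sym (-‿inverseʳ _))
    (≤-respʳ (sym (+-identityʳ 0#)) ≤-refl , ≤-respʳ (sym (-‿inverseʳ 0#)) ≤-refl)
  sumTo-diff-⊴ {g} {G} (suc j) n p = ⊴-resp (move _ _ _) (move _ _ _) (⊴-+ (sumTo-diff-⊴ j n p) (p (j ℕ.+ n)))
    where
    move : ∀ a b c → (a - b) + c ≈ (a + c) - b
    move = solve 3 (λ a b c → (a :- b) :+ c := (a :+ c) :- b) refl

  -- The difference is the sum of the f i · g l over the part of a rectangle outside the triangle i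
  -- + l < m, and is therefore dominated termwise. The offset `j` makes the induction go through:
  -- removing the first term of `f` shortens one side of the rectangle and leaves the other.
  product-conv-diff-⊴ : ∀ m j → (∀ i → f i ⊴ F i) → (∀ i → g i ⊴ G i) →
    sumTo m f * sumTo (j ℕ.+ m) g - sumTo m (conv f g) ⊴ sumTo m F * sumTo (j ℕ.+ m) G - sumTo m (conv F G)
  product-conv-diff-⊴ {f} {F} {g} {G} zero j p q = ⊴-resp (zero-eq _) (zero-eq _)
    (≤-respʳ (sym (+-identityʳ 0#)) ≤-refl , ≤-respʳ (sym (-‿inverseʳ 0#)) ≤-refl)
    where
    zero-eq : ∀ a → 0# ≈ 0# * a - 0#
    zero-eq = solve 1 (λ a → κ 0 := κ 0 :* a :- κ 0) refl
  product-conv-diff-⊴ {f} {F} {g} {G} (suc m) j p q = ⊴-resp (regroup f g) (regroup F G)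
    (⊴-+ (⊴-* (p 0) (sumTo-diff-⊴ j (suc m) q))
      (≡.subst (λ n → sumTo m (tail f) * sumTo n g - sumTo m (conv (tail f) g) ⊴
                      sumTo m (tail F) * sumTo n G - sumTo m (conv (tail F) G))
        (≡.sym (ℕ.+-suc j m)) (product-conv-diff-⊴ m (suc j) (λ i → p (suc i)) q)))
    where
    regroup : ∀ f g → f 0 * (sumTo (j ℕ.+ suc m) g - sumTo (suc m) g) +
                      (sumTo m (tail f) * sumTo (j ℕ.+ suc m) g - sumTo m (conv (tail f) g)) ≈
                      sumTo (suc m) f * sumTo (j ℕ.+ suc m) g - sumTo (suc m) (conv f g)
    regroup f g = trans
      (solve 5 (λ a s t u v → a :* (s :- t) :+ (u :* s :- v) := (a :+ u) :* s :- (a :* t :+ v)) refl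
        (f 0) (sumTo (j ℕ.+ suc m) g) (sumTo (suc m) g) (sumTo m (tail f)) (sumTo m (conv (tail f) g)))
      (+-cong (*-congʳ (sym (sumTo-cons m f))) (-‿cong (sym (sumTo-conv-cons m f g))))

  0≤⊴ : ∀ {x} → 0# ≤ x → x ⊴ x
  0≤⊴ p = 0≤+ p p , ≤-respʳ (sym (-‿inverseʳ _)) ≤-refl

  conv-≤-sumTo-* : ∀ n → (∀ i → 0# ≤ f i) → (∀ i → 0# ≤ g i) → sumTo n (conv f g) ≤ sumTo n f * sumTo n g
  conv-≤-sumTo-* {f} {g} n p q = ≤-by refl (halve-0≤ (proj₁ (product-conv-diff-⊴ n 0 (λ i → 0≤⊴ (p i)) (λ i → 0≤⊴ (q i)))))

-- The exponential function, logarithms and square roots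

module Exponential (em : ExcludedMiddle 0ℓ) (R : CompleteOrderedField) where

  open Series em R public
  open import Relation.Binary.Reasoning.Setoid setoid

  private
    variable
      x y : Carrier

  the-satisfies : ∀ {P : Pred Carrier 0ℓ} → ∃ P → P (the P)
  the-satisfies {P} ∃P with em {∃ P}
  ... | yes (_ , p) = p
  ... | no ¬∃P      = ⊥-elim (¬∃P ∃P)

  -- Bounds a described number before its existence is known: the default value 0# must satisfy the
  -- bound too. It serves `exp` at negative arguments and `log` of an arbitrary number.
  the-elim : ∀ (P Q : Pred Carrier 0ℓ) → (∀ x → P x → Q x) → Q 0# → Q (the P)
  the-elim P Q P⊆Q q with em {∃ P}
  ... | yes (x , p) = P⊆Q x p
  ... | no _        = q

  Monotone : (ℕ → Carrier) → Set
  Monotone u = ∀ {m n} → m ℕ.≤ n → u m ≤ u n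

  monotone-converges : ∀ {u} c → Monotone u → (∀ n → u n ≤ c) → ∃ (Converges u)
  monotone-converges {u} c mono bounded = s , converges
    where
    Values : Pred Carrier 0ℓ
    Values y = ∃[ n ] y ≈ u n
    sup = supremum Values (u 0 , 0 , refl) (c , λ y (n , e) → ≤-respˡ (sym e) (bounded n))
    s = proj₁ sup
    upper = proj₁ (proj₂ sup)
    least = proj₂ (proj₂ sup)
    converges : Converges u s
    converges ε 0<ε with em {∃[ N ] s - ε < u N}
    ... | yes (N , p) = N , λ n N≤n → <-≤-trans p (mono N≤n) , ≤-<-trans (upper (u n) (n , refl))
            (<-by (solve 2 (λ s e → (s :+ e) :- s := e) refl s ε) 0<ε)
    ... | no ¬p = ⊥-elim (<⇒≱ (<-by (solve 2 (λ s e → s :- (s :- e) := e) refl s ε) 0<ε)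
            (least (s - ε) (λ y (n , e) → ≤-respˡ (sym e) (≮⇒≥ (λ q → ¬p (n , q))))))

  limit-upper : ∀ {u l} → Monotone u → Converges u l → ∀ n → u n ≤ l
  limit-upper {u} {l} mono conv n = ≮⇒≥ λ l<u →
    let N , p = conv (u n - l) (0<-diff l<u) in
    <⇒≱ (<-respʳ (solve 2 (λ l u → l :+ (u :- l) := u) refl l (u n)) (proj₂ (p (N ℕ.+ n) (ℕ.m≤m+n N n))))
        (mono (ℕ.m≤n+m n N))

  limit-least : ∀ {u l c} → Converges u l → (∀ n → u n ≤ c) → l ≤ c
  limit-least {u} {l} {c} conv bounded = ≮⇒≥ λ c<l →
    let N , p = conv (l - c) (0<-diff c<l) in
    <⇒≱ (<-respˡ (solve 2 (λ l c → l :- (l :- c) := c) refl l c) (proj₁ (p N ℕ.≤-refl))) (bounded N)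

  term : Carrier → ℕ → Carrier
  term x i = x ^ i / fromℕ (i !)

  expSum : ℕ → Carrier → Carrier
  expSum n x = sumTo n (term x)

  0<! : ∀ i → 0# < fromℕ (i !)
  0<! i = 0<fromℕ (i !) {{ℕ._!≢0 i}}

  /-cancel-≈ : ∀ {x y z} → 0# < z → x * z ≈ y → x ≈ y / z
  /-cancel-≈ {x} {y} {z} p e = begin
    x              ≈⟨ *-identityʳ x ⟨
    x * 1#         ≈⟨ *-congˡ (⁻¹-inverse p) ⟨
    x * (z * z ⁻¹) ≈⟨ *-assoc x z (z ⁻¹) ⟨
    x * z * z ⁻¹   ≈⟨ *-congʳ e ⟩
    y / z          ∎

  *-cancelˡ-≈ : ∀ {x y z} → 0# < z → z * x ≈ z * y → x ≈ y
  *-cancelˡ-≈ {x} {y} {z} p e = trans (/-cancel-≈ p (trans (*-comm x z) e))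
    (sym (/-cancel-≈ p (*-comm y z)))

  derivative-term : ∀ x i → derivative (term x) i ≈ x * term x i
  derivative-term x i = *-cancelˡ-≈ (0<! i) (begin
    fromℕ (i !) * (fromℕ (suc i) * (x ^ suc i / fromℕ (suc i !)))
      ≈⟨ solve 3 (λ a b c → a :* (b :* c) := c :* (b :* a)) refl (fromℕ (i !)) (fromℕ (suc i)) _ ⟩
    x ^ suc i / fromℕ (suc i !) * (fromℕ (suc i) * fromℕ (i !))
      ≈⟨ *-congˡ (fromℕ-* (suc i) (i !)) ⟨
    x ^ suc i / fromℕ (suc i !) * fromℕ (suc i !)
      ≈⟨ /-*-cancel (0<! (suc i)) ⟩
    x * x ^ i
      ≈⟨ *-congˡ (/-*-cancel (0<! i)) ⟨
    x * (term x i * fromℕ (i !))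
      ≈⟨ solve 3 (λ x t f → x :* (t :* f) := f :* (x :* t)) refl x (term x i) (fromℕ (i !)) ⟩
    fromℕ (i !) * (x * term x i) ∎)

  term-0 : ∀ x → term x 0 ≈ 1#
  term-0 x = sym (/-cancel-≈ (0<! 0) (trans (*-congˡ fromℕ-1) (*-identityʳ 1#)))

  -- The binomial theorem divided by k!, obtained from the differential equation: both sides have
  -- constant term 1, and `derivative` acts on both as multiplication by x + y.
  conv-term : ∀ x y k → conv (term x) (term y) k ≈ term (x + y) k
  conv-term x y zero = trans (*-cong (term-0 x) (term-0 y)) (trans (*-identityʳ 1#) (sym (term-0 (x + y))))
  conv-term x y (suc k) = *-cancelˡ-≈ (0<fromℕ (suc k)) (begin
    derivative (conv (term x) (term y)) k
      ≈⟨ leibniz (term x) (term y) k ⟩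
    conv (derivative (term x)) (term y) k + conv (term x) (derivative (term y)) k
      ≈⟨ +-cong (trans (conv-congˡ k (derivative-term x)) (conv-*ˡ x k))
                (trans (conv-congʳ k (derivative-term y)) (conv-*ʳ y k)) ⟩
    x * conv (term x) (term y) k + y * conv (term x) (term y) k
      ≈⟨ distribʳ _ x y ⟨
    (x + y) * conv (term x) (term y) k
      ≈⟨ *-congˡ (conv-term x y k) ⟩
    (x + y) * term (x + y) k
      ≈⟨ derivative-term (x + y) k ⟨
    derivative (term (x + y)) k ∎)

  0≤term : 0# ≤ x → ∀ i → 0# ≤ term x i
  0≤term p i = 0≤/ (0≤^ i p) (0<! i)

  expSum-monotone : 0# ≤ x → Monotone (λ n → expSum n x)
  expSum-monotone p = sumTo-monoˡ (0≤term p)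

  expSum-mono : ∀ n → 0# ≤ x → x ≤ y → expSum n x ≤ expSum n y
  expSum-mono n p q = sumTo-mono n (λ i → *-monoˡ-≤ (<⇒≤ (0<⁻¹ (0<! i))) (^-monoˡ-≤ i p q))

  expSum-≤-* : ∀ n → 0# ≤ x → 0# ≤ y → expSum n (x + y) ≤ expSum n x * expSum n y
  expSum-≤-* {x} {y} n p q = ≤-respˡ (sumTo-cong n (conv-term x y)) (conv-≤-sumTo-* n (0≤term p) (0≤term q))

  expSum-*-≤ : ∀ m n → 0# ≤ x → 0# ≤ y → expSum m x * expSum n y ≤ expSum (m ℕ.+ n) (x + y)
  expSum-*-≤ {x} {y} m n p q = ≤-respʳ (sumTo-cong (m ℕ.+ n) (conv-term x y)) (sumTo-*-≤-conv m n (0≤term p) (0≤term q))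

  term-suc-≤ : 0# ≤ x → ∀ i → term x (suc i) ≤ x * term x i
  term-suc-≤ {x} p i = ≤-respʳ (derivative-term x i)
    (≤-by (solve 2 (λ n t → (κ 1 :+ n) :* t :- t := n :* t) refl (fromℕ i) (term x (suc i)))
      (0≤* (0≤fromℕ i) (0≤term p (suc i))))

  -- Since each term is at most x times the preceding one, S n ≤ S (n + 1) ≤ 1 + x · S n. For x < 1
  -- this bounds the series by 1/(1 - x).
  expSum-geometric : ∀ n → 0# ≤ x → expSum n x * (1# - x) ≤ 1#
  expSum-geometric {x} n p = ≤-by
    (solve 2 (λ x s → κ 1 :- s :* (κ 1 :- x) := (κ 1 :+ x :* s) :- s) refl x (expSum n x))
    (0≤-diff (≤-trans (expSum-monotone p (ℕ.n≤1+n n)) (≤-respˡ (sym (sumTo-cons n (term x)))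
      (+-mono-≤ (≈⇒≤ (term-0 x)) (≤-respʳ (sumTo-*ˡ n x) (sumTo-mono n (term-suc-≤ p)))))))

  1≤expSum : ∀ n → 0# ≤ x → 1# ≤ expSum (suc n) x
  1≤expSum {x} n p = ≤-trans (≤-respʳ (sym (+-identityˡ _)) (≈⇒≤ (sym (term-0 x)))) (expSum-monotone p {1} {suc n} (ℕ.s≤s ℕ.z≤n))

  0≤expSum : ∀ n → 0# ≤ x → 0# ≤ expSum n x
  0≤expSum n p = 0≤sumTo n (0≤term p)

  1+x≤expSum : ∀ n → 0# ≤ x → 1# + x ≤ expSum (suc (suc n)) x
  1+x≤expSum {x} n p = ≤-trans (≈⇒≤ (sym expSum-2)) (expSum-monotone p {2} {suc (suc n)} (ℕ.s≤s (ℕ.s≤s ℕ.z≤n)))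
    where
    expSum-2 : expSum 2 x ≈ 1# + x
    expSum-2 = +-cong (trans (+-identityˡ _) (term-0 x))
      (trans (solve 1 (λ t → t := (κ 1 :+ κ 0) :* t) refl (term x 1))
        (trans (derivative-term x 0) (trans (*-congˡ (term-0 x)) (*-identityʳ x))))

  expSum-0 : ∀ n → expSum (suc n) 0# ≈ 1#
  expSum-0 n = ≤-antisym
    (≤-respˡ (solve 1 (λ s → s :* (κ 1 :- κ 0) := s) refl _) (expSum-geometric (suc n) ≤-refl))
    (1≤expSum n ≤-refl)

  -- Splitting x into k steps of length at most 1/2.
  expSum-bounded : 0# ≤ x → ∃[ c ] (∀ n → expSum n x ≤ c)
  expSum-bounded {x} 0≤x = fromℕ 2 ^ k , λ n → ≤-respˡ (sumTo-cong n (λ i → *-congʳ (^-congˡ i kh≈x))) (power n k)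
    where
    half = 1# / fromℕ 2
    0<half : 0# < half
    0<half = 0</ 0#<1# (0<fromℕ 2)
    half≈ : half * fromℕ 2 ≈ 1#
    half≈ = /-*-cancel (0<fromℕ 2)
    k = proj₁ (archimedean (x / half))
    x<k*half : x < fromℕ k * half
    x<k*half = <-respˡ (/-*-cancel 0<half) (<-respˡ (*-comm _ _) (<-respʳ (*-comm _ _)
      (*-monoʳ-< 0<half (proj₂ (archimedean (x / half))))))
    0<k : 0# < fromℕ k
    0<k = ≤-<-trans (0≤/ 0≤x 0<half) (proj₂ (archimedean (x / half)))
    h = x / fromℕ k
    0≤h : 0# ≤ h
    0≤h = 0≤/ 0≤x 0<k
    h≤half : h ≤ half
    h≤half = /-≤ 0<k (<⇒≤ (<-respʳ (*-comm _ _) x<k*half))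
    kh≈x : fromℕ k * h ≈ x
    kh≈x = trans (*-comm _ _) (/-*-cancel 0<k)
    step : ∀ n → expSum n h ≤ fromℕ 2
    step n = *-cancelʳ-≤ 0<half (≤-respʳ (trans (sym half≈) (*-comm _ _))
      (≤-trans (*-monoʳ-≤ (0≤expSum n 0≤h) (≤-by
        (trans (solve 2 (λ a h → (κ 1 :- h) :- a := (a :- h) :+ (κ 1 :- a :* κ 2)) refl half h)
          (trans (+-congˡ (trans (+-congˡ (-‿cong half≈)) (-‿inverseʳ 1#))) (+-identityʳ _)))
        (0≤-diff h≤half))) (expSum-geometric n 0≤h)))
    power : ∀ n k → expSum n (fromℕ k * h) ≤ fromℕ 2 ^ k
    power zero k = 0≤^ k (0≤fromℕ 2)
    power (suc n) zero = ≈⇒≤ (trans (sumTo-cong (suc n) (λ i → *-congʳ (^-congˡ i (zeroˡ h)))) (expSum-0 n))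
    power (suc n) (suc k) = ≤-respˡ
      (sumTo-cong (suc n) (λ i → *-congʳ (^-congˡ i (solve 2 (λ h k → h :+ k :* h := (κ 1 :+ k) :* h) refl h (fromℕ k)))))
      (≤-trans (expSum-≤-* (suc n) 0≤h (0≤* (0≤fromℕ k) 0≤h))
        (*-mono-≤ (0≤expSum (suc n) 0≤h) (0≤^ k (0≤fromℕ 2)) (step (suc n)) (power (suc n) k)))

  Converges-cong : ∀ u v {l} → (∀ n → u n ≈ v n) → Converges u l → Converges v l
  Converges-cong u v e c ε 0<ε = let N , p = c ε 0<ε in
    N , λ n N≤n → <-respʳ (e n) (proj₁ (p n N≤n)) , <-respˡ (e n) (proj₂ (p n N≤n))

  exp-converges : 0# ≤ x → Converges (λ n → expSum n x) (exp x)
  exp-converges {x} p = Converges-cong (λ n → ∑< n (term x)) (λ n → expSum n x) (λ n → ∑<≈sumTo n (term x)) (the-satisfies {Converges (λ n → ∑< n (term x))}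
    (let c , bounded = expSum-bounded p
         l , conv = monotone-converges c (expSum-monotone p) bounded
     in l , Converges-cong (λ n → expSum n x) (λ n → ∑< n (term x)) (λ n → sym (∑<≈sumTo n (term x))) conv))

  expSum≤exp : ∀ n → 0# ≤ x → expSum n x ≤ exp x
  expSum≤exp n p = limit-upper (expSum-monotone p) (exp-converges p) n

  exp-least : ∀ {c} → 0# ≤ x → (∀ n → expSum n x ≤ c) → exp x ≤ c
  exp-least p = limit-least (exp-converges p)

  exp-mono : 0# ≤ x → x ≤ y → exp x ≤ exp y
  exp-mono p q = exp-least p (λ n → ≤-trans (expSum-mono n p q) (expSum≤exp n (≤-trans p q)))

  1+x≤exp : 0# ≤ x → 1# + x ≤ exp x
  1+x≤exp p = ≤-trans (1+x≤expSum 0 p) (expSum≤exp 2 p)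

  1≤exp : 0# ≤ x → 1# ≤ exp x
  1≤exp p = ≤-trans (1≤expSum 0 p) (expSum≤exp 1 p)

  exp-0 : exp 0# ≤ 1#
  exp-0 = exp-least ≤-refl bound
    where
    bound : ∀ n → expSum n 0# ≤ 1#
    bound zero    = 0≤1
    bound (suc n) = ≈⇒≤ (expSum-0 n)

  -- The two suprema are taken one after the other, each time after dividing by the other factor,
  -- which is positive.
  exp-*-≤ : 0# ≤ x → 0# ≤ y → exp x * exp y ≤ exp (x + y)
  exp-*-≤ {x} {y} p q = ≤-trans (*-monoˡ-≤ 0≤exp-y (exp-least p (λ m → ≤-/ 0<exp-y (le m)))) (≈⇒≤ (/-*-cancel 0<exp-y))
    where
    0<exp-y : 0# < exp y
    0<exp-y = <-≤-trans 0#<1# (1≤exp q)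
    0≤exp-y = <⇒≤ 0<exp-y
    le : ∀ m → expSum m x * exp y ≤ exp (x + y)
    le zero = ≤-respˡ (sym (zeroˡ _)) (<⇒≤ (<-≤-trans 0#<1# (1≤exp (0≤+ p q))))
    le (suc m) = ≤-respˡ (*-comm _ _) (≤-trans (*-monoˡ-≤ (<⇒≤ 0<s)
      (exp-least q (λ n → ≤-/ 0<s (≤-respˡ (*-comm _ _) (≤-trans (expSum-*-≤ (suc m) n p q) (expSum≤exp (suc m ℕ.+ n) (0≤+ p q)))))))
      (≈⇒≤ (/-*-cancel 0<s)))
      where
      0<s : 0# < expSum (suc m) x
      0<s = <-≤-trans 0#<1# (1≤expSum m p)

  -- A quantitative form of continuity: a step of length y multiplies `exp` by at most 1/(1 - y), by
  -- `expSum-geometric`.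
  exp-+-≤ : 0# ≤ x → 0# ≤ y → y < 1# → exp (x + y) * (1# - y) ≤ exp x
  exp-+-≤ {x} {y} p q y<1 = ≤-trans
    (*-monoˡ-≤ (<⇒≤ (0<-diff y<1)) (exp-least (0≤+ p q) (λ n → ≤-/ (0<-diff y<1) (bound n))))
    (≈⇒≤ (/-*-cancel (0<-diff y<1)))
    where
    bound : ∀ n → expSum n (x + y) * (1# - y) ≤ exp x
    bound n = ≤-trans (*-monoˡ-≤ (<⇒≤ (0<-diff y<1)) (expSum-≤-* n p q))
      (≤-respˡ (sym (*-assoc _ _ _)) (≤-trans (*-monoʳ-≤ (0≤expSum n p) (expSum-geometric n q))
        (≤-respˡ (sym (*-identityʳ _)) (expSum≤exp n p))))

  exp-× : ∀ m → 0# ≤ x → exp x ^ m ≤ exp (fromℕ m * x)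
  exp-× {x} zero p = 1≤exp (≈⇒≤ (sym (zeroˡ x)))
  exp-× {x} (suc m) p = ≤-trans (*-monoʳ-≤ (≤-trans 0≤1 (1≤exp p)) (exp-× m p))
    (≤-trans (exp-*-≤ p mx) (exp-mono (0≤+ p mx) (≈⇒≤ (solve 2 (λ x m → x :+ m :* x := (κ 1 :+ m) :* x) refl x (fromℕ m)))))
    where
    mx : 0# ≤ fromℕ m * x
    mx = 0≤* (0≤fromℕ m) p

  -- An intermediate value theorem from four estimates that hold for `exp`. The solution of e x ≈ y
  -- is the supremum of the x ≥ 0 with e x ≤ y, a set bounded by y because of the linear lower
  -- bound; `e-+-≤` takes the place of continuity.
  module _ (e : Carrier → Carrier) (e-0 : e 0# ≤ 1#)
    (e-mono : ∀ {x y} → 0# ≤ x → x ≤ y → e x ≤ e y)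
    (1+x≤e : ∀ {x} → 0# ≤ x → 1# + x ≤ e x)
    (e-+-≤ : ∀ {x y} → 0# ≤ x → 0# ≤ y → y < 1# → e (x + y) * (1# - y) ≤ e x)
    where

    private
      1≤e : 0# ≤ x → 1# ≤ e x
      1≤e {x} p = ≤-trans (≤-by (solve 1 (λ x → (κ 1 :+ x) :- κ 1 := x) refl x) p) (1+x≤e p)

      complement : ∀ t → 1# - (1# - t) ≈ t
      complement = solve 1 (λ t → κ 1 :- (κ 1 :- t) := t) refl

      module Supremum {y L : Carrier} (1<y : 1# < y) (0≤L : 0# ≤ L)
        (upper : ∀ x → 0# ≤ x → e x ≤ y → x ≤ L)
        (least : ∀ u → (∀ x → 0# ≤ x → e x ≤ y → x ≤ u) → L ≤ u)
        where

        0<y : 0# < y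
        0<y = <-trans 0#<1# 1<y

        0<eL : 0# < e L
        0<eL = <-≤-trans 0#<1# (1≤e 0≤L)

        not-below : ¬ (e L < y)
        not-below eL<y = <⇒≱ L<L+h (upper (L + h) (0≤+ 0≤L (<⇒≤ 0<h)) e[L+h]≤y)
          where
          -- The step `h` is chosen with 1 - h = e L / y, so that `e-+-≤` gives e (L + h) ≤ y,
          -- against the choice of L as an upper bound.
          t h : Carrier
          t = e L / y
          h = 1# - t
          0<t : 0# < t
          0<t = 0</ 0<eL 0<y
          0<h : 0# < h
          0<h = 0<-diff (/-< 0<y (<-respʳ (sym (*-identityˡ y)) eL<y))
          h<1 : h < 1#
          h<1 = <-by (complement t) 0<t
          L<L+h : L < L + h
          L<L+h = <-by (solve 2 (λ l h → (l :+ h) :- l := h) refl L h) 0<h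
          e[L+h]*t≤y*t : e (L + h) * t ≤ y * t
          e[L+h]*t≤y*t = ≤-respˡ (*-congˡ (complement t))
            (≤-respʳ (trans (sym (/-*-cancel 0<y)) (*-comm t y)) (e-+-≤ 0≤L (<⇒≤ 0<h) h<1))
          e[L+h]≤y : e (L + h) ≤ y
          e[L+h]≤y = *-cancelʳ-≤ 0<t e[L+h]*t≤y*t

        not-above : ¬ (y < e L)
        not-above y<eL = <⇒≱ L-h<L (least (L - h) bound)
          where
          -- Now 1 - h = y / e L. A point x of the set closer to L than `h` would give e x ≥ e L ·
          -- (1 - (L - x)) > y, so L - h would be a smaller upper bound.
          t h : Carrier
          t = y / e L
          h = 1# - t
          L-h<L : L - h < L
          L-h<L = <-by (solve 2 (λ l h → l :- (l :- h) := h) refl L h)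
            (0<-diff (/-< 0<eL (<-respʳ (sym (*-identityˡ (e L))) y<eL)))
          bound : ∀ x → 0# ≤ x → e x ≤ y → x ≤ L - h
          bound x 0≤x ex≤y = ≮⇒≥ contra
            where
            z : Carrier
            z = L - x
            0≤z : 0# ≤ z
            0≤z = 0≤-diff (upper x 0≤x ex≤y)
            contra : ¬ (L - h < x)
            contra L-h<x = <⇒≱ y<eL[1-z] (≤-trans eL[1-z]≤ex ex≤y)
              where
              t<1-z : t < 1# - z
              t<1-z = <-by (solve 3 (λ l t x → (κ 1 :- (l :- x)) :- t := x :- (l :- (κ 1 :- t))) refl L t x) (0<-diff L-h<x)
              y<eL[1-z] : y < e L * (1# - z)
              y<eL[1-z] = <-respˡ (trans (*-comm (e L) t) (/-*-cancel 0<eL)) (*-monoʳ-< 0<eL t<1-z)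
              z<1 : z < 1#
              z<1 = <-by refl (<-trans (0</ 0<y 0<eL) t<1-z)
              eL[1-z]≤ex : e L * (1# - z) ≤ e x
              eL[1-z]≤ex = ≤-trans
                (*-monoˡ-≤ (0≤-diff (<⇒≤ z<1)) (e-mono 0≤L (≈⇒≤ (solve 2 (λ l x → l := x :+ (l :- x)) refl L x))))
                (e-+-≤ 0≤x 0≤z z<1)

        attained : e L ≈ y
        attained with compare (e L) y
        ... | tri≈ _ eq _ = eq
        ... | tri< p _ _ = ⊥-elim (not-below p)
        ... | tri> _ _ p = ⊥-elim (not-above p)

    attains : 1# < y → ∃[ x ] e x ≈ y
    attains {y} 1<y = proj₁ sup , Supremum.attained 1<y (proj₁ (proj₂ sup) 0# 0∈Below)
      (λ x p q → proj₁ (proj₂ sup) x (p , q)) (λ u p → proj₂ (proj₂ sup) u (λ x q → p x (proj₁ q) (proj₂ q)))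
      where
      Below : Pred Carrier 0ℓ
      Below x = 0# ≤ x × e x ≤ y
      0∈Below : Below 0#
      0∈Below = ≤-refl , ≤-trans e-0 (<⇒≤ 1<y)
      sup : ∃[ s ] UpperBound Below s × (∀ u → UpperBound Below u → s ≤ u)
      sup = supremum Below (0# , 0∈Below)
        (y , λ x q → ≤-trans (≤-by (solve 1 (λ x → (κ 1 :+ x) :- x := κ 1) refl x) 0≤1) (≤-trans (1+x≤e (proj₁ q)) (proj₂ q)))

  exp-surjective : 1# < y → ∃[ x ] exp x ≈ y
  exp-surjective = attains exp exp-0 exp-mono 1+x≤exp exp-+-≤

  -- For x < 0 the product expSum n x * expSum n (- x) tends to 1, so exp x cannot exceed 1.
  exp-nonpositive : x < 0# → ∀ {l} → Converges (λ n → expSum n x) l → l ≤ 1#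
  exp-nonpositive {x} x<0 {l} conv-l = ≮⇒≥ contra
    where
    z = - x
    0<z : 0# < z
    0<z = <-respʳ (+-identityˡ z) (0<-diff x<0)
    0≤z = <⇒≤ 0<z
    power-⊴ : ∀ i → x ^ i ⊴ z ^ i
    power-⊴ zero    = 0≤⊴ 0≤1
    power-⊴ (suc i) = ⊴-* (≤-respʳ (sym (-‿inverseˡ x)) ≤-refl , ≤-respʳ (+-comm _ _) (0≤+ 0≤z 0≤z)) (power-⊴ i)
    term-⊴ : ∀ i → term x i ⊴ term z i
    term-⊴ i = ⊴-* (power-⊴ i) (0≤⊴ (<⇒≤ (0<⁻¹ (0<! i))))
    contra : ¬ (1# < l)
    contra 1<l = <⇒≱ lower upper
      where
      N₁ = conv-l (l - 1#) (0<-diff 1<l)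
      N₂ = exp-converges (0≤+ 0≤z 0≤z) z 0<z
      m = proj₁ N₁ ℕ.+ proj₁ N₂
      n = suc (suc m)
      N₁≤n : proj₁ N₁ ℕ.≤ n
      N₁≤n = ℕ.≤-trans (ℕ.m≤m+n _ _) (ℕ.m≤n+m m 2)
      N₂≤n : proj₁ N₂ ℕ.≤ n
      N₂≤n = ℕ.≤-trans (ℕ.m≤n+m (proj₁ N₂) (proj₁ N₁)) (ℕ.m≤n+m m 2)
      1<expSum-x : 1# < expSum n x
      1<expSum-x = <-respˡ (solve 1 (λ l → l :- (l :- κ 1) := κ 1) refl l) (proj₁ (proj₂ N₁ n N₁≤n))
      lower : 1# + z < expSum n x * expSum n z
      lower = ≤-<-trans (1+x≤expSum m 0≤z) (<-respˡ (*-identityʳ _) (<-respʳ (*-comm _ _)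
        (*-monoʳ-< (<-≤-trans 0#<1# (1≤expSum (suc m) 0≤z)) 1<expSum-x)))
      E E′ : Carrier
      E  = expSum n x * expSum n z
      E′ = expSum n z * expSum n z
      -- `E′` is at most exp (z + z), and `N₂` was taken for the precision z.
      tail≤z : E′ - expSum n (z + z) ≤ z
      tail≤z = ≤-by
        (solve 4 (λ z e s l → z :- (e :- s) := ((l :- e)) :+ (s :- (l :- z))) refl z E′ (expSum n (z + z)) (exp (z + z)))
        (0≤+ (0≤-diff (≤-trans (expSum-*-≤ n n 0≤z 0≤z) (expSum≤exp (n ℕ.+ n) (0≤+ 0≤z 0≤z))))
             (0≤-diff (<⇒≤ (proj₁ (proj₂ N₂ n N₂≤n)))))
      -- The terms at x are dominated in absolute value by those at z = - x, so this difference is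
      -- bounded by the one at z, where it is at most z.
      difference : E - expSum n (x + z) ⊴ E′ - expSum n (z + z)
      difference = ⊴-resp (+-congˡ (-‿cong (sumTo-cong n (conv-term x z)))) (+-congˡ (-‿cong (sumTo-cong n (conv-term z z))))
        (product-conv-diff-⊴ n 0 term-⊴ (λ i → 0≤⊴ (0≤term 0≤z i)))
      expSum-x+z : expSum n (x + z) ≈ 1#
      expSum-x+z = trans (sumTo-cong n (λ i → *-congʳ (^-congˡ i (-‿inverseʳ x)))) (expSum-0 (suc m))
      upper : E ≤ 1# + z
      upper = ≤-by (trans
        (solve 4 (λ z e t s → (κ 1 :+ z) :- e := ((z :- t) :+ (t :- (e :- s))) :+ (κ 1 :- s)) refl z E (E′ - expSum n (z + z)) (expSum n (x + z)))
        (trans (+-congˡ (trans (+-congˡ (-‿cong expSum-x+z)) (-‿inverseʳ 1#))) (+-identityʳ _)))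
        (0≤+ (0≤-diff tail≤z) (proj₂ difference))

  -- `log y` is any solution of exp x ≈ y, so negative solutions must be excluded before it is known
  -- to be positive for y > 1.
  exp≤1 : x < 0# → exp x ≤ 1#
  exp≤1 {x} x<0 = the-elim (Converges (λ n → ∑< n (term x))) (_≤ 1#)
    (λ l c → exp-nonpositive x<0 (Converges-cong (λ n → ∑< n (term x)) (λ n → expSum n x) (λ n → ∑<≈sumTo n (term x)) c))
    0≤1

  exp-log : 1# < y → exp (log y) ≈ y
  exp-log {y} 1<y = the-satisfies {λ x → exp x ≈ y} (exp-surjective 1<y)

  0<log : 1# < y → 0# < log y
  0<log {y} 1<y with compare 0# (log y)
  ... | tri< p _ _ = p
  ... | tri≈ _ e _ = ⊥-elim (<⇒≱ 1<y (≤-respˡ (exp-log 1<y) (≤-trans (exp-mono (≈⇒≤ e) (≈⇒≤ (sym e))) exp-0)))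
  ... | tri> _ _ p = ⊥-elim (<⇒≱ 1<y (≤-respˡ (exp-log 1<y) (exp≤1 p)))

  -- A solution of exp x ≈ y beyond m · log z would force y ≥ exp (m · log z) ≥ z ^ m. The default
  -- value 0# of `log` obeys the bound as well.
  log-≤ : ∀ {z} m → 1# < z → y < z ^ m → log y ≤ fromℕ m * log z
  log-≤ {y} {z} m 1<z y<zᵐ = the-elim (λ x → exp x ≈ y) (_≤ fromℕ m * log z)
    (λ x e → ≮⇒≥ (λ p → <⇒≱ y<zᵐ (≤-respʳ e
      (≤-trans (≤-respˡ (^-congˡ m (exp-log 1<z)) (exp-× m (<⇒≤ (0<log 1<z)))) (exp-mono 0≤m*log (<⇒≤ p))))))
    0≤m*log
    where
    0≤m*log : 0# ≤ fromℕ m * log z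
    0≤m*log = 0≤* (0≤fromℕ m) (<⇒≤ (0<log 1<z))

  exp-≤-* : 0# ≤ x → 0# ≤ y → exp (x + y) ≤ exp x * exp y
  exp-≤-* p q = exp-least (0≤+ p q) (λ n → ≤-trans (expSum-≤-* n p q)
    (*-mono-≤ (0≤expSum n p) (≤-trans 0≤1 (1≤exp q)) (expSum≤exp n p) (expSum≤exp n q)))

  IsRoot : Carrier → Pred Carrier 0ℓ
  IsRoot y r = 0# ≤ r × r * r ≈ y

  root-positive : ∀ {r} → 0# < y → IsRoot y r → 0# < r
  root-positive     0<y (inj₁ 0<r , _) = 0<r
  root-positive {r = r} 0<y (inj₂ 0≈r , e) = ⊥-elim (<-irrefl (trans (sym (zeroˡ r)) (trans (*-congʳ 0≈r) e)) 0<y)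

  root>1 : 1# < y → ∃ (IsRoot y)
  root>1 {y} 1<y = exp z , ≤-trans 0≤1 (1≤exp 0≤z) , trans
    (≤-antisym (≤-trans (exp-*-≤ 0≤z 0≤z) (exp-mono (0≤+ 0≤z 0≤z) (≈⇒≤ z+z≈log)))
               (≤-trans (exp-mono (<⇒≤ (0<log 1<y)) (≈⇒≤ (sym z+z≈log))) (exp-≤-* 0≤z 0≤z)))
    (exp-log 1<y)
    where
    z : Carrier
    z = log y / fromℕ 2
    0≤z : 0# ≤ z
    0≤z = 0≤/ (<⇒≤ (0<log 1<y)) (0<fromℕ 2)
    z+z≈log : z + z ≈ log y
    z+z≈log = trans (solve 1 (λ z → z :+ z := z :* κ 2) refl z) (/-*-cancel (0<fromℕ 2))

  -- Above 1 the root is exp (log y / 2). The product law of `exp` is available for nonnegative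
  -- arguments, so below 1 the root is the inverse of a root of 1/y.
  root : 0# < y → ∃ (IsRoot y)
  root {y} 0<y with compare y 1#
  ... | tri> _ _ 1<y = root>1 1<y
  ... | tri≈ _ y≈1 _ = 1# , 0≤1 , trans (*-identityʳ 1#) (sym y≈1)
  ... | tri< y<1 _ _ = r ⁻¹ , <⇒≤ (0<⁻¹ 0<r) , *-cancelˡ-≈ 0<1/y (begin
          1# / y * (r ⁻¹ * r ⁻¹)     ≈⟨ *-congʳ r*r≈1/y ⟨
          r * r * (r ⁻¹ * r ⁻¹)      ≈⟨ solve 2 (λ r s → r :* r :* (s :* s) := (r :* s) :* (r :* s)) refl r (r ⁻¹) ⟩
          (r * r ⁻¹) * (r * r ⁻¹)    ≈⟨ *-cong (⁻¹-inverse 0<r) (⁻¹-inverse 0<r) ⟩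
          1# * 1#                    ≈⟨ *-identityʳ 1# ⟩
          1#                         ≈⟨ /-*-cancel 0<y ⟨
          1# / y * y                 ∎)
    where
    1/y-root : ∃ (IsRoot (1# / y))
    1/y-root = root>1 (</ 0<y (<-respˡ (sym (*-identityˡ y)) y<1))
    r : Carrier
    r = proj₁ 1/y-root
    r*r≈1/y : r * r ≈ 1# / y
    r*r≈1/y = proj₂ (proj₂ 1/y-root)
    0<1/y : 0# < 1# / y
    0<1/y = 0</ 0#<1# 0<y
    0<r : 0# < r
    0<r = root-positive 0<1/y (proj₂ 1/y-root)

  √-isRoot : 0# < y → IsRoot y (√ y)
  √-isRoot {y} 0<y = the-satisfies {IsRoot y} (root 0<y)

  square-cancel-≤ : 0# ≤ y → x * x ≤ y * y → x ≤ y
  square-cancel-≤ {y} {x} 0≤y p = ≮⇒≥ (λ y<x → <⇒≱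
    (≤-<-trans (*-monoʳ-≤ 0≤y (<⇒≤ y<x)) (<-respˡ (*-comm _ _) (*-monoʳ-< (≤-<-trans 0≤y y<x) y<x))) p)

-- Null sets, Borel-Cantelli, and hits for almost all α

module Rows (Q : ℕ → ℕ) (0<Q : ∀ k → 0 ℕ.< Q k) (K : ℕ) where

  next : ℕ × ℕ → ℕ × ℕ
  next (k , c) with suc c ℕ.<? Q k
  ... | yes _ = k , suc c
  ... | no  _ = suc k , 0

  -- Lists the pairs (k , c) with k ≥ K and c < Q k row by row, because `Null` asks for one sequence
  -- of intervals.
  walk : ℕ → ℕ × ℕ
  walk zero    = K , 0
  walk (suc n) = next (walk n)

  next-right : ∀ k c → suc c ℕ.< Q k → next (k , c) ≡ (k , suc c)
  next-right k c p with suc c ℕ.<? Q k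
  ... | yes _ = ≡.refl
  ... | no ¬p = ⊥-elim (¬p p)

  next-down : ∀ k c → suc c ≡ Q k → next (k , c) ≡ (suc k , 0)
  next-down k c e with suc c ℕ.<? Q k
  ... | yes p = ⊥-elim (ℕ.<-irrefl e p)
  ... | no  _ = ≡.refl

  reaches-along : ∀ k c → ∃[ n ] walk n ≡ (k , 0) → c ℕ.< Q k → ∃[ n ] walk n ≡ (k , c)
  reaches-along k zero    start p = start
  reaches-along k (suc c) start p =
    let n , e = reaches-along k c start (ℕ.<-trans (ℕ.n<1+n c) p)
    in suc n , ≡.trans (≡.cong next e) (next-right k c p)

  reaches : ∀ j c → c ℕ.< Q (j ℕ.+ K) → ∃[ n ] walk n ≡ (j ℕ.+ K , c)
  reaches zero    c p = reaches-along K c (0 , ≡.refl) p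
  reaches (suc j) c p = reaches-along (suc j ℕ.+ K) c (suc n , ≡.trans (≡.cong next e) (next-down (j ℕ.+ K) last 1+last≡Q)) p
    where
    last = ℕ.pred (Q (j ℕ.+ K))
    1+last≡Q : suc last ≡ Q (j ℕ.+ K)
    1+last≡Q = ℕ.suc-pred (Q (j ℕ.+ K)) {{ℕ.>-nonZero (0<Q (j ℕ.+ K))}}
    end = reaches j last (ℕ.≤-reflexive 1+last≡Q)
    n = proj₁ end
    e = proj₂ end

module Measure (em : ExcludedMiddle 0ℓ) (R : CompleteOrderedField) where

  open Exponential em R public

  Null-⊆ : ∀ {A B : Pred Carrier 0ℓ} → (∀ x → A x → B x) → Null B → Null A
  Null-⊆ A⊆B null ε 0<ε =
    let a , b , a≤b , cover , total = null ε 0<ε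
    in a , b , a≤b , (λ x Ax → cover x (A⊆B x Ax)) , total

  module _ (Q : ℕ → ℕ) (0<Q : ∀ k → 0 ℕ.< Q k) (a b : ℕ → ℕ → Carrier) (a≤b : ∀ k c → a k c ≤ b k c)
    (v : ℕ → Carrier) (0≤v : ∀ k → 0# ≤ v k) (v→0 : ∀ ε → 0# < ε → ∃[ K ] v K ≤ ε)
    (row : ∀ k → sumTo (Q k) (λ c → b k c - a k c) ≤ v k - v (suc k))
    where

    InfinitelyOften : Pred Carrier 0ℓ
    InfinitelyOften x = ∀ K → ∃[ k ] ∃[ c ] K ℕ.≤ k × c ℕ.< Q k × a k c < x × x < b k c

    -- The rows from K on form the cover. Their lengths telescope to at most v K, which a suitable K
    -- brings below ε.
    borel-cantelli : Null InfinitelyOften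
    borel-cantelli ε 0<ε = (λ i → at a (walk i)) , (λ i → at b (walk i)) , (λ i → a≤b _ _) , cover ,
      λ n → ≤-respˡ (sym (∑<≈sumTo n (λ i → length′ (walk i)))) (total n)
      where
      K : ℕ
      K = proj₁ (v→0 ε 0<ε)
      open Rows Q 0<Q K
      at : (ℕ → ℕ → Carrier) → ℕ × ℕ → Carrier
      at f (k , c) = f k c
      length′ : ℕ × ℕ → Carrier
      length′ (k , c) = b k c - a k c
      partial : ℕ → ℕ → Carrier
      partial k c = sumTo c (λ c → b k c - a k c)
      cover : ∀ x → InfinitelyOften x → ∃[ i ] at a (walk i) < x × x < at b (walk i)
      cover x often =
        let k , c , K≤k , c<Q , p , q = often K
            k≡ = ≡.sym (ℕ.m∸n+n≡m K≤k)
            n , e = reaches (k ∸ K) c (≡.subst (λ k → c ℕ.< Q k) k≡ c<Q)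
            e′ = ≡.trans e (≡.cong (_, c) (≡.sym k≡))
        in n , ≡.subst (λ z → at a z < x) (≡.sym e′) p , ≡.subst (λ z → x < at b z) (≡.sym e′) q
      -- The invariant of the walk: v K - v k pays for the completed rows, the partial sum for the
      -- current one.
      Bounded : ℕ → ℕ × ℕ → Set
      Bounded n (k , c) = c ℕ.< Q k × sumTo n (λ i → length′ (walk i)) ≤ (v K - v k) + partial k c
      step : ∀ n z → Bounded n z → sumTo n (λ i → length′ (walk i)) + length′ z ≤ (v K - v (proj₁ (next z))) + partial (proj₁ (next z)) (proj₂ (next z)) × proj₂ (next z) ℕ.< Q (proj₁ (next z))
      step n (k , c) (c<Q , bound) with suc c ℕ.<? Q k
      ... | yes p = ≤-respʳ (+-assoc _ _ _) (+-mono-≤ bound ≤-refl) , p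
      ... | no ¬p = ≤-trans (+-mono-≤ bound ≤-refl) (≤-by
              (solve 5 (λ vK v v′ s l → ((vK :- v′) :+ κ 0) :- (((vK :- v) :+ s) :+ l) := (v :- v′) :- (s :+ l)) refl
                 (v K) (v k) (v (suc k)) (partial k c) (b k c - a k c))
              (0≤-diff (≡.subst (λ n → sumTo n (λ c → b k c - a k c) ≤ v k - v (suc k)) (≡.sym (ℕ.≤-antisym c<Q (ℕ.≮⇒≥ ¬p))) (row k)))) ,
              0<Q (suc k)
      invariant : ∀ n → Bounded n (walk n)
      invariant zero = 0<Q K , ≈⇒≤ (solve 1 (λ x → κ 0 := (x :- x) :+ κ 0) refl (v K))
      invariant (suc n) = let p , q = step n (walk n) (invariant n) in q , p
      total : ∀ n → sumTo n (λ i → length′ (walk i)) ≤ ε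
      total n = ≤-trans (proj₂ (invariant n)) (≤-trans (≤-by
          (solve 4 (λ vK v s v′ → vK :- ((vK :- v) :+ s) := ((v :- v′) :- s) :+ v′) refl (v K) (v k) (partial k c) (v (suc k)))
          (0≤+ (0≤-diff (≤-trans (sumTo-monoˡ (λ i → 0≤-diff (a≤b k i)) (ℕ.<⇒≤ (proj₁ (invariant n)))) (row k))) (0≤v (suc k))))
        (proj₂ (v→0 ε 0<ε)))
        where
        k = proj₁ (walk n)
        c = proj₂ (walk n)

  fromℕ-∑ : ∀ n f → fromℕ (∑ℕ n f) ≈ sumTo n (λ i → fromℕ (f i))
  fromℕ-∑ zero    f = refl
  fromℕ-∑ (suc n) f = trans (fromℕ-+ (∑ℕ n f) (f n)) (+-congʳ (fromℕ-∑ n f))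

  RealArc : Carrier → ℕ → ℕ → ℕ → ℕ → Set
  RealArc α C M lo hi = ∃[ k ]
    fromℕ M * fromℕ k + fromℕ lo ≤ fromℕ M * (α * fromℕ C) × fromℕ M * (α * fromℕ C) < fromℕ M * fromℕ k + fromℕ hi

  realArc : ∀ {α Q i C M lo hi} .{{_ : NonZero Q}} .{{_ : NonZero M}} .{{_ : NonZero C}} →
    fromℕ i ≤ α * fromℕ Q → α * fromℕ Q < fromℕ i + 1# → InArc Q i C M lo hi → RealArc α C M lo hi
  realArc {α} {Q} {i} {C} {M} {lo} {hi} i≤αQ αQ<i+1 (k , lower , upper) = k ,
    *-cancelʳ-≤ (0<fromℕ Q) (≤-respˡ (cast₁ lo) (≤-trans (fromℕ-mono-≤ lower) (≤-respˡ (sym cast₂) (≤-respʳ rearrange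
      (*-monoʳ-≤ (0≤fromℕ M) (*-monoˡ-≤ (0≤fromℕ C) i≤αQ)))))) ,
    *-cancelʳ-< (0≤fromℕ Q) (<-≤-trans (<-respˡ rearrange
      (*-monoʳ-< (0<fromℕ M) (<-respˡ (*-comm _ _) (<-respʳ (*-comm _ _) (*-monoʳ-< (0<fromℕ C) (<-respʳ (+-comm _ _) αQ<i+1))))))
      (≤-respʳ (cast₁ hi) (≤-respˡ cast₃ (fromℕ-mono-≤ upper))))
    where
    rearrange : fromℕ M * (α * fromℕ Q * fromℕ C) ≈ fromℕ M * (α * fromℕ C) * fromℕ Q
    rearrange = solve 4 (λ m a q c → m :* (a :* q :* c) := m :* (a :* c) :* q) refl (fromℕ M) α (fromℕ Q) (fromℕ C)
    cast₁ : ∀ x → fromℕ ((M ℕ.* k ℕ.+ x) ℕ.* Q) ≈ (fromℕ M * fromℕ k + fromℕ x) * fromℕ Q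
    cast₁ x = trans (fromℕ-* (M ℕ.* k ℕ.+ x) Q) (*-congʳ (trans (fromℕ-+ (M ℕ.* k) x) (+-congʳ (fromℕ-* M k))))
    cast₂ : fromℕ (M ℕ.* (i ℕ.* C)) ≈ fromℕ M * (fromℕ i * fromℕ C)
    cast₂ = trans (fromℕ-* M (i ℕ.* C)) (*-congˡ (fromℕ-* i C))
    cast₃ : fromℕ (M ℕ.* (suc i ℕ.* C)) ≈ fromℕ M * ((1# + fromℕ i) * fromℕ C)
    cast₃ = trans (fromℕ-* M (suc i ℕ.* C)) (*-congˡ (fromℕ-* (suc i) C))

  harmonic-vanishes : ∀ x ε → 0# < ε → ∃[ K ] x / fromℕ (suc K) ≤ ε
  harmonic-vanishes x ε 0<ε =
    let K , p = archimedean (x / ε) in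
    K , /-≤ (0<fromℕ (suc K)) (≤-trans
      (<⇒≤ (<-respˡ (/-*-cancel 0<ε) (<-respˡ (*-comm _ _) (*-monoʳ-< 0<ε p))))
      (*-monoʳ-≤ (<⇒≤ 0<ε) (≤-by (solve 1 (λ k → (κ 1 :+ k) :- k := κ 1) refl (fromℕ K)) 0≤1)))

  private
    -- The ring solver treats inverses as variables, so an equation r ≈ 1 enters its identities as a
    -- multiple of 1 - r, which is discarded here.
    absorb : ∀ {r c x} → r ≈ 1# → x + c * (1# - r) ≈ x
    absorb {r} {c} {x} e = trans (+-congˡ (trans (*-congˡ (trans (+-congˡ (-‿cong e)) (-‿inverseʳ 1#))) (zeroʳ c))) (+-identityʳ x)

    area-bound : ∀ {i Q m x e} C → i * Q ≈ 1# → m * x ≈ 1# → 0# ≤ i → 0# ≤ x → e * (m * m) ≤ C * Q →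
      fromℕ 2 * i * e ≤ fromℕ 2 * C * (x * x)
    area-bound {i} {Q} {m} {x} {e} C iQ≈1 mx≈1 0≤i 0≤x bound = ≤-respˡ
      (trans (solve 4 (λ i m x e → κ 2 :* (i :* (x :* x)) :* (e :* (m :* m)) := κ 2 :* i :* e :* (m :* x) :* (m :* x)) refl i m x e)
        (trans (*-cong (trans (*-congˡ mx≈1) (*-identityʳ _)) mx≈1) (*-identityʳ _)))
      (≤-respʳ
        (trans (solve 4 (λ i q x c → κ 2 :* (i :* (x :* x)) :* (c :* q) := κ 2 :* c :* (x :* x) :* (i :* q)) refl i Q x C)
          (trans (*-congˡ iQ≈1) (*-identityʳ _)))
        (*-monoʳ-≤ (0≤* (0≤fromℕ 2) (0≤* 0≤i (0≤* 0≤x 0≤x))) bound))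

    -- Here x = 1/(k + 1) and y = 1/(k + 2), so that x - y = xy and x ≤ 2y.
    telescope-bound : ∀ {C k x y} → 0# ≤ C → 0# ≤ k → 0# ≤ x → 0# ≤ y → (1# + k) * x ≈ 1# → (1# + (1# + k)) * y ≈ 1# →
      fromℕ 2 * C * (x * x) ≤ fromℕ 4 * C * x - fromℕ 4 * C * y
    telescope-bound {C} {k} {x} {y} 0≤C 0≤k 0≤x 0≤y ex ey = ≤-by
      (trans (solve 4 (λ c k x y → (κ 4 :* c :* x :- κ 4 :* c :* y) :- κ 2 :* c :* (x :* x) :=
            (κ 2 :* c :* (x :* x) :* (y :* k)
              :+ (κ 4 :* c :* (x :* y) :- κ 4 :* c :* y) :* (κ 1 :- (κ 1 :+ k) :* x))
              :+ (κ 4 :* c :* x :- κ 2 :* c :* (x :* x)) :* (κ 1 :- (κ 1 :+ (κ 1 :+ k)) :* y)) refl C k x y)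
        (trans (absorb ey) (absorb ex)))
      (0≤* (0≤* (0≤* (0≤fromℕ 2) 0≤C) (0≤* 0≤x 0≤x)) (0≤* 0≤y 0≤k))

  -- The cell [c/q , (c+1)/q) is given the interval of radius e c / q around c/q.
  left right : ℕ → (ℕ → ℕ) → ℕ → Carrier
  left  q e c = (fromℕ c - fromℕ (e c)) / fromℕ q
  right q e c = (fromℕ c + fromℕ (e c)) / fromℕ q

  left≤right : ∀ q e c .{{_ : NonZero q}} → left q e c ≤ right q e c
  left≤right q e c = *-monoˡ-≤ (<⇒≤ (0<⁻¹ (0<fromℕ q))) (≤-by
    (solve 2 (λ c e → (c :+ e) :- (c :- e) := e :+ e) refl (fromℕ c) (fromℕ (e c)))
    (0≤+ (0≤fromℕ (e c)) (0≤fromℕ (e c))))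

  -- The intervals of the row have total length 2/q times the sum of the `e c`, hence at most 2C/(k
  -- + 1)².
  row-bound : ∀ k q C e .{{_ : NonZero q}} → ∑ℕ q e ℕ.* (suc k ℕ.* suc k) ℕ.≤ C ℕ.* q →
    sumTo q (λ c → right q e c - left q e c) ≤
    fromℕ 4 * fromℕ C / fromℕ (suc k) - fromℕ 4 * fromℕ C / fromℕ (suc (suc k))
  row-bound k q C e bound = ≤-respˡ (sym rewrite-sum) (≤-trans
    (area-bound (fromℕ C) (trans (*-comm _ _) (⁻¹-inverse 0<q)) (⁻¹-inverse 0<m) (<⇒≤ (0<⁻¹ 0<q)) (<⇒≤ (0<⁻¹ 0<m)) cast)
    (telescope-bound (0≤fromℕ C) (0≤fromℕ k) (<⇒≤ (0<⁻¹ 0<m)) (<⇒≤ (0<⁻¹ 0<m+1)) (⁻¹-inverse 0<m) (⁻¹-inverse 0<m+1)))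
    where
    0<q : 0# < fromℕ q
    0<q = 0<fromℕ q
    0<m : 0# < fromℕ (suc k)
    0<m = 0<fromℕ (suc k)
    0<m+1 : 0# < fromℕ (suc (suc k))
    0<m+1 = 0<fromℕ (suc (suc k))
    rewrite-sum : sumTo q (λ c → right q e c - left q e c) ≈ fromℕ 2 * fromℕ q ⁻¹ * fromℕ (∑ℕ q e)
    rewrite-sum = trans (sumTo-cong q (λ c →
        solve 3 (λ c e i → (c :+ e) :* i :- (c :- e) :* i := κ 2 :* i :* e) refl (fromℕ c) (fromℕ (e c)) (fromℕ q ⁻¹)))
      (trans (sumTo-*ˡ q (fromℕ 2 * fromℕ q ⁻¹)) (*-congˡ (sym (fromℕ-∑ q e))))
    cast : fromℕ (∑ℕ q e) * (fromℕ (suc k) * fromℕ (suc k)) ≤ fromℕ C * fromℕ q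
    cast = ≤-respˡ (trans (fromℕ-* (∑ℕ q e) (suc k ℕ.* suc k)) (*-congˡ (fromℕ-* (suc k) (suc k))))
      (≤-respʳ (fromℕ-* C q) (fromℕ-mono-≤ {∑ℕ q e ℕ.* (suc k ℕ.* suc k)} {C ℕ.* q} bound))

  Covered : ℕ → (ℕ → ℕ) → Pred Carrier 0ℓ
  Covered q e α = ∃[ c ] c ℕ.< q × left q e c < α × α < right q e c

  -- A cell with e c ≥ 1 lies inside its open interval, left endpoint included, since the interval
  -- is centred there. An uncovered α thus lies in a cell with e c = 0.
  uncovered-cell : ∀ {α} q e .{{_ : NonZero q}} → 0# < α → α < 1# → ¬ Covered q e α →
    ∃[ c ] e c ≡ 0 × fromℕ c ≤ α * fromℕ q × α * fromℕ q < fromℕ c + 1#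
  uncovered-cell {α} q e 0<α α<1 ¬covered =
    let c , lower , upper = floor (0≤* (<⇒≤ 0<α) (0≤fromℕ q))
    in c , radius-0 c lower upper (e c) ≡.refl , lower , upper
    where
    radius-0 : ∀ c → fromℕ c ≤ α * fromℕ q → α * fromℕ q < fromℕ c + 1# → ∀ x → e c ≡ x → x ≡ 0
    radius-0 c lower upper zero    _  = ≡.refl
    radius-0 c lower upper (suc x) eq = ⊥-elim (¬covered (c , c<q ,
      ≡.subst (λ x → (fromℕ c - fromℕ x) / fromℕ q < α) (≡.sym eq)
        (/-< (0<fromℕ q) (<-≤-trans (<-by (solve 2 (λ c e → c :- (c :- (κ 1 :+ e)) := κ 1 :+ e) refl (fromℕ c) (fromℕ x))
          (0<+ 0#<1# (0≤fromℕ x))) lower)) ,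
      ≡.subst (λ x → α < (fromℕ c + fromℕ x) / fromℕ q) (≡.sym eq)
        (</ (0<fromℕ q) (<-≤-trans upper (+-mono-≤ ≤-refl
          (≤-by (solve 1 (λ e → (κ 1 :+ e) :- κ 1 := e) refl (fromℕ x)) (0≤fromℕ x)))))))
      where
      c<q : c ℕ.< q
      c<q = fromℕ-cancel-< (≤-<-trans lower (<-respʳ (*-identityˡ _)
        (<-respˡ (*-comm _ _) (<-respʳ (*-comm _ _) (*-monoʳ-< (0<fromℕ q) α<1)))))

  -- Stage k works with M = k + 1. The hypothesis `long` turns the Chebyshev bound 6h²/N on the
  -- proportion of exceptional cells into C/(k + 1)².
  module Equidistribution (p q r N h : ℕ → ℕ) (C : ℕ)
    (p≤ : ∀ k → p k ℕ.≤ suc k) (q≤r : ∀ k → q k ℕ.≤ r k) (r≤ : ∀ k → r k ℕ.≤ suc k)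
    (N-nonZero : ∀ k → NonZero (N k)) (long : ∀ k → 6 ℕ.* (h k ℕ.* h k) ℕ.* (suc k ℕ.* suc k) ℕ.≤ C ℕ.* N k) where

    -- What an unexceptional cell tells about the α in it, with the grid itself forgotten.
    Hits : Carrier → ℕ → (ℕ → ℕ) → Set
    Hits α k hit =
      (∀ n → hit n ℕ.≤ 1) ×
      (∀ n → n ℕ.< N k → hit n ≡ 1 → RealArc α (A n) (suc k) 0 (p k) × RealArc α (B n) (suc k) (q k) (r k)) ×
      h k ℕ.* (N k ℕ.* (p k ℕ.* (r k ∸ q k))) ℕ.≤ h k ℕ.* (suc k ℕ.* suc k ℕ.* ∑ℕ (N k) hit) ℕ.+ 2 ℕ.* (suc k ℕ.* suc k) ℕ.* N k

    Regular : Pred Carrier 0ℓ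
    Regular α = ∃[ K ] (∀ k → K ℕ.≤ k → ∃ (Hits α k))

    module Stage (k : ℕ) = Discretised (N k) (suc k) (p k) (q k) (r k) (h k) {{N-nonZero k}} (p≤ k) (q≤r k) (r≤ k)

    Q : ℕ → ℕ
    Q k = Stage.Q k

    Q-nonZero : ∀ k → NonZero (Q k)
    Q-nonZero k = ℕ.m*n≢0 (suc k) (∏B (N k)) {{_}} {{∏B-nonZero (N k)}}

    exceptional : ℕ → ℕ → ℕ
    exceptional k c = Stage.exceptional k c

    ∑-exceptional : ∀ k → ∑ℕ (Q k) (exceptional k) ℕ.* (suc k ℕ.* suc k) ℕ.≤ C ℕ.* Q k
    ∑-exceptional k = ℕ.*-cancelʳ-≤ (E ℕ.* m²) (C ℕ.* Q k) (N k) {{N-nonZero k}} (begin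
      E ℕ.* m² ℕ.* N k                        ≡⟨ lemma E m² (N k) ⟩
      E ℕ.* N k ℕ.* m²                        ≤⟨ ℕ.*-monoˡ-≤ m² (Stage.∑-exceptional k) ⟩
      6 ℕ.* (h k ℕ.* h k) ℕ.* Q k ℕ.* m²      ≡⟨ lemma (6 ℕ.* (h k ℕ.* h k)) (Q k) m² ⟩
      6 ℕ.* (h k ℕ.* h k) ℕ.* m² ℕ.* Q k      ≤⟨ ℕ.*-monoˡ-≤ (Q k) (long k) ⟩
      C ℕ.* N k ℕ.* Q k                       ≡⟨ lemma C (N k) (Q k) ⟩
      C ℕ.* Q k ℕ.* N k                       ∎)
      where
      open ℕ.≤-Reasoning
      E m² : ℕ
      E = ∑ℕ (Q k) (exceptional k)
      m² = suc k ℕ.* suc k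
      lemma : ∀ x y z → x ℕ.* y ℕ.* z ≡ x ℕ.* z ℕ.* y
      lemma = ℕ-Solver.solve-∀

    hits : ∀ α k → (∃[ c ] exceptional k c ≡ 0 × fromℕ c ≤ α * fromℕ (Q k) × α * fromℕ (Q k) < fromℕ c + 1#) → ∃ (Hits α k)
    hits α k (c , e , lower , upper) = Stage.hit k c , Stage.hit≤1 k c ,
      (λ n n<N hit≡1 →
        realArc {α} {Q k} {c} {A n} {suc k} {0} {p k} {{Q-nonZero k}} {{_}} {{ℕ.>-nonZero (1≤A n)}}
          lower upper (proj₁ (Stage.hit≡1 k n<N hit≡1)) ,
        realArc {α} {Q k} {c} {B n} {suc k} {q k} {r k} {{Q-nonZero k}} {{_}} {{B-nonZero n}}
          lower upper (proj₂ (Stage.hit≡1 k n<N hit≡1))) ,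
      Stage.many-hits k c e

    almost-all-regular : Null (λ α → 0# < α × α < 1# × ¬ Regular α)
    almost-all-regular = Null-⊆ often
      (borel-cantelli Q (λ k → ℕ.>-nonZero⁻¹ (Q k) {{Q-nonZero k}})
        (λ k → left (Q k) (exceptional k)) (λ k → right (Q k) (exceptional k))
        (λ k c → left≤right (Q k) (exceptional k) c {{Q-nonZero k}})
        (λ k → fromℕ 4 * fromℕ C / fromℕ (suc k))
        (λ k → 0≤/ (0≤* (0≤fromℕ 4) (0≤fromℕ C)) (0<fromℕ (suc k)))
        (harmonic-vanishes (fromℕ 4 * fromℕ C))
        (λ k → row-bound k (Q k) C (exceptional k) {{Q-nonZero k}} (∑-exceptional k)))
      where
      often : ∀ α → 0# < α × α < 1# × ¬ Regular α →
        ∀ K → ∃[ k ] ∃[ c ] K ℕ.≤ k × c ℕ.< Q k × left (Q k) (exceptional k) c < α × α < right (Q k) (exceptional k) c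
      often α (0<α , α<1 , irregular) K with em {∃[ k ] K ℕ.≤ k × Covered (Q k) (exceptional k) α}
      ... | yes (k , K≤k , c , rest) = k , c , K≤k , rest
      -- If no stage from K on covers α, then each of them yields hits, and α is regular.
      ... | no ¬p = ⊥-elim (irregular (K , λ k K≤k → hits α k
              (uncovered-cell (Q k) (exceptional k) {{Q-nonZero k}} 0<α α<1 (λ covered → ¬p (k , K≤k , covered)))))

-- Lists without repetition, and the numbers attached to a solution

unique-length-≤ : ∀ {A : Set} {xs ys : List A} → Unique ys → (∀ {y} → y ∈ ys → y ∈ xs) → length ys ℕ.≤ length xs
unique-length-≤ {ys = []} _ _ = ℕ.z≤n
unique-length-≤ {A} {xs} {y ∷ ys} (y∉ys ∷ unique) ys⊆xs with as , bs , ≡.refl ← ∈-∃++ (ys⊆xs (here ≡.refl)) =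
  ℕ.≤-trans (ℕ.s≤s (unique-length-≤ unique rest)) (ℕ.≤-reflexive (≡.trans (≡.cong suc (length-++ as))
    (≡.sym (≡.trans (length-++ as) (ℕ.+-suc (length as) (length bs))))))
  where
  rest : ∀ {z} → z ∈ ys → z ∈ as ++ bs
  rest {z} z∈ys with ∈-++⁻ as (ys⊆xs (there z∈ys))
  ... | inj₁ z∈as          = ∈-++⁺ˡ z∈as
  ... | inj₂ (here z≡y)    = ⊥-elim (All.lookup y∉ys z∈ys (≡.sym z≡y))
  ... | inj₂ (there z∈bs)  = ∈-++⁺ʳ as z∈bs

module _ {A : Set} (hit : ℕ → ℕ) (hit≤1 : ∀ n → hit n ℕ.≤ 1) (n₀ : ℕ) (G : ℕ → A → Set)
  (G-disjoint : ∀ {m n x y} → m ℕ.< n → G m x → G n y → y ≢ x) where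

  collect : ∀ N → (∀ n → n₀ ℕ.≤ n → n ℕ.< N → hit n ≡ 1 → ∃ (G n)) →
    ∃[ xs ] Unique xs × (∀ {x} → x ∈ xs → ∃[ n ] n₀ ℕ.≤ n × n ℕ.< N × G n x) × ∑ℕ N hit ℕ.≤ length xs ℕ.+ n₀
  collect zero    found = [] , [] , (λ ()) , ℕ.z≤n
  collect (suc N) found = extend (collect N (λ n p q → found n p (ℕ.m<n⇒m<1+n q))) (n₀ ℕ.≤? N) (hit N) ≡.refl (hit≤1 N)
    where
    weaken : ∀ {xs} → (∀ {x} → x ∈ xs → ∃[ n ] n₀ ℕ.≤ n × n ℕ.< N × G n x) →
             ∀ {x} → x ∈ xs → ∃[ n ] n₀ ℕ.≤ n × n ℕ.< suc N × G n x
    weaken p x∈xs = let n , n₀≤n , n<N , g = p x∈xs in n , n₀≤n , ℕ.m<n⇒m<1+n n<N , g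
    Collected : ℕ → Set
    Collected N = ∃[ xs ] Unique xs × (∀ {x} → x ∈ xs → ∃[ n ] n₀ ℕ.≤ n × n ℕ.< N × G n x) × ∑ℕ N hit ℕ.≤ length xs ℕ.+ n₀
    ∑ℕ≤ : ∀ n → ∑ℕ n hit ℕ.≤ n
    ∑ℕ≤ n = ℕ.≤-trans (∑ℕ-mono n hit≤1) (ℕ.≤-reflexive (≡.trans (∑ℕ-const n 1) (ℕ.*-identityʳ n)))
    extend : Collected N → _ → ∀ h → hit N ≡ h → h ℕ.≤ 1 → Collected (suc N)
    extend (xs , unique , p , bound) _ zero e _ = xs , unique , weaken p ,
      ℕ.≤-trans (ℕ.≤-reflexive (≡.trans (≡.cong (∑ℕ N hit ℕ.+_) e) (ℕ.+-identityʳ _))) bound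
    -- So far there have been at most N + 1 ≤ n₀ hits, which the summand `n₀` absorbs; the empty
    -- list suffices.
    extend (xs , unique , p , bound) (no n₀≰N) (suc zero) e _ = [] , [] , (λ ()) ,
      ℕ.≤-trans (∑ℕ≤ (suc N)) (ℕ.≰⇒> n₀≰N)
    extend (xs , unique , p , bound) (yes n₀≤N) (suc zero) e _ with x , g ← found N n₀≤N ℕ.≤-refl e =
      x ∷ xs , All.tabulate (λ y∈xs → let n , _ , n<N , g′ = p y∈xs in G-disjoint n<N g′ g) ∷ unique ,
      (λ { (here ≡.refl) → N , n₀≤N , ℕ.≤-refl , g ; (there y∈xs) → weaken p y∈xs }) ,
      ℕ.≤-trans (ℕ.≤-reflexive (≡.trans (≡.cong (∑ℕ N hit ℕ.+_) e) (ℕ.+-comm _ 1))) (ℕ.s≤s bound)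
    extend _ _ (suc (suc _)) _ (ℕ.s≤s ())

-- a² + a² + 1 = d² , a² + c² = e² + 1 and a² + a² + c² = g² , where A = a² and B = e².
a e c g : ℕ → ℕ
a n = 2 ℕ.* b n
e n = 2 ℕ.* b² n
c n = ℕ.pred (e n)
g n = suc (e n)

1≤b : ∀ n → 1 ℕ.≤ b n
1≤b n = ℕ.>-nonZero⁻¹ (b n) {{b-nonZero n}}

1+c≡e : ∀ n → suc (c n) ≡ e n
1+c≡e n = ℕ.suc-pred (e n) {{ℕ.m*n≢0 2 (b² n) {{_}} {{ℕ.>-nonZero (1≤b² n)}}}}

a²≡A : ∀ n → a n ℕ.* a n ≡ A n
a²≡A n = lemma (b n)
  where
  lemma : ∀ x → (2 ℕ.* x) ℕ.* (2 ℕ.* x) ≡ 4 ℕ.* (x ℕ.* x)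
  lemma = ℕ-Solver.solve-∀

e²≡B : ∀ n → e n ℕ.* e n ≡ B n
e²≡B n = lemma (b² n)
  where
  lemma : ∀ x → (2 ℕ.* x) ℕ.* (2 ℕ.* x) ≡ 4 ℕ.* (x ℕ.* x)
  lemma = ℕ-Solver.solve-∀

d²≡A+A+1 : ∀ n → d n ℕ.* d n ≡ A n ℕ.+ A n ℕ.+ 1
d²≡A+A+1 n = ≡.trans (pell n) (lemma (b² n))
  where
  lemma : ∀ x → 8 ℕ.* x ℕ.+ 1 ≡ 4 ℕ.* x ℕ.+ 4 ℕ.* x ℕ.+ 1
  lemma = ℕ-Solver.solve-∀

A≡2e : ∀ n → A n ≡ 2 ℕ.* e n
A≡2e n = lemma (b² n)
  where
  lemma : ∀ x → 4 ℕ.* x ≡ 2 ℕ.* (2 ℕ.* x)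
  lemma = ℕ-Solver.solve-∀

c²+A≡B+1 : ∀ n → c n ℕ.* c n ℕ.+ A n ≡ B n ℕ.+ 1
c²+A≡B+1 n = ≡.trans (≡.cong (c n ℕ.* c n ℕ.+_) (≡.trans (A≡2e n) (≡.cong (2 ℕ.*_) (≡.sym (1+c≡e n)))))
  (≡.trans (lemma (c n)) (≡.cong (ℕ._+ 1) (≡.trans (≡.cong (λ x → x ℕ.* x) (1+c≡e n)) (e²≡B n))))
  where
  lemma : ∀ x → x ℕ.* x ℕ.+ 2 ℕ.* suc x ≡ suc x ℕ.* suc x ℕ.+ 1
  lemma = ℕ-Solver.solve-∀

g²≡B+A+1 : ∀ n → g n ℕ.* g n ≡ B n ℕ.+ A n ℕ.+ 1
g²≡B+A+1 n = lemma (b² n)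
  where
  lemma : ∀ x → suc (2 ℕ.* x) ℕ.* suc (2 ℕ.* x) ≡ 4 ℕ.* (x ℕ.* x) ℕ.+ 4 ℕ.* x ℕ.+ 1
  lemma = ℕ-Solver.solve-∀

a≤e : ∀ n → a n ℕ.≤ e n
a≤e n = ℕ.*-monoʳ-≤ 2 (ℕ.m≤n*m (b n) (b n) {{b-nonZero n}})

c≤e : ∀ n → c n ℕ.≤ e n
c≤e n = ℕ.pred[n]≤n

a≤d : ∀ n → a n ℕ.≤ d n
a≤d zero    = ℕ.s≤s (ℕ.s≤s ℕ.z≤n)
a≤d (suc n) = ℕ.≤-trans (ℕ.≤-reflexive (ℕ.*-distribˡ-+ 2 (3 ℕ.* b n) (d n)))
  (ℕ.+-mono-≤ (ℕ.≤-trans (ℕ.≤-reflexive (≡.sym (ℕ.*-assoc 2 3 (b n)))) (ℕ.*-monoˡ-≤ (b n) (ℕ.m≤m+n 6 2)))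
              (ℕ.*-monoˡ-≤ (d n) (ℕ.m≤m+n 2 1)))

-- The index starts at 1 because a 0 = 2 exceeds c 0 = 1; the first solution yields no ordered
-- triple and is left out later by 1 ≤ n.
a≤c : ∀ n → a (suc n) ℕ.≤ c (suc n)
a≤c n = ℕ.≤-pred (ℕ.≤-trans a<e (ℕ.≤-reflexive (≡.sym (1+c≡e (suc n)))))
  where
  2≤b : 2 ℕ.≤ b (suc n)
  2≤b = ℕ.≤-trans (ℕ.≤-trans (ℕ.m≤m+n 2 1) (ℕ.*-monoʳ-≤ 3 (1≤b n))) (ℕ.m≤m+n (3 ℕ.* b n) (d n))
  a<e : a (suc n) ℕ.< e (suc n)
  a<e = ℕ.*-monoʳ-< 2 (ℕ.<-≤-trans
    (ℕ.m<m+n (b (suc n)) {b (suc n) ℕ.+ 0} (ℕ.≤-trans (1≤b (suc n)) (ℕ.m≤m+n (b (suc n)) 0)))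
    (ℕ.*-monoˡ-≤ (b (suc n)) 2≤b))

2A≤A : ∀ {m n} → m ℕ.< n → A m ℕ.+ A m ℕ.≤ A n
2A≤A {m} {suc n} m<1+n with ℕ.m≤n⇒m<n∨m≡n (ℕ.≤-pred m<1+n)
... | inj₂ ≡.refl = ℕ.≤-trans (ℕ.≤-reflexive (≡.cong (A m ℕ.+_) (≡.sym (ℕ.+-identityʳ (A m)))))
      (ℕ.≤-trans (ℕ.*-monoˡ-≤ (A m) (ℕ.m≤m+n 2 7)) (9A≤A m))
... | inj₁ m<n = ℕ.≤-trans (2A≤A m<n) (ℕ.≤-trans (ℕ.m≤n*m (A n) 9) (9A≤A n))

n<A : ∀ n → n ℕ.< A n
n<A zero    = 1≤A 0
n<A (suc n) = ℕ.≤-trans (ℕ.s≤s (n<A n)) (ℕ.≤-trans (ℕ.+-monoˡ-≤ (A n) (1≤A n)) (2A≤A (ℕ.n<1+n n)))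

-- From fractional parts to triples in T(α)

module Triples (em : ExcludedMiddle 0ℓ) (R : CompleteOrderedField) where

  open Measure em R public

  square : ∀ n → fromℕ n ^ 2 ≈ fromℕ (n ℕ.* n)
  square n = trans (*-congˡ (*-identityʳ (fromℕ n))) (sym (fromℕ-* n n))

  isFloor : ∀ {α} k n → fromℕ k ≤ α * fromℕ (n ℕ.* n) → α * fromℕ (n ℕ.* n) < fromℕ k + 1# → IsFloor (α * fromℕ n ^ 2) k
  isFloor {α} k n lower upper = ≤-respʳ (sym (*-congˡ (square n))) lower , <-respˡ (sym (*-congˡ (square n))) upper

  √⁻¹≤ : ∀ {α} n → 0# < α → 1# ≤ α * fromℕ (n ℕ.* n) → (√ α) ⁻¹ ≤ fromℕ n
  √⁻¹≤ {α} n 0<α 1≤αn² = ≤-respˡ (*-identityˡ _) (/-≤ 0<√α (square-cancel-≤ (0≤* (0≤fromℕ n) (<⇒≤ 0<√α))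
    (≤-respˡ (sym (*-identityʳ 1#)) (≤-respʳ
      (trans (*-cong (sym (proj₂ (√-isRoot 0<α))) (fromℕ-* n n))
        (solve 2 (λ r n → r :* r :* (n :* n) := (n :* r) :* (n :* r)) refl (√ α) (fromℕ n)))
      1≤αn²))))
    where
    0<√α : 0# < √ α
    0<√α = root-positive 0<α (√-isRoot 0<α)

  sFrom : ∀ {α} k m n → 0# < α → 1 ℕ.≤ m → m ℕ.≤ n → 1# ≤ α * fromℕ (m ℕ.* m) →
    fromℕ k ≤ α * fromℕ (n ℕ.* n) → α * fromℕ (n ℕ.* n) < fromℕ k + 1# → SFrom α n k
  sFrom k m n 0<α 1≤m m≤n 1≤αm² lower upper = ℕ.≤-trans 1≤m m≤n ,
    √⁻¹≤ n 0<α (≤-trans 1≤αm² (*-monoʳ-≤ (<⇒≤ 0<α) (fromℕ-mono-≤ {m ℕ.* m} {n ℕ.* n} (ℕ.*-mono-≤ m≤n m≤n)))) ,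
    isFloor k n lower upper

  -- With u = αA - k and w = αB - l these inequalities make k + k, l, l - k and
  -- l + k the integer parts of αd², αe², αc² and αg².
  Suitable : Carrier → Carrier → Carrier → ℕ → ℕ → Set
  Suitable α x y k l =
    0# ≤ x - fromℕ k × 0# ≤ y - fromℕ l ×
    (x - fromℕ k) + (x - fromℕ k) + α < 1# ×
    (x - fromℕ k) + (y - fromℕ l) + α < 1# ×
    x - fromℕ k ≤ (y - fromℕ l) + α

  record GoodTriple (α : Carrier) (n : ℕ) (t : Triple) : Set where
    field
      k l       : ℕ
      t≡        : t ≡ (k , k , l ∸ k)
      k≤αA      : fromℕ k ≤ α * fromℕ (A n)
      αA<k+1    : α * fromℕ (A n) < fromℕ k + 1#
      1≤αA      : 1# ≤ α * fromℕ (A n)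
      inT       : T (S α) (k , k , l ∸ k)
      sFrom-a   : SFrom α (a n) k
      sFrom-c   : SFrom α (c n) (l ∸ k)

  -- With x = αA and y = αB, the numbers αd², αc² and αg² are x + x + α, y + α - x and y + x + α.
  -- The pair sums are k + k from d and twice l from e, the triple sum is l + k from g. The order k
  -- ≤ l - k comes from a ≤ c, integer parts being monotone.
  goodTriple : ∀ {α n k l} → 0# < α → 1 ℕ.≤ n → 1# ≤ α * fromℕ (A n) →
    Suitable α (α * fromℕ (A n)) (α * fromℕ (B n)) k l → GoodTriple α n (k , k , l ∸ k)
  goodTriple {α} {n@(suc n′)} {k} {l} 0<α _ 1≤αA (0≤u , 0≤w , 2u+α<1 , u+w+α<1 , u≤w+α) = record
    { k = k ; l = l ; t≡ = ≡.refl ; k≤αA = k≤x ; αA<k+1 = x<k+1 ; 1≤αA = 1≤αA ; sFrom-a = s-a ; sFrom-c = s-c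
    ; inT = 1≤k , ℕ.≤-refl , k≤l∸k , (a n , s-a) , (a n , s-a) , (c n , s-c) , (d n , s-d) ,
            (e n , ≡.subst (SFrom α (e n)) (≡.sym (ℕ.m+[n∸m]≡n k≤l)) s-e) ,
            (e n , ≡.subst (SFrom α (e n)) (≡.sym (ℕ.m∸n+n≡m k≤l)) s-e) ,
            (g n , ≡.subst (SFrom α (g n)) (≡.sym k+k+[l∸k]≡l+k) s-g)
    }
    where
    x y : Carrier
    x = α * fromℕ (A n)
    y = α * fromℕ (B n)
    k≤x : fromℕ k ≤ x
    k≤x = ≤-by refl 0≤u
    l≤y : fromℕ l ≤ y
    l≤y = ≤-by refl 0≤w
    x<k+1 : x < fromℕ k + 1#
    x<k+1 = <-by (solve 3 (λ x k α → (k :+ κ 1) :- x := (κ 1 :- ((x :- k) :+ (x :- k) :+ α)) :+ ((x :- k) :+ α)) refl x (fromℕ k) α)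
      (0<+ (0<-diff 2u+α<1) (0≤+ 0≤u (<⇒≤ 0<α)))
    y<l+1 : y < fromℕ l + 1#
    y<l+1 = <-by (solve 5 (λ x k y l α → (l :+ κ 1) :- y := (κ 1 :- ((x :- k) :+ (y :- l) :+ α)) :+ ((x :- k) :+ α)) refl
        x (fromℕ k) y (fromℕ l) α)
      (0<+ (0<-diff u+w+α<1) (0≤+ 0≤u (<⇒≤ 0<α)))
    x≤y : x ≤ y
    x≤y = *-monoʳ-≤ (<⇒≤ 0<α) (fromℕ-mono-≤ {A n} {B n} (A≤B n))
    1≤k : 1 ℕ.≤ k
    1≤k = fromℕ-≤-<suc {1} {k} (≤-<-trans (≤-respˡ (sym fromℕ-1) 1≤αA) x<k+1)
    k≤l : k ℕ.≤ l
    k≤l = fromℕ-≤-<suc {k} {l} (≤-<-trans k≤x (≤-<-trans x≤y y<l+1))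
    l-k : fromℕ (l ∸ k) ≈ fromℕ l - fromℕ k
    l-k = trans (solve 2 (λ z k → z := (z :+ k) :- k) refl (fromℕ (l ∸ k)) (fromℕ k))
      (+-congʳ (trans (sym (fromℕ-+ (l ∸ k) k)) (reflexive (≡.cong fromℕ (ℕ.m∸n+n≡m k≤l)))))
    c-lower : fromℕ (l ∸ k) ≤ α * fromℕ (c n ℕ.* c n)
    c-upper : α * fromℕ (c n ℕ.* c n) < fromℕ (l ∸ k) + 1#
    αa² : α * fromℕ (a n ℕ.* a n) ≈ x
    αa² = *-congˡ (reflexive (≡.cong fromℕ (a²≡A n)))
    αe² : α * fromℕ (e n ℕ.* e n) ≈ y
    αe² = *-congˡ (reflexive (≡.cong fromℕ (e²≡B n)))
    αd² : α * fromℕ (d n ℕ.* d n) ≈ x + x + α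
    αd² = trans (*-congˡ (trans (reflexive (≡.cong fromℕ (d²≡A+A+1 n)))
        (trans (fromℕ-+ (A n ℕ.+ A n) 1) (+-cong (fromℕ-+ (A n) (A n)) fromℕ-1))))
      (solve 2 (λ α z → α :* (z :+ z :+ κ 1) := α :* z :+ α :* z :+ α) refl α (fromℕ (A n)))
    αg² : α * fromℕ (g n ℕ.* g n) ≈ y + x + α
    αg² = trans (*-congˡ (trans (reflexive (≡.cong fromℕ (g²≡B+A+1 n)))
        (trans (fromℕ-+ (B n ℕ.+ A n) 1) (+-cong (fromℕ-+ (B n) (A n)) fromℕ-1))))
      (solve 3 (λ α z w → α :* (w :+ z :+ κ 1) := α :* w :+ α :* z :+ α) refl α (fromℕ (A n)) (fromℕ (B n)))
    αc² : α * fromℕ (c n ℕ.* c n) ≈ (y + α) - x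
    αc² = trans (solve 3 (λ α z w → α :* z := α :* (z :+ w) :- α :* w) refl α (fromℕ (c n ℕ.* c n)) (fromℕ (A n)))
      (+-congʳ (trans (*-congˡ (trans (sym (fromℕ-+ (c n ℕ.* c n) (A n))) (trans (reflexive (≡.cong fromℕ (c²+A≡B+1 n)))
          (trans (fromℕ-+ (B n) 1) (+-congˡ fromℕ-1)))))
        (solve 2 (λ α z → α :* (z :+ κ 1) := α :* z :+ α) refl α (fromℕ (B n)))))
    c-lower = ≤-respˡ (sym l-k) (≤-respʳ (sym αc²) (≤-by
      (solve 5 (λ x k y l α → ((y :+ α) :- x) :- (l :- k) := ((y :- l) :+ α) :- (x :- k)) refl x (fromℕ k) y (fromℕ l) α)
      (0≤-diff u≤w+α)))
    c-upper = <-respʳ (+-congʳ (sym l-k)) (<-respˡ (sym αc²) (<-by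
      (solve 5 (λ x k y l α → ((l :- k) :+ κ 1) :- ((y :+ α) :- x) := (κ 1 :- ((x :- k) :+ (y :- l) :+ α)) :+ ((x :- k) :+ (x :- k))) refl
        x (fromℕ k) y (fromℕ l) α)
      (0<+ (0<-diff u+w+α<1) (0≤+ 0≤u 0≤u))))
    1≤a : 1 ℕ.≤ a n
    1≤a = ℕ.≤-trans (1≤b n) (ℕ.m≤n*m (b n) 2)
    from : ∀ z m → a n ℕ.≤ m → fromℕ z ≤ α * fromℕ (m ℕ.* m) → α * fromℕ (m ℕ.* m) < fromℕ z + 1# → SFrom α m z
    from z m a≤m = sFrom z (a n) m 0<α 1≤a a≤m (≤-respʳ (sym αa²) 1≤αA)
    s-a : SFrom α (a n) k
    s-a = from k (a n) ℕ.≤-refl (≤-respʳ (sym αa²) k≤x) (<-respˡ (sym αa²) x<k+1)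
    s-c : SFrom α (c n) (l ∸ k)
    s-c = from (l ∸ k) (c n) (a≤c n′) c-lower c-upper
    s-e : SFrom α (e n) l
    s-e = from l (e n) (a≤e n) (≤-respʳ (sym αe²) l≤y) (<-respˡ (sym αe²) y<l+1)
    s-d : SFrom α (d n) (k ℕ.+ k)
    s-d = from (k ℕ.+ k) (d n) (a≤d n)
      (≤-respˡ (sym (fromℕ-+ k k)) (≤-respʳ (sym αd²) (≤-by
        (solve 3 (λ x k α → (x :+ x :+ α) :- (k :+ k) := (x :- k) :+ (x :- k) :+ α) refl x (fromℕ k) α)
        (0≤+ (0≤+ 0≤u 0≤u) (<⇒≤ 0<α)))))
      (<-respʳ (+-congʳ (sym (fromℕ-+ k k))) (<-respˡ (sym αd²) (<-by
        (solve 3 (λ x k α → (k :+ k :+ κ 1) :- (x :+ x :+ α) := κ 1 :- ((x :- k) :+ (x :- k) :+ α)) refl x (fromℕ k) α)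
        (0<-diff 2u+α<1))))
    s-g : SFrom α (g n) (l ℕ.+ k)
    s-g = from (l ℕ.+ k) (g n) (ℕ.≤-trans (a≤e n) (ℕ.n≤1+n (e n)))
      (≤-respˡ (sym (fromℕ-+ l k)) (≤-respʳ (sym αg²) (≤-by
        (solve 5 (λ x k y l α → (y :+ x :+ α) :- (l :+ k) := (x :- k) :+ (y :- l) :+ α) refl x (fromℕ k) y (fromℕ l) α)
        (0≤+ (0≤+ 0≤u 0≤w) (<⇒≤ 0<α)))))
      (<-respʳ (+-congʳ (sym (fromℕ-+ l k))) (<-respˡ (sym αg²) (<-by
        (solve 5 (λ x k y l α → (l :+ k :+ κ 1) :- (y :+ x :+ α) := κ 1 :- ((x :- k) :+ (y :- l) :+ α)) refl x (fromℕ k) y (fromℕ l) α)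
        (0<-diff u+w+α<1))))
    k≤l∸k : k ℕ.≤ l ∸ k
    k≤l∸k = fromℕ-≤-<suc {k} {l ∸ k} (≤-<-trans k≤x (≤-<-trans
      (≤-respˡ αa² (*-monoʳ-≤ (<⇒≤ 0<α) (fromℕ-mono-≤ {a n ℕ.* a n} {c n ℕ.* c n} (ℕ.*-mono-≤ (a≤c n′) (a≤c n′))))) c-upper))
    k+k+[l∸k]≡l+k : k ℕ.+ k ℕ.+ (l ∸ k) ≡ l ℕ.+ k
    k+k+[l∸k]≡l+k = ≡.trans (ℕ.+-assoc k k (l ∸ k)) (≡.trans (≡.cong (k ℕ.+_) (ℕ.m+[n∸m]≡n k≤l)) (ℕ.+-comm k l))

  -- The first entries differ: αA at least doubles from m to n and is at least 1 at m, so its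
  -- integer part increases.
  goodTriple-≢ : ∀ {α m n t t′} → 0# < α → m ℕ.< n → GoodTriple α m t → GoodTriple α n t′ → t′ ≢ t
  goodTriple-≢ {α} {m} {n} 0<α m<n G G′ t′≡t = ℕ.<⇒≢ k<k′
    (≡.cong proj₁ (≡.trans (≡.sym (GoodTriple.t≡ G)) (≡.trans (≡.sym t′≡t) (GoodTriple.t≡ G′))))
    where
    module G = GoodTriple G
    module G′ = GoodTriple G′
    k<k′ : G.k ℕ.< G′.k
    k<k′ = fromℕ-≤-<suc {suc G.k} {G′.k} (≤-<-trans (+-mono-≤ G.1≤αA G.k≤αA) (≤-<-trans
      (≤-respˡ (trans (*-congˡ (fromℕ-+ (A m) (A m))) (distribˡ α _ _)) (*-monoʳ-≤ (<⇒≤ 0<α) (fromℕ-mono-≤ {A m ℕ.+ A m} {A n} (2A≤A m<n))))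
      G′.αA<k+1))

  -- In units of M, the arcs give u < p/M ≤ β and w < r/M ≤ β, so 2u + α and u + w + α are below 2β
  -- + α ≤ 1; and u < β ≤ q/M + α ≤ w + α.
  suitable : ∀ {α β x y} M {p q r k l} .{{_ : NonZero M}} →
    fromℕ p ≤ β * fromℕ M → fromℕ r ≤ β * fromℕ M → β + β + α ≤ 1# → β * fromℕ M ≤ fromℕ q + α * fromℕ M →
    fromℕ M * fromℕ k + fromℕ 0 ≤ fromℕ M * x → fromℕ M * x < fromℕ M * fromℕ k + fromℕ p →
    fromℕ M * fromℕ l + fromℕ q ≤ fromℕ M * y → fromℕ M * y < fromℕ M * fromℕ l + fromℕ r →
    Suitable α x y k l
  suitable {α} {β} {x} {y} M {p} {q} {r} {k} {l} p≤ r≤ 2β+α≤1 q≥ x-lower x-upper y-lower y-upper =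
    0≤-diff (cancel-≤ (≤-by
      (solve 3 (λ m x k → x :* m :- k :* m := m :* x :- (m :* k :+ κ 0)) refl m x (fromℕ k)) (0≤-diff x-lower))) ,
    0≤-diff (cancel-≤ (≤-by
      (solve 4 (λ m y l q → y :* m :- l :* m := (m :* y :- (m :* l :+ q)) :+ q) refl m y (fromℕ l) (fromℕ q))
      (0≤+ (0≤-diff y-lower) (0≤fromℕ q)))) ,
    cancel-< (<-by
      (solve 6 (λ m x k α β p → κ 1 :* m :- ((x :- k) :+ (x :- k) :+ α) :* m :=
          ((m :* k :+ p) :- m :* x) :+ ((((m :* k :+ p) :- m :* x) :+ ((β :* m :- p) :+ (β :* m :- p))) :+ (κ 1 :- (β :+ β :+ α)) :* m)) refl
        m x (fromℕ k) α β (fromℕ p))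
      (0<+ (0<-diff x-upper) (0≤+ (0≤+ (0≤-diff (<⇒≤ x-upper)) (0≤+ (0≤-diff p≤) (0≤-diff p≤))) (0≤* (0≤-diff 2β+α≤1) 0≤m)))) ,
    cancel-< (<-by
      (solve 9 (λ m x k y l α β p r → κ 1 :* m :- ((x :- k) :+ (y :- l) :+ α) :* m :=
          ((m :* k :+ p) :- m :* x) :+ ((((m :* l :+ r) :- m :* y) :+ ((β :* m :- p) :+ (β :* m :- r))) :+ (κ 1 :- (β :+ β :+ α)) :* m)) refl
        m x (fromℕ k) y (fromℕ l) α β (fromℕ p) (fromℕ r))
      (0<+ (0<-diff x-upper) (0≤+ (0≤+ (0≤-diff (<⇒≤ y-upper)) (0≤+ (0≤-diff p≤) (0≤-diff r≤))) (0≤* (0≤-diff 2β+α≤1) 0≤m)))) ,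
    cancel-≤ (≤-by
      (solve 9 (λ m x k y l α β p q → ((y :- l) :+ α) :* m :- (x :- k) :* m :=
          ((m :* y :- (m :* l :+ q)) :+ ((m :* k :+ p) :- m :* x)) :+ ((β :* m :- p) :+ ((q :+ α :* m) :- β :* m))) refl
        m x (fromℕ k) y (fromℕ l) α β (fromℕ p) (fromℕ q))
      (0≤+ (0≤+ (0≤-diff y-lower) (0≤-diff (<⇒≤ x-upper))) (0≤+ (0≤-diff p≤) (0≤-diff q≥))))
    where
    m : Carrier
    m = fromℕ M
    0≤m : 0# ≤ m
    0≤m = 0≤fromℕ M
    cancel-≤ : ∀ {z w} → z * m ≤ w * m → z ≤ w
    cancel-≤ = *-cancelʳ-≤ (0<fromℕ M)
    cancel-< : ∀ {z w} → z * m < w * m → z < w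
    cancel-< = *-cancelʳ-< 0≤m

-- Growth of the solutions, cardinalities, and infinitude of T(α)

module Counting (em : ExcludedMiddle 0ℓ) (R : CompleteOrderedField) where

  open Triples em R public

  -- Lets the ring solver work modulo an equation: it proves an identity with an extra multiple of x
  -- - y, which is removed here.
  cancel-zero : ∀ {x y z c} → x ≈ y → z + c * (x - y) ≈ z
  cancel-zero {x} {y} {z} {c} e = trans (+-congˡ (trans (*-congˡ (trans (+-congʳ e) (-‿inverseʳ y))) (zeroʳ c))) (+-identityʳ z)

  σ Λ : Carrier
  σ = √ (fromℕ 2)
  Λ = 1# + σ

  σ-root : IsRoot (fromℕ 2) σ
  σ-root = √-isRoot (0<fromℕ 2)

  1<Λ : 1# < Λ
  1<Λ = <-by (solve 1 (λ s → (κ 1 :+ s) :- κ 1 := s) refl σ) (root-positive (0<fromℕ 2) σ-root)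

  -- (1 + √2)² = 3 + 2√2 is the unit 3 + √8 behind the recursion of `b` and `d`.
  power-expansion : ∀ {s} → s * s ≈ fromℕ 2 → ∀ n →
    fromℕ (d n) + fromℕ 2 * fromℕ (b n) * s ≈ ((1# + s) ^ 2) ^ suc n
  power-expansion {s} s²≈2 zero = sym (trans
    (solve 1 (λ s → (κ 1 :+ s) :* ((κ 1 :+ s) :* κ 1) :* κ 1 := (κ 3 :+ κ 2 :* (κ 1 :+ κ 0) :* s) :+ κ 1 :* (s :* s :- κ 2)) refl s)
    (cancel-zero s²≈2))
  power-expansion {s} s²≈2 (suc n) = trans (+-cong
      (trans (fromℕ-+ (8 ℕ.* b n) (3 ℕ.* d n)) (+-cong (fromℕ-* 8 (b n)) (fromℕ-* 3 (d n))))
      (*-congʳ (*-congˡ (trans (fromℕ-+ (3 ℕ.* b n) (d n)) (+-congʳ (fromℕ-* 3 (b n)))))))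
    (trans (sym (cancel-zero s²≈2))
    (trans (solve 3 (λ b d s → (κ 8 :* b :+ κ 3 :* d) :+ κ 2 :* (κ 3 :* b :+ d) :* s :+ (κ 4 :* b :+ d :+ κ 2 :* b :* s) :* (s :* s :- κ 2) :=
        (κ 1 :+ s) :* ((κ 1 :+ s) :* κ 1) :* (d :+ κ 2 :* b :* s)) refl (fromℕ (b n)) (fromℕ (d n)) s)
      (*-congˡ (power-expansion s²≈2 n))))

  -- The square is d² + 8b² + 4bds = 16b² + 1 + 4bds, and ds ≥ 4b because (ds)² = 16b² + 2.
  square-bound : ∀ {b d s} → 0# ≤ b → 0# ≤ d → 0# ≤ s → s * s ≈ fromℕ 2 → d * d ≈ fromℕ 8 * (b * b) + 1# →
    fromℕ 32 * (b * b) ≤ (d + fromℕ 2 * b * s) * (d + fromℕ 2 * b * s)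
  square-bound {b} {d} {s} 0≤b 0≤d 0≤s s²≈2 d² = ≤-by
    (trans (solve 4 (λ b d s z → (d :+ κ 2 :* b :* s) :* (d :+ κ 2 :* b :* s) :- κ 32 :* (b :* b) :=
        (κ 1 :+ κ 4 :* (b :* (d :* s :- κ 4 :* b))) :+ κ 4 :* (b :* b) :* (s :* s :- κ 2) :+ κ 1 :* (d :* d :- (κ 8 :* (b :* b) :+ κ 1))) refl b d s b)
      (trans (cancel-zero d²) (cancel-zero s²≈2)))
    (0≤+ 0≤1 (0≤* (0≤fromℕ 4) (0≤* 0≤b (0≤-diff (square-cancel-≤ (0≤* 0≤d 0≤s) 4b≤ds)))))
    where
    4b≤ds : fromℕ 4 * b * (fromℕ 4 * b) ≤ d * s * (d * s)
    4b≤ds = ≤-by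
      (trans (solve 3 (λ b d s → d :* s :* (d :* s) :- κ 4 :* b :* (κ 4 :* b) :=
          κ 2 :+ d :* d :* (s :* s :- κ 2) :+ κ 2 :* (d :* d :- (κ 8 :* (b :* b) :+ κ 1))) refl b d s)
        (trans (cancel-zero d²) (cancel-zero s²≈2)))
      (0≤fromℕ 2)

  -- As 32b² = 16e, this is the origin of the 16 in log(16x); the exponent doubles because the
  -- expansion is squared.
  16e≤Λ : ∀ n → fromℕ 16 * fromℕ (e n) ≤ Λ ^ (4 ℕ.* suc n)
  16e≤Λ n = ≤-respˡ (trans (solve 1 (λ b → κ 32 :* (b :* b) := κ 16 :* (κ 2 :* (b :* b))) refl (fromℕ (b n)))
      (*-congˡ (trans (*-congˡ (sym (fromℕ-* (b n) (b n)))) (sym (fromℕ-* 2 (b² n))))))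
    (≤-respʳ eq (square-bound (0≤fromℕ (b n)) (0≤fromℕ (d n)) (proj₁ σ-root) (proj₂ σ-root)
      (trans (sym (fromℕ-* (d n) (d n))) (trans (reflexive (≡.cong fromℕ (pell n)))
        (trans (fromℕ-+ (8 ℕ.* b² n) 1) (+-cong (trans (fromℕ-* 8 (b² n)) (*-congˡ (fromℕ-* (b n) (b n)))) fromℕ-1))))))
    where
    exponent : ∀ m → 2 ℕ.* (m ℕ.+ m) ≡ 4 ℕ.* m
    exponent = ℕ-Solver.solve-∀
    eq : (fromℕ (d n) + fromℕ 2 * fromℕ (b n) * σ) * (fromℕ (d n) + fromℕ 2 * fromℕ (b n) * σ) ≈ Λ ^ (4 ℕ.* suc n)
    eq = trans (*-cong (power-expansion (proj₂ σ-root) n) (power-expansion (proj₂ σ-root) n))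
      (trans (sym (^-homo-* (Λ ^ 2) (suc n) (suc n))) (trans (^-assocʳ Λ 2 (suc n ℕ.+ suc n))
        (reflexive (≡.cong (Λ ^_) (exponent (suc n))))))

  e≤ : ∀ {x n N} → n ℕ.< N → Λ ^ (4 ℕ.* N) ≤ fromℕ 16 * x → fromℕ (e n) ≤ x
  e≤ {x} {n} {N} n<N p = *-cancelʳ-≤ (0<fromℕ 16) (≤-respˡ (*-comm _ _) (≤-respʳ (*-comm _ _)
    (≤-trans (16e≤Λ n) (≤-trans (^-monoʳ-≤ (<⇒≤ 1<Λ) (ℕ.*-monoʳ-≤ 4 n<N)) p))))

  goodTriple-T≤ : ∀ {α x n t} → GoodTriple α n t → fromℕ (e n) ≤ x → T≤ x α t
  goodTriple-T≤ {α} {x} {n} G e≤x = ≡.subst (T≤ x α) (≡.sym G.t≡)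
    (G.inT , a n , a n , c n , (G.sFrom-a , a≤x) , (G.sFrom-a , a≤x) ,
      (G.sFrom-c , ≤-trans (fromℕ-mono-≤ {c n} {e n} (c≤e n)) e≤x))
    where
    module G = GoodTriple G
    a≤x : fromℕ (a n) ≤ x
    a≤x = ≤-trans (fromℕ-mono-≤ {a n} {e n} (a≤e n)) e≤x

  -- Excluded middle decides P, whose elements are then filtered out of a box. The last component
  -- turns a list of distinct elements into a lower bound for the cardinality.
  bounded⇒cardinality : ∀ (P : Pred Triple 0ℓ) bound →
    (∀ {k l m} → P (k , l , m) → k ℕ.< bound × l ℕ.< bound × m ℕ.< bound) →
    ∃[ c ] HasCardinality P c × (∀ ys → Unique ys → (∀ {t} → t ∈ ys → P t) → length ys ℕ.≤ c)
  bounded⇒cardinality P bound below =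
    length xs , (xs , unique , (λ t → mk⇔ complete (λ t∈xs → proj₂ (∈-filter⁻ P? {xs = box} t∈xs))) , ≡.refl) ,
    (λ ys ys-unique ys⊆ → unique-length-≤ ys-unique (λ t∈ys → complete (ys⊆ t∈ys)))
    where
    P? : ∀ t → Dec (P t)
    P? t = em
    box : List Triple
    box = cartesianProduct (upTo bound) (cartesianProduct (upTo bound) (upTo bound))
    xs : List Triple
    xs = filter P? box
    unique : Unique xs
    unique = Unique.filter⁺ P? (Unique.cartesianProduct⁺ (Unique.upTo⁺ bound)
      (Unique.cartesianProduct⁺ (Unique.upTo⁺ bound) (Unique.upTo⁺ bound)))
    complete : ∀ {t} → P t → t ∈ xs
    complete p = let k< , l< , m< = below p in
      ∈-filter⁺ P? (∈-cartesianProduct⁺ (∈-upTo⁺ k<) (∈-cartesianProduct⁺ (∈-upTo⁺ l<) (∈-upTo⁺ m<))) p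

  T≤-cardinality : ∀ {α} x → 0# < α → ∃[ c ] HasCardinality (T≤ x α) c ×
    (∀ ys → Unique ys → (∀ {t} → t ∈ ys → T≤ x α t) → length ys ℕ.≤ c)
  T≤-cardinality {α} x 0<α = bounded⇒cardinality (T≤ x α) (proj₁ (archimedean (α * x ^ 2)))
    (λ (_ , _ , _ , _ , (s₁ , p₁) , (s₂ , p₂) , (s₃ , p₃)) → below s₁ p₁ , below s₂ p₂ , below s₃ p₃)
    where
    below : ∀ {n k} → SFrom α n k → fromℕ n ≤ x → k ℕ.< proj₁ (archimedean (α * x ^ 2))
    below {n} {k} (_ , _ , k≤αn² , _) n≤x = fromℕ-cancel-< {k} (≤-<-trans k≤αn²
      (≤-<-trans (*-monoʳ-≤ (<⇒≤ 0<α) (^-monoˡ-≤ 2 (0≤fromℕ n) n≤x)) (proj₂ (archimedean (α * x ^ 2)))))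

  1≤αA-eventually : ∀ {α} y → 0# < α → ∃[ n₀ ] 1 ℕ.≤ n₀ × (∀ n → n₀ ℕ.≤ n → y ≤ α * fromℕ (A n))
  1≤αA-eventually {α} y 0<α =
    let n₁ , p = archimedean (y / α) in
    suc n₁ , ℕ.s≤s ℕ.z≤n , λ n n₀≤n → ≤-trans (<⇒≤ (<-respˡ (/-*-cancel 0<α) (<-respˡ (*-comm _ _) (*-monoʳ-< 0<α p))))
      (*-monoʳ-≤ (<⇒≤ 0<α) (fromℕ-mono-≤ {n₁} {A n} (ℕ.≤-trans (ℕ.n≤1+n n₁) (ℕ.≤-trans n₀≤n (ℕ.<⇒≤ (n<A n))))))

  -- Stage k examines sixth (1 + k) solutions with arcs of precision 1 / (1 + k).
  sixth : ℕ → ℕ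
  sixth m = m ℕ.* (m ℕ.* (m ℕ.* (m ℕ.* (m ℕ.* m))))

  -- (1 + x)⁶ ≤ 1 + 63x on [0 , 1], taken at x = 1/(k + 1), with 63 = 2⁶ - 1. The polynomial in
  -- `lemma` is the exact difference and has nonnegative coefficients.
  sixth-suc : ∀ k → sixth (suc (suc k)) ℕ.* suc k ℕ.≤ sixth (suc k) ℕ.* (suc k ℕ.+ 63)
  sixth-suc k = ℕ.m+n≤o⇒m≤o _ (ℕ.≤-reflexive (lemma k))
    where
    lemma : ∀ k →
      (2 ℕ.+ k) ℕ.* ((2 ℕ.+ k) ℕ.* ((2 ℕ.+ k) ℕ.* ((2 ℕ.+ k) ℕ.* ((2 ℕ.+ k) ℕ.* (2 ℕ.+ k))))) ℕ.* (1 ℕ.+ k)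
        ℕ.+ k ℕ.* (129 ℕ.+ k ℕ.* (534 ℕ.+ k ℕ.* (895 ℕ.+ k ℕ.* (760 ℕ.+ k ℕ.* (327 ℕ.+ k ℕ.* 57))))) ≡
      (1 ℕ.+ k) ℕ.* ((1 ℕ.+ k) ℕ.* ((1 ℕ.+ k) ℕ.* ((1 ℕ.+ k) ℕ.* ((1 ℕ.+ k) ℕ.* (1 ℕ.+ k))))) ℕ.* ((1 ℕ.+ k) ℕ.+ 63)
    lemma = ℕ-Solver.solve-∀

  -- The condition `long` for the tolerance 4m², with 96 = 6 · 4².
  sixth-long : ∀ m → 6 ℕ.* (4 ℕ.* (m ℕ.* m) ℕ.* (4 ℕ.* (m ℕ.* m))) ℕ.* (m ℕ.* m) ℕ.≤ 96 ℕ.* sixth m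
  sixth-long m = ℕ.≤-reflexive (lemma m)
    where
    lemma : ∀ m → 6 ℕ.* (4 ℕ.* (m ℕ.* m) ℕ.* (4 ℕ.* (m ℕ.* m))) ℕ.* (m ℕ.* m) ≡
      96 ℕ.* (m ℕ.* (m ℕ.* (m ℕ.* (m ℕ.* (m ℕ.* m)))))
    lemma = ℕ-Solver.solve-∀

  fourth≤sixth : ∀ m .{{_ : NonZero m}} → m ℕ.* (m ℕ.* (m ℕ.* m)) ℕ.≤ sixth m
  fourth≤sixth m = ℕ.*-monoʳ-≤ m (ℕ.*-monoʳ-≤ m (ℕ.*-monoʳ-≤ m (ℕ.m≤m*n m (m ℕ.* m) {{ℕ.m*n≢0 m m}})))

  m≤fourth : ∀ m .{{_ : NonZero m}} → m ℕ.≤ m ℕ.* (m ℕ.* (m ℕ.* m))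
  m≤fourth m {{m≢0}} = ℕ.m≤m*n m (m ℕ.* (m ℕ.* m)) {{ℕ.m*n≢0 m (m ℕ.* m) {{m≢0}} {{ℕ.m*n≢0 m m}}}}

  sixth-nonZero : ∀ m .{{_ : NonZero m}} → NonZero (sixth m)
  sixth-nonZero m = ℕ.>-nonZero (ℕ.≤-trans (ℕ.>-nonZero⁻¹ m) (ℕ.≤-trans (m≤fourth m) (fourth≤sixth m)))

  good-triples : ∀ {α} N hit n₀ → 0# < α → (∀ n → hit n ℕ.≤ 1) →
    (∀ n → n₀ ℕ.≤ n → n ℕ.< N → hit n ≡ 1 → ∃ (GoodTriple α n)) →
    ∃[ ts ] Unique ts × (∀ {t} → t ∈ ts → ∃[ n ] n₀ ℕ.≤ n × n ℕ.< N × GoodTriple α n t) × ∑ℕ N hit ℕ.≤ length ts ℕ.+ n₀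
  good-triples {α} N hit n₀ 0<α hit≤1 = collect hit hit≤1 n₀ (GoodTriple α) (goodTriple-≢ 0<α) N

  hit-goodTriple : ∀ {α β} n M {p q r} .{{_ : NonZero M}} → 0# < α → 1 ℕ.≤ n → 1# ≤ α * fromℕ (A n) →
    fromℕ p ≤ β * fromℕ M → fromℕ r ≤ β * fromℕ M → β + β + α ≤ 1# →
    (q ℕ.< r → β * fromℕ M ≤ fromℕ q + α * fromℕ M) →
    RealArc α (A n) M 0 p → RealArc α (B n) M q r → ∃ (GoodTriple α n)
  hit-goodTriple {α} n M {p} {q} {r} 0<α 1≤n 1≤αA p≤ r≤ 2β+α≤1 q≥ (k , x-lower , x-upper) (l , y-lower , y-upper) =
    _ , goodTriple {α} {n} {k} {l} 0<α 1≤n 1≤αA (suitable M {p} {q} {r} {k} {l} p≤ r≤ 2β+α≤1 (q≥ q<r) x-lower x-upper y-lower y-upper)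
    where
    q<r : q ℕ.< r
    q<r = fromℕ-cancel-< {q} {r} (<-by
      (solve 3 (λ z q r → r :- q := (z :+ r) :- (z :+ q)) refl (fromℕ M * fromℕ l) (fromℕ q) (fromℕ r))
      (0<-diff (≤-<-trans y-lower y-upper)))

  -- With this value the loss 2M²N/h in the count is N/2. It stays below the main term N even when
  -- both arcs have the minimal length 1/M.
  h : ℕ → ℕ
  h m = 4 ℕ.* (m ℕ.* m)

  hits-simplified : ∀ m N w s .{{_ : NonZero m}} → h m ℕ.* (N ℕ.* w) ℕ.≤ h m ℕ.* (m ℕ.* m ℕ.* s) ℕ.+ 2 ℕ.* (m ℕ.* m) ℕ.* N →
    2 ℕ.* (N ℕ.* w) ℕ.≤ 2 ℕ.* (m ℕ.* m ℕ.* s) ℕ.+ N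
  hits-simplified m N w s {{m≢0}} p = ℕ.*-cancelˡ-≤ (2 ℕ.* (m ℕ.* m)) {{ℕ.m*n≢0 2 (m ℕ.* m) {{_}} {{ℕ.m*n≢0 m m {{m≢0}} {{m≢0}}}}}}
    (ℕ.≤-trans (ℕ.≤-reflexive (left′ m (N ℕ.* w))) (ℕ.≤-trans p (ℕ.≤-reflexive (right′ m (m ℕ.* m ℕ.* s) N))))
    where
    left′ : ∀ m x → 2 ℕ.* (m ℕ.* m) ℕ.* (2 ℕ.* x) ≡ 4 ℕ.* (m ℕ.* m) ℕ.* x
    left′ = ℕ-Solver.solve-∀
    right′ : ∀ m x n → 4 ℕ.* (m ℕ.* m) ℕ.* x ℕ.+ 2 ℕ.* (m ℕ.* m) ℕ.* n ≡ 2 ℕ.* (m ℕ.* m) ℕ.* (2 ℕ.* x ℕ.+ n)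
    right′ = ℕ-Solver.solve-∀

  module _ (N : ℕ → ℕ) (N≡ : ∀ k → N k ≡ sixth (suc k)) where

    N-nonZero : ∀ k → NonZero (N k)
    N-nonZero k = ≡.subst NonZero (≡.sym (N≡ k)) (sixth-nonZero (suc k))

    long : ∀ k → 6 ℕ.* (h (suc k) ℕ.* h (suc k)) ℕ.* (suc k ℕ.* suc k) ℕ.≤ 96 ℕ.* N k
    long k = ≡.subst (λ N → 6 ℕ.* (h (suc k) ℕ.* h (suc k)) ℕ.* (suc k ℕ.* suc k) ℕ.≤ 96 ℕ.* N) (≡.sym (N≡ k)) (sixth-long (suc k))

    -- The square [0 , 1/M)². For a fixed α in (0 , 1) it is admissible as soon as 1/M ≤ α and 2/M +
    -- α ≤ 1, hence from some stage on.
    module Unit = Equidistribution (λ _ → 1) (λ _ → 0) (λ _ → 1) N (λ k → h (suc k)) 96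
      (λ k → ℕ.s≤s ℕ.z≤n) (λ k → ℕ.z≤n) (λ k → ℕ.s≤s ℕ.z≤n) N-nonZero long

    -- The count gives N ≤ 2m²s, that is m⁴ ≤ 2s, so for 2n₀ < m some hit lies at or beyond `n₀`.
    unit-hits : ∀ m N s n₀ .{{_ : NonZero m}} → N ≡ sixth m → n₀ ℕ.+ n₀ ℕ.< m →
      h m ℕ.* (N ℕ.* (1 ℕ.* (1 ∸ 0))) ℕ.≤ h m ℕ.* (m ℕ.* m ℕ.* s) ℕ.+ 2 ℕ.* (m ℕ.* m) ℕ.* N → n₀ ℕ.< s
    unit-hits m N s n₀ {{m≢0}} ≡.refl n₀<m p = ℕ.*-cancelˡ-< 2 n₀ s (begin-strict
      n₀ ℕ.+ (n₀ ℕ.+ 0)               ≡⟨ ≡.cong (n₀ ℕ.+_) (ℕ.+-identityʳ n₀) ⟩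
      n₀ ℕ.+ n₀                       <⟨ n₀<m ⟩
      m                               ≤⟨ m≤fourth m ⟩
      m ℕ.* (m ℕ.* (m ℕ.* m))         ≤⟨ ℕ.*-cancelˡ-≤ (m ℕ.* m) {{ℕ.m*n≢0 m m {{m≢0}} {{m≢0}}}} (begin
        m ℕ.* m ℕ.* (m ℕ.* (m ℕ.* (m ℕ.* m)))   ≡⟨ ℕ.*-assoc m m _ ⟩
        sixth m                                 ≤⟨ ℕ.+-cancelʳ-≤ (sixth m) _ _ (begin
          sixth m ℕ.+ sixth m                   ≡⟨ double (sixth m) ⟩
          2 ℕ.* (sixth m ℕ.* 1)                 ≤⟨ hits-simplified m (sixth m) 1 s p ⟩
          2 ℕ.* (m ℕ.* m ℕ.* s) ℕ.+ sixth m     ∎) ⟩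
        2 ℕ.* (m ℕ.* m ℕ.* s)                   ≡⟨ swap (m ℕ.* m) s ⟩
        m ℕ.* m ℕ.* (2 ℕ.* s)                   ∎) ⟩
      2 ℕ.* s                         ∎)
      where
      open ℕ.≤-Reasoning
      double : ∀ x → x ℕ.+ x ≡ 2 ℕ.* (x ℕ.* 1)
      double = ℕ-Solver.solve-∀
      swap : ∀ x y → 2 ℕ.* (x ℕ.* y) ≡ x ℕ.* (2 ℕ.* y)
      swap = ℕ-Solver.solve-∀

    max-first : ∀ (ts : List Triple) → ∃[ bound ] (∀ {t} → t ∈ ts → proj₁ t ℕ.≤ bound)
    max-first []       = 0 , λ ()
    max-first (t ∷ ts) = let m , p = max-first ts in
      proj₁ t ℕ.⊔ m , λ { (here ≡.refl) → ℕ.m≤m⊔n _ m ; (there t∈ts) → ℕ.≤-trans (p t∈ts) (ℕ.m≤n⊔m (proj₁ t) m) }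

    regular⇒infinite : ∀ {α} → 0# < α → α < 1# → Unit.Regular α → Infinite (T (S α))
    regular⇒infinite {α} 0<α α<1 (K , regular) (ts , T⊆ts) = absurd (1≤αA-eventually (1# + fromℕ bound) 0<α)
      (archimedean (1# / α)) (archimedean (fromℕ 2 / (1# - α)))
      where
      bound : ℕ
      bound = proj₁ (max-first ts)
      absurd : (∃[ n₀ ] 1 ℕ.≤ n₀ × (∀ n → n₀ ℕ.≤ n → 1# + fromℕ bound ≤ α * fromℕ (A n))) →
        ∃[ k₁ ] 1# / α < fromℕ k₁ → ∃[ k₂ ] fromℕ 2 / (1# - α) < fromℕ k₂ → ⊥
      absurd (n₀ , 1≤n₀ , large) (k₁ , 1/α<k₁) (k₂ , 2/[1-α]<k₂) =
        contradiction (regular k K≤k)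
        where
        -- The stage is late enough for regularity (`K`), for 1/M ≤ α (`k₁`), for 2/M + α ≤ 1
        -- (`k₂`), and for a hit where αA exceeds all first entries of the list (`n₀`).
        k M : ℕ
        k = K ℕ.+ (k₁ ℕ.+ (k₂ ℕ.+ (n₀ ℕ.+ n₀)))
        M = suc k
        K≤k : K ℕ.≤ k
        K≤k = ℕ.m≤m+n K _
        k₁≤M : k₁ ℕ.≤ M
        k₁≤M = ℕ.m≤n⇒m≤1+n (ℕ.≤-trans (ℕ.m≤m+n k₁ _) (ℕ.m≤n+m _ K))
        k₂≤M : k₂ ℕ.≤ M
        k₂≤M = ℕ.m≤n⇒m≤1+n (ℕ.≤-trans (ℕ.≤-trans (ℕ.m≤m+n k₂ _) (ℕ.m≤n+m _ k₁)) (ℕ.m≤n+m _ K))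
        n₀+n₀<M : n₀ ℕ.+ n₀ ℕ.< M
        n₀+n₀<M = ℕ.s≤s (ℕ.≤-trans (ℕ.≤-trans (ℕ.m≤n+m _ k₂) (ℕ.m≤n+m _ k₁)) (ℕ.m≤n+m _ K))
        β : Carrier
        β = 1# / fromℕ M
        βM : β * fromℕ M ≈ 1#
        βM = /-*-cancel (0<fromℕ M)
        1≤αM : 1# ≤ α * fromℕ M
        1≤αM = ≤-respˡ (/-*-cancel 0<α) (≤-respˡ (*-comm _ _) (*-monoʳ-≤ (<⇒≤ 0<α)
          (≤-trans (<⇒≤ 1/α<k₁) (fromℕ-mono-≤ {k₁} {M} k₁≤M))))
        2≤[1-α]M : fromℕ 2 ≤ (1# - α) * fromℕ M
        2≤[1-α]M = ≤-respˡ (/-*-cancel (0<-diff α<1)) (≤-respˡ (*-comm _ _) (*-monoʳ-≤ (0≤-diff (<⇒≤ α<1))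
          (≤-trans (<⇒≤ 2/[1-α]<k₂) (fromℕ-mono-≤ {k₂} {M} k₂≤M))))
        2β+α≤1 : β + β + α ≤ 1#
        2β+α≤1 = *-cancelʳ-≤ (0<fromℕ M) (≤-by
          (trans (solve 3 (λ α β m → κ 1 :* m :- (β :+ β :+ α) :* m := ((κ 1 :- α) :* m :- κ 2) :+ (κ 0 :- κ 2) :* (β :* m :- κ 1)) refl α β (fromℕ M))
            (cancel-zero βM))
          (0≤-diff 2≤[1-α]M))
        1≤βM : fromℕ 1 ≤ β * fromℕ M
        1≤βM = ≈⇒≤ (trans fromℕ-1 (sym βM))
        contradiction : ∃ (Unit.Hits α k) → ⊥
        contradiction (hit , hit≤1 , arcs , many) = nonempty (good-triples (N k) hit n₀ 0<α hit≤1 found)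
          where
          found : ∀ n → n₀ ℕ.≤ n → n ℕ.< N k → hit n ≡ 1 → ∃ (GoodTriple α n)
          found n n₀≤n n<N hit≡1 = hit-goodTriple n M {1} {0} {1} 0<α (ℕ.≤-trans 1≤n₀ n₀≤n)
            (≤-trans (≤-by (solve 1 (λ z → (κ 1 :+ z) :- κ 1 := z) refl (fromℕ bound)) (0≤fromℕ bound)) (large n n₀≤n))
            1≤βM 1≤βM 2β+α≤1 (λ _ → ≤-respʳ (sym (+-identityˡ _)) (≤-respˡ (sym βM) 1≤αM))
            (proj₁ (arcs n n<N hit≡1)) (proj₂ (arcs n n<N hit≡1))
          n₀<∑ : n₀ ℕ.< ∑ℕ (N k) hit
          n₀<∑ = unit-hits M (N k) (∑ℕ (N k) hit) n₀ (N≡ k) n₀+n₀<M many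
          nonempty : (∃[ ts ] Unique ts × (∀ {t} → t ∈ ts → ∃[ n ] n₀ ℕ.≤ n × n ℕ.< N k × GoodTriple α n t) × ∑ℕ (N k) hit ℕ.≤ length ts ℕ.+ n₀) → ⊥
          nonempty ([] , _ , _ , short) = ℕ.<⇒≱ n₀<∑ short
          nonempty (t ∷ _ , _ , good , _) with n , n₀≤n , _ , G ← good (here ≡.refl) =
            ℕ.<⇒≱ (fromℕ-≤-<suc {suc bound} {GoodTriple.k G} (≤-<-trans (large n n₀≤n) (GoodTriple.αA<k+1 G)))
              (proj₂ (max-first ts) (T⊆ts _ (GoodTriple.inT G)))

    almost-all-infinite : ForAlmostAll∈⟨ 0# , 1# ⟩ (λ α → Infinite (T (S α)))
    almost-all-infinite = Null-⊆ (λ α (0<α , α<1 , finite) → 0<α , α<1 , λ regular → finite (regular⇒infinite 0<α α<1 regular))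
      Unit.almost-all-regular

-- The explicit lower bound

module LowerBound (em : ExcludedMiddle 0ℓ) (R : CompleteOrderedField) where

  open Counting em R public
  open Min (DecTotalOrder.totalOrder decTotalOrder) using (x⊓y≤x; x⊓y≤y; ⊓-sel)

  -- Of the 5, rounding p and w uses 3, the solutions discarded before n₀ use 1, the tolerated
  -- deviation at most 1/2, and the rest is slack.
  rectangle-count : ∀ {β γ N M p w s c n₀} → 0# ≤ N → 1# ≤ M → M * M * M ≤ N * M → β ≤ 1# → 0# ≤ β → 0# ≤ w → w ≤ M →
    β * M - 1# ≤ p → γ * M - fromℕ 2 ≤ w → n₀ ≤ M → s ≤ c + n₀ →
    fromℕ 2 * (N * (p * w)) ≤ fromℕ 2 * (M * M * s) + N →
    N * (β * γ * M - fromℕ 5) ≤ c * M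
  rectangle-count {β} {γ} {N} {M} {p} {w} {s} {c} {n₀} 0≤N 1≤M M³≤NM β≤1 0≤β 0≤w w≤M p≥ w≥ n₀≤M s≤ hits =
    *-cancelʳ-≤ {fromℕ 2 * M} (*-pos (0<fromℕ 2) 0<M) (≤-by
      (solve 9 (λ β γ N M p w s c n → c :* M :* (κ 2 :* M) :- N :* (β :* γ :* M :- κ 5) :* (κ 2 :* M) :=
          (((κ 2 :* (M :* M :* s) :+ N) :- κ 2 :* (N :* (p :* w)))
            :+ κ 2 :* (M :* M) :* ((c :+ n) :- s)
            :+ κ 2 :* (M :* M) :* (M :- n)
            :+ κ 2 :* N :* (w :* (p :- (β :* M :- κ 1))))
          :+ (κ 2 :* N :* ((M :- w) :+ β :* M :* (w :- (γ :* M :- κ 2)) :+ (κ 2 :* M) :* (κ 1 :- β))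
            :+ κ 2 :* (N :* M :- M :* M :* M)
            :+ N :* (M :- κ 1)
            :+ N :* M)) refl β γ N M p w s c n₀)
      (0≤+
        (0≤+ (0≤+ (0≤+ (0≤-diff hits)
          (0≤* (0≤* 0≤2 (0≤* 0≤M 0≤M)) (0≤-diff s≤)))
          (0≤* (0≤* 0≤2 (0≤* 0≤M 0≤M)) (0≤-diff n₀≤M)))
          (0≤* (0≤* 0≤2 0≤N) (0≤* 0≤w (0≤-diff p≥))))
        (0≤+ (0≤+ (0≤+
          (0≤* (0≤* 0≤2 0≤N) (0≤+ (0≤+ (0≤-diff w≤M) (0≤* (0≤* 0≤β 0≤M) (0≤-diff w≥))) (0≤* (0≤* 0≤2 0≤M) (0≤-diff β≤1))))
          (0≤* 0≤2 (0≤-diff M³≤NM)))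
          (0≤* 0≤N (0≤-diff 1≤M)))
          (0≤* 0≤N 0≤M))))
    where
    0≤2 : 0# ≤ fromℕ 2
    0≤2 = 0≤fromℕ 2
    0<M : 0# < M
    0<M = <-≤-trans 0#<1# 1≤M
    0≤M : 0# ≤ M
    0≤M = <⇒≤ 0<M

  -- Two errors must fit into ε: the 5 of the rectangle count and the gap F between consecutive
  -- lengths. Both are bounded, whereas the gain MDε grows with M.
  final-bound : ∀ {P m D ℓ L ε c N N′ M F} → P * m ≈ fromℕ 4 * D → ℓ ≤ fromℕ 4 * N′ * L → N′ * M ≤ N * (M + F) →
    N * (D * M - fromℕ 5) ≤ c * M → fromℕ 16 * D * L * F + fromℕ 5 * (fromℕ 16 * L + ε) ≤ M * (D * ε) →
    0# ≤ D → 0# ≤ L → 0# ≤ N → 0# < M → 0# < ε →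
    P * m * (ℓ / (fromℕ 16 * L + ε)) ≤ c
  final-bound {P} {m} {D} {ℓ} {L} {ε} {c} {N} {N′} {M} {F} Pm≈4D ℓ≤ N′M≤ N≤cM large 0≤D 0≤L 0≤N 0<M 0<ε =
    ≤-respˡ (*-assoc _ _ _) (/-≤ 0<W (*-cancelʳ-≤ 0<M (≤-by
      (trans (solve 10 (λ Pm D ℓ L ε c N N′ M F → c :* (κ 16 :* L :+ ε) :* M :- Pm :* ℓ :* M :=
            ((((c :* M :- N :* (D :* M :- κ 5)) :* (κ 16 :* L :+ ε)
              :+ N :* (M :* (D :* ε) :- (κ 16 :* D :* L :* F :+ κ 5 :* (κ 16 :* L :+ ε))))
              :+ κ 16 :* (D :* L) :* (N :* (M :+ F) :- N′ :* M))
              :+ κ 4 :* (D :* M) :* (κ 4 :* N′ :* L :- ℓ))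
            :+ (κ 0 :- ℓ :* M) :* (Pm :- κ 4 :* D)) refl (P * m) D ℓ L ε c N N′ M F)
        (cancel-zero Pm≈4D))
      (0≤+ (0≤+ (0≤+
        (0≤* (0≤-diff N≤cM) (<⇒≤ 0<W))
        (0≤* 0≤N (0≤-diff large)))
        (0≤* (0≤* (0≤fromℕ 16) (0≤* 0≤D 0≤L)) (0≤-diff N′M≤)))
        (0≤* (0≤* (0≤fromℕ 4) (0≤* 0≤D (<⇒≤ 0<M))) (0≤-diff ℓ≤))))))
    where
    0<W : 0# < fromℕ 16 * L + ε
    0<W = <-respʳ (+-comm _ _) (0<+ 0<ε (0≤* (0≤fromℕ 16) 0≤L))

  module Interval (s t : Carrier) (0<s : 0# < s) (s<t : s < t) (t<1 : t < 1#)
    (N : ℕ → ℕ) (N≡ : ∀ k → N k ≡ sixth (suc k)) where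

    -- `γ` = min(β , s), so [β - γ , β) is the range of w in the overview and `D` is the area of the
    -- rectangle.
    P₁ P₂ β γ D : Carrier
    P₁ = 1# - t
    P₂ = P₁ ⊓ (fromℕ 2 * s)
    β = P₁ / fromℕ 2
    γ = P₂ / fromℕ 2
    D = β * γ

    β2 : β * fromℕ 2 ≈ P₁
    β2 = /-*-cancel (0<fromℕ 2)

    γ2 : γ * fromℕ 2 ≈ P₂
    γ2 = /-*-cancel (0<fromℕ 2)

    0<P₁ : 0# < P₁
    0<P₁ = 0<-diff t<1

    0<P₂ : 0# < P₂
    0<P₂ = [ (λ e → <-respʳ (sym e) 0<P₁) , (λ e → <-respʳ (sym e) (*-pos (0<fromℕ 2) 0<s)) ]′ (⊓-sel P₁ (fromℕ 2 * s))

    0<β : 0# < β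
    0<β = 0</ 0<P₁ (0<fromℕ 2)

    0<γ : 0# < γ
    0<γ = 0</ 0<P₂ (0<fromℕ 2)

    γ≤β : γ ≤ β
    γ≤β = *-monoˡ-≤ (<⇒≤ (0<⁻¹ (0<fromℕ 2))) (x⊓y≤x P₁ (fromℕ 2 * s))

    γ≤s : γ ≤ s
    γ≤s = /-≤ (0<fromℕ 2) (≤-respʳ (*-comm _ _) (x⊓y≤y P₁ (fromℕ 2 * s)))

    β+β+t≈1 : β + β + t ≈ 1#
    β+β+t≈1 = trans (solve 2 (λ β t → β :+ β :+ t := β :* κ 2 :+ t) refl β t)
      (trans (+-congʳ β2) (solve 1 (λ t → (κ 1 :- t) :+ t := κ 1) refl t))

    0<t : 0# < t
    0<t = <-trans 0<s s<t

    β≤1 : β ≤ 1#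
    β≤1 = ≤-respʳ β+β+t≈1 (≤-by (solve 2 (λ β t → (β :+ β :+ t) :- β := β :+ t) refl β t) (0≤+ (<⇒≤ 0<β) (<⇒≤ 0<t)))

    floor-β : ∀ k → ∃[ x ] fromℕ x ≤ β * fromℕ (suc k) × β * fromℕ (suc k) < fromℕ x + 1#
    floor-β k = floor (0≤* (<⇒≤ 0<β) (0≤fromℕ (suc k)))

    floor-γ : ∀ k → ∃[ x ] fromℕ x ≤ γ * fromℕ (suc k) × γ * fromℕ (suc k) < fromℕ x + 1#
    floor-γ k = floor (0≤* (<⇒≤ 0<γ) (0≤fromℕ (suc k)))

    -- Rounding `p` down may lower both ends of the second arc by up to one unit. Shortening the arc
    -- by one, through `pred`, keeps its lower end above (β - γ)M.
    p z w q : ℕ → ℕ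
    p k = proj₁ (floor-β k)
    z k = proj₁ (floor-γ k)
    w k = ℕ.pred (z k)
    q k = p k ∸ w k

    p≤βM : ∀ k → fromℕ (p k) ≤ β * fromℕ (suc k)
    p≤βM k = proj₁ (proj₂ (floor-β k))

    βM<p+1 : ∀ k → β * fromℕ (suc k) < fromℕ (p k) + 1#
    βM<p+1 k = proj₂ (proj₂ (floor-β k))

    γM<z+1 : ∀ k → γ * fromℕ (suc k) < fromℕ (z k) + 1#
    γM<z+1 k = proj₂ (proj₂ (floor-γ k))

    p≤M : ∀ k → p k ℕ.≤ suc k
    p≤M k = fromℕ-cancel-≤ {p k} {suc k} (≤-trans (p≤βM k) (≤-respʳ (*-identityˡ _) (*-monoˡ-≤ (0≤fromℕ (suc k)) β≤1)))

    z≤p : ∀ k → z k ℕ.≤ p k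
    z≤p k = fromℕ-≤-<suc {z k} {p k} (≤-<-trans (proj₁ (proj₂ (floor-γ k)))
      (≤-<-trans (*-monoˡ-≤ (0≤fromℕ (suc k)) γ≤β) (βM<p+1 k)))

    w≤p : ∀ k → w k ℕ.≤ p k
    w≤p k = ℕ.≤-trans ℕ.pred[n]≤n (z≤p k)

    module Stages = Equidistribution p q p N (λ k → h (suc k)) 96 p≤M (λ k → ℕ.m∸n≤m (p k) (w k)) p≤M
      (N-nonZero N N≡) (long N N≡)

    -- A nonempty second arc means z ≥ 2, hence q = p - z + 1 with p > βM - 1 and z ≤ γM ≤ sM.
    second-arc : ∀ {α} k → s < α → q k ℕ.< p k → β * fromℕ (suc k) ≤ fromℕ (q k) + α * fromℕ (suc k)
    second-arc {α} k s<α q<p = ≤-by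
      (trans (solve 7 (λ β γ α m p q z → (q :+ α :* m) :- β :* m :=
          ((p :+ κ 1) :- β :* m) :+ ((γ :* m :- z) :+ (α :- γ) :* m) :+ κ 1 :* ((q :+ z) :- (p :+ κ 1))) refl
          β γ α (fromℕ (suc k)) (fromℕ (p k)) (fromℕ (q k)) (fromℕ (z k)))
        (cancel-zero (trans (sym (fromℕ-+ (q k) (z k))) (trans (reflexive (≡.cong fromℕ (q+z (z k) ≡.refl))) (+-comm _ _)))))
      (0≤+ (0≤-diff (<⇒≤ (βM<p+1 k))) (0≤+ (0≤-diff (proj₁ (proj₂ (floor-γ k))))
        (0≤* (0≤-diff (≤-trans γ≤s (<⇒≤ s<α))) (0≤fromℕ (suc k)))))
      where
      q+z : ∀ y → z k ≡ y → q k ℕ.+ z k ≡ suc (p k)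
      q+z zero    eq = ⊥-elim (ℕ.<⇒≱ q<p (ℕ.≤-reflexive (≡.sym (≡.cong (λ z → p k ∸ ℕ.pred z) eq))))
      q+z (suc y) eq = ≡.trans (≡.cong (q k ℕ.+_) (≡.trans eq (≡.cong suc (≡.sym (≡.cong ℕ.pred eq)))))
        (≡.trans (ℕ.+-suc (q k) (w k)) (≡.cong suc (ℕ.m∸n+n≡m (w≤p k))))

    γM-2≤w : ∀ k → γ * fromℕ (suc k) - fromℕ 2 ≤ fromℕ (w k)
    γM-2≤w k = ≤-by (solve 2 (λ w y → w :- (y :- κ 2) := (w :+ κ 1) :+ κ 1 :- y) refl (fromℕ (w k)) (γ * fromℕ (suc k)))
      (0≤-diff (<⇒≤ (<-≤-trans (γM<z+1 k) (+-mono-≤ (≤-respʳ (+-comm _ _) (fromℕ-mono-≤ {z k} {suc (w k)} (pred-lemma (z k)))) ≤-refl))))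
      where
      pred-lemma : ∀ z → z ℕ.≤ suc (ℕ.pred z)
      pred-lemma zero    = ℕ.z≤n
      pred-lemma (suc z) = ℕ.≤-refl

    module _ {α : Carrier} (s<α : s < α) (α<t : α < t) where

      0<α : 0# < α
      0<α = <-trans 0<s s<α

      2β+α≤1 : β + β + α ≤ 1#
      2β+α≤1 = ≤-respʳ β+β+t≈1 (+-mono-≤ ≤-refl (<⇒≤ α<t))

      stage-count : ∀ {x} k n₀ → 1 ℕ.≤ n₀ → (∀ n → n₀ ℕ.≤ n → 1# ≤ α * fromℕ (A n)) → n₀ ℕ.≤ suc k →
        ∃ (Stages.Hits α k) → Λ ^ (4 ℕ.* N k) ≤ fromℕ 16 * x →
        ∃[ c ] HasCardinality (T≤ x α) c × fromℕ (N k) * (D * fromℕ (suc k) - fromℕ 5) ≤ fromℕ c * fromℕ (suc k)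
      stage-count {x} k n₀ 1≤n₀ large n₀≤M (hit , hit≤1 , arcs , many) Λ≤16x =
        conclude (good-triples (N k) hit n₀ 0<α hit≤1 found) (T≤-cardinality x 0<α)
        where
        found : ∀ n → n₀ ℕ.≤ n → n ℕ.< N k → hit n ≡ 1 → ∃ (GoodTriple α n)
        found n n₀≤n n<N hit≡1 = hit-goodTriple n (suc k) {p k} {q k} {p k} 0<α (ℕ.≤-trans 1≤n₀ n₀≤n) (large n n₀≤n)
          (p≤βM k) (p≤βM k) 2β+α≤1 (second-arc k s<α) (proj₁ (arcs n n<N hit≡1)) (proj₂ (arcs n n<N hit≡1))
        conclude :
          (∃[ ts ] Unique ts × (∀ {t} → t ∈ ts → ∃[ n ] n₀ ℕ.≤ n × n ℕ.< N k × GoodTriple α n t) × ∑ℕ (N k) hit ℕ.≤ length ts ℕ.+ n₀) →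
          (∃[ c ] HasCardinality (T≤ x α) c × (∀ ys → Unique ys → (∀ {t} → t ∈ ys → T≤ x α t) → length ys ℕ.≤ c)) →
          ∃[ c ] HasCardinality (T≤ x α) c × fromℕ (N k) * (D * fromℕ (suc k) - fromℕ 5) ≤ fromℕ c * fromℕ (suc k)
        conclude (ts , unique , good , ∑≤) (c , card , longest) = c , card , rectangle-count {β} {γ}
          (0≤fromℕ (N k)) (≤-by (solve 1 (λ k → (κ 1 :+ k) :- κ 1 := k) refl (fromℕ k)) (0≤fromℕ k)) M³≤NM
          β≤1 (<⇒≤ 0<β) (0≤fromℕ (w k)) (fromℕ-mono-≤ {w k} {suc k} (ℕ.≤-trans (w≤p k) (p≤M k)))
          (≤-by (solve 2 (λ p y → p :- (y :- κ 1) := (p :+ κ 1) :- y) refl (fromℕ (p k)) (β * fromℕ (suc k))) (0≤-diff (<⇒≤ (βM<p+1 k))))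
          (γM-2≤w k) (fromℕ-mono-≤ {n₀} {suc k} n₀≤M)
          (≤-respʳ (fromℕ-+ c n₀) (fromℕ-mono-≤ {∑ℕ (N k) hit} {c ℕ.+ n₀}
            (ℕ.≤-trans ∑≤ (ℕ.+-monoˡ-≤ n₀ (longest ts unique (λ t∈ts →
              let n , _ , n<N , G = good t∈ts in goodTriple-T≤ G (e≤ n<N Λ≤16x)))))))
          (≤-respˡ cast₁ (≤-respʳ cast₂ (fromℕ-mono-≤ {2 ℕ.* (N k ℕ.* (p k ℕ.* w k))} simplified)))
          where
          simplified : 2 ℕ.* (N k ℕ.* (p k ℕ.* w k)) ℕ.≤ 2 ℕ.* (suc k ℕ.* suc k ℕ.* ∑ℕ (N k) hit) ℕ.+ N k
          simplified = hits-simplified (suc k) (N k) (p k ℕ.* w k) (∑ℕ (N k) hit)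
            (≡.subst (λ y → h (suc k) ℕ.* (N k ℕ.* (p k ℕ.* y)) ℕ.≤ h (suc k) ℕ.* (suc k ℕ.* suc k ℕ.* ∑ℕ (N k) hit) ℕ.+ 2 ℕ.* (suc k ℕ.* suc k) ℕ.* N k)
              (ℕ.m∸[m∸n]≡n (w≤p k)) many)
          cast₁ : fromℕ (2 ℕ.* (N k ℕ.* (p k ℕ.* w k))) ≈ fromℕ 2 * (fromℕ (N k) * (fromℕ (p k) * fromℕ (w k)))
          cast₁ = trans (fromℕ-* 2 (N k ℕ.* (p k ℕ.* w k))) (*-congˡ (trans (fromℕ-* (N k) (p k ℕ.* w k)) (*-congˡ (fromℕ-* (p k) (w k)))))
          cast₂ : fromℕ (2 ℕ.* (suc k ℕ.* suc k ℕ.* ∑ℕ (N k) hit) ℕ.+ N k) ≈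
                  fromℕ 2 * (fromℕ (suc k) * fromℕ (suc k) * fromℕ (∑ℕ (N k) hit)) + fromℕ (N k)
          cast₂ = trans (fromℕ-+ (2 ℕ.* (suc k ℕ.* suc k ℕ.* ∑ℕ (N k) hit)) (N k)) (+-congʳ
            (trans (fromℕ-* 2 (suc k ℕ.* suc k ℕ.* ∑ℕ (N k) hit)) (*-congˡ
              (trans (fromℕ-* (suc k ℕ.* suc k) (∑ℕ (N k) hit)) (*-congʳ (fromℕ-* (suc k) (suc k)))))))
          M³≤NM : fromℕ (suc k) * fromℕ (suc k) * fromℕ (suc k) ≤ fromℕ (N k) * fromℕ (suc k)
          M³≤NM = *-monoˡ-≤ (0≤fromℕ (suc k)) (≤-respˡ (fromℕ-* (suc k) (suc k))
            (fromℕ-mono-≤ {suc k ℕ.* suc k} {N k} (square≤ (N k) (suc k) (N≡ k))))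
            where
            square≤ : ∀ N m .{{_ : NonZero m}} → N ≡ sixth m → m ℕ.* m ℕ.≤ N
            square≤ N m {{m≢0}} ≡.refl = ℕ.*-monoʳ-≤ m (ℕ.m≤m*n m (m ℕ.* (m ℕ.* (m ℕ.* m)))
              {{ℕ.m*n≢0 m (m ℕ.* (m ℕ.* m)) {{m≢0}} {{ℕ.m*n≢0 m (m ℕ.* m) {{m≢0}} {{ℕ.m*n≢0 m m {{m≢0}} {{m≢0}}}}}}}})

      Bound : Pred Carrier 0ℓ
      Bound ε = ∃[ x₀ ] 1# < x₀ × (∀ x → x₀ ≤ x → ∃[ c ] HasCardinality (T≤ x α) c ×
        P₁ * P₂ * (log (fromℕ 16 * x) / (fromℕ 16 * log Λ + ε)) ≤ fromℕ c)

      -- For 16x between `f k` and `f (suc k)` the triples are counted at stage k, while the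
      -- logarithm is bounded by stage k + 1.
      regular⇒bound : Stages.Regular α → ∀ ε → 0# < ε → Bound ε
      regular⇒bound (K , regular) ε 0<ε = from-thresholds (1≤αA-eventually 1# 0<α) (archimedean (W / (D * ε)))
        where
        L W : Carrier
        L = log Λ
        -- The total error in `final-bound` with F = 63; `k₁` is the stage from which MDε exceeds
        -- it.
        W = fromℕ 16 * D * L * fromℕ 63 + fromℕ 5 * (fromℕ 16 * L + ε)
        0<Dε : 0# < D * ε
        0<Dε = *-pos (*-pos 0<β 0<γ) 0<ε
        f : ℕ → Carrier
        f k = Λ ^ (4 ℕ.* N k)
        k≤4N : ∀ k → k ℕ.≤ 4 ℕ.* N k
        k≤4N k = ℕ.≤-trans (ℕ.n≤1+n k) (ℕ.≤-trans (k+1≤ (N k) (N≡ k)) (ℕ.m≤n*m (N k) 4))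
          where
          k+1≤ : ∀ N → N ≡ sixth (suc k) → suc k ℕ.≤ N
          k+1≤ N ≡.refl = ℕ.≤-trans (m≤fourth (suc k)) (fourth≤sixth (suc k))
        from-thresholds : (∃[ n₀ ] 1 ℕ.≤ n₀ × (∀ n → n₀ ℕ.≤ n → 1# ≤ α * fromℕ (A n))) →
          ∃[ k₁ ] W / (D * ε) < fromℕ k₁ → Bound ε
        from-thresholds (n₀ , 1≤n₀ , large) (k₁ , W<k₁) = 1# + f k₀ ,
          <-by (solve 1 (λ y → (κ 1 :+ y) :- κ 1 := y) refl (f k₀)) (<-≤-trans 0#<1# (1≤^ (4 ℕ.* N k₀) (<⇒≤ 1<Λ))) ,
          λ x x₀≤x → at x x₀≤x (^-unbounded 1<Λ (fromℕ 16 * x))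
          where
          k₀ : ℕ
          k₀ = K ℕ.+ (n₀ ℕ.+ k₁)
          at : ∀ x → 1# + f k₀ ≤ x → ∃[ j ] fromℕ 16 * x < Λ ^ j → ∃[ c ] HasCardinality (T≤ x α) c ×
            P₁ * P₂ * (log (fromℕ 16 * x) / (fromℕ 16 * L + ε)) ≤ fromℕ c
          at x x₀≤x (j , 16x<Λʲ) = between (crossing f (fromℕ 16 * x) k₀ j start
              (<-≤-trans 16x<Λʲ (^-monoʳ-≤ (<⇒≤ 1<Λ) (ℕ.≤-trans (ℕ.m≤m+n j k₀) (k≤4N (j ℕ.+ k₀))))))
            where
            start : f k₀ ≤ fromℕ 16 * x
            start = ≤-by (solve 2 (λ x y → κ 16 :* x :- y := (x :- (κ 1 :+ y)) :+ (κ 15 :* x :+ κ 1)) refl x (f k₀))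
              (0≤+ (0≤-diff x₀≤x) (0≤+ (0≤* (0≤fromℕ 15) (≤-trans (0≤+ 0≤1 (0≤^ (4 ℕ.* N k₀) (<⇒≤ (<-trans 0#<1# 1<Λ)))) x₀≤x)) 0≤1))
            between : ∃[ k ] k₀ ℕ.≤ k × f k ≤ fromℕ 16 * x × fromℕ 16 * x < f (suc k) → ∃[ c ] HasCardinality (T≤ x α) c ×
              P₁ * P₂ * (log (fromℕ 16 * x) / (fromℕ 16 * L + ε)) ≤ fromℕ c
            between (k , k₀≤k , fk≤16x , 16x<f[k+1]) =
              let c , card , many = stage-count k n₀ 1≤n₀ large
                    (ℕ.m≤n⇒m≤1+n (ℕ.≤-trans (ℕ.≤-trans (ℕ.m≤m+n n₀ k₁) (ℕ.m≤n+m _ K)) k₀≤k))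
                    (regular k (ℕ.≤-trans (ℕ.m≤m+n K _) k₀≤k)) fk≤16x
              in c , card , final-bound {D = D} {N = fromℕ (N k)} {N′ = fromℕ (N (suc k))} {M = fromℕ (suc k)} {F = fromℕ 63}
                P₁P₂≈4D log≤ N′M≤ many W≤
                (<⇒≤ (*-pos 0<β 0<γ)) (<⇒≤ (0<log 1<Λ)) (0≤fromℕ (N k)) (0<fromℕ (suc k)) 0<ε
              where
              P₁P₂≈4D : P₁ * P₂ ≈ fromℕ 4 * D
              P₁P₂≈4D = trans (*-cong (sym β2) (sym γ2))
                (solve 2 (λ β γ → β :* κ 2 :* (γ :* κ 2) := κ 4 :* (β :* γ)) refl β γ)
              log≤ : log (fromℕ 16 * x) ≤ fromℕ 4 * fromℕ (N (suc k)) * L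
              log≤ = ≤-respʳ (*-congʳ (fromℕ-* 4 (N (suc k)))) (log-≤ (4 ℕ.* N (suc k)) 1<Λ 16x<f[k+1])
              N′M≤ : fromℕ (N (suc k)) * fromℕ (suc k) ≤ fromℕ (N k) * (fromℕ (suc k) + fromℕ 63)
              N′M≤ = ≤-respˡ (fromℕ-* (N (suc k)) (suc k)) (≤-respʳ
                (trans (fromℕ-* (N k) (suc k ℕ.+ 63)) (*-congˡ (fromℕ-+ (suc k) 63)))
                (fromℕ-mono-≤ {N (suc k) ℕ.* suc k} {N k ℕ.* (suc k ℕ.+ 63)}
                  (≡.subst₂ (λ a b → a ℕ.* suc k ℕ.≤ b ℕ.* (suc k ℕ.+ 63)) (≡.sym (N≡ (suc k))) (≡.sym (N≡ k)) (sixth-suc k))))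
              W≤ : W ≤ fromℕ (suc k) * (D * ε)
              W≤ = ≤-respˡ (/-*-cancel 0<Dε) (*-monoˡ-≤ (<⇒≤ 0<Dε) (≤-trans (<⇒≤ W<k₁) (fromℕ-mono-≤ {k₁} {suc k}
                (ℕ.m≤n⇒m≤1+n (ℕ.≤-trans (ℕ.≤-trans (ℕ.m≤n+m k₁ n₀) (ℕ.m≤n+m _ K)) k₀≤k)))))

    almost-all-bound : ForAlmostAll∈⟨ s , t ⟩ (λ α → ∀ ε → 0# < ε →
      ∃[ x₀ ] 1# < x₀ × (∀ x → x₀ ≤ x → ∃[ c ] HasCardinality (T≤ x α) c ×
        P₁ * P₂ * (log (fromℕ 16 * x) / (fromℕ 16 * log Λ + ε)) ≤ fromℕ c))
    almost-all-bound = Null-⊆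
      (λ α (s<α , α<t , ¬bound) → <-trans 0<s s<α , <-trans α<t t<1 , λ regular → ¬bound (regular⇒bound s<α α<t regular))
      Stages.almost-all-regular

theorem1p4 : (em : ExcludedMiddle 0ℓ) (R : CompleteOrderedField) →
    let open Analysis em R in
    (∀ s t → 0# < s → s < t → t < 1# →
    ForAlmostAll∈⟨ s , t ⟩ (λ α →
    ∀ ε → 0# < ε →
    ∃[ x₀ ] 1# < x₀ × (∀ x → x₀ ≤ x →
    ∃[ c ] HasCardinality (T≤ x α) c ×
    (1# - t) * ((1# - t) ⊓ (fromℕ 2 * s))
    * (log (fromℕ 16 * x) / (fromℕ 16 * log (1# + √ (fromℕ 2)) + ε))
    ≤ fromℕ c)))
    × ForAlmostAll∈⟨ 0# , 1# ⟩ (λ α → Infinite (T (S α)))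
theorem1p4 em R =
  (λ s t 0<s s<t t<1 → Interval.almost-all-bound s t 0<s s<t t<1 (λ k → sixth (suc k)) (λ k → ≡.refl)) ,
  almost-all-infinite (λ k → sixth (suc k)) (λ k → ≡.refl)
  where open LowerBound em R
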